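{- Let $n,k$ be natural numbers with $n\ge2$ and let $\mathcal{A}\subseteq[k]^n$ be a transitive-symmetric vector-intersecting family. If $2\log n\le k\le\sqrt n\log n$, then $\frac{|\mathcal{A}|}{k^n}\le128\exp\left(-\frac{0.0001k}{\log n}\right)$. If $k>\sqrt n\log n$, then $\frac{|\mathcal{A}|}{k^n}\le128\exp(-0.0001\sqrt n)$.
   Context: $\log$ natural. $\mathcal{A}\subseteq[k]^n$ is vector-intersecting if for all $x,y\in\mathcal{A}$ there is $i\in[n]$ with $x_i=y_i$. It is transitive-symmetric if for all $i,j\in[n]$ there is a permutation $\sigma$ of $[n]$ with $\sigma(i)=j$ such that $(x_1,\dots,x_n)\in\mathcal{A}\iff(x_{\sigma(1)},\dots,x_{\sigma(n)})\in\mathcal{A}$. -}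

module Defs where

open import Algebra.Bundles using (CommutativeRing; CommutativeSemiring)
import Algebra.Properties.CommutativeSemiring.Exp as CommutativeExp
import Algebra.Properties.Semiring.Exp as Exp
open import Data.Empty using (⊥-elim)
open import Data.Fin using (Fin)
open import Data.Fin.Permutation using (Permutation′; _⟨$⟩ʳ_)
import Data.Integer as ℤ
import Data.Integer.Properties as ℤ
open import Data.List using (List; length)
open import Data.List.Membership.Propositional using (_∈_)
open import Data.Nat as ℕ using (ℕ; zero; suc)
import Data.Nat.Properties as ℕ
open import Data.Product using (∃; Σ-syntax; ∃-syntax; _×_; _,_; proj₁; proj₂)
open import Data.Rational hiding (truncate; round)
open import Data.Rational.Properties
import Data.Rational.Solver as Solver
import Data.Rational.Unnormalised as ℚᵘ
import Data.Rational.Unnormalised.Properties as ℚᵘ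
open import Data.Sum using (_⊎_; inj₁; inj₂; [_,_]′)
open import Data.Vec using (Vec; lookup; tabulate)
open import Function using (_⇔_; mk⇔; Equivalence; _∘_)
open import Relation.Binary using (tri<; tri≈; tri>)
open import Relation.Binary.PropositionalEquality
open import Relation.Nullary using (¬_; yes; no; contradiction)

open Solver.+-*-Solver using (solve; con; _:=_; _:+_; _:*_; _:-_; :-_)

ℚ-commutativeSemiring : CommutativeSemiring _ _
ℚ-commutativeSemiring = CommutativeRing.commutativeSemiring +-*-commutativeRing

open Exp (CommutativeSemiring.semiring ℚ-commutativeSemiring) using (_^_; ^-assocʳ)
open CommutativeExp ℚ-commutativeSemiring using (^-distrib-*)

0≤1ℚ : 0ℚ ≤ 1ℚ
0≤1ℚ = nonNegative⁻¹ 1ℚ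

0<1ℚ : 0ℚ < 1ℚ
0<1ℚ = positive⁻¹ 1ℚ

0<½ : 0ℚ < ½
0<½ = positive⁻¹ ½

opaque
  p≤q⇒0≤q-p : ∀ {p q} → p ≤ q → 0ℚ ≤ q - p
  p≤q⇒0≤q-p {p} {q} p≤q = subst (_≤ q - p) (+-inverseʳ p) (+-monoˡ-≤ (- p) p≤q)

opaque
  p<q⇒0<q-p : ∀ {p q} → p < q → 0ℚ < q - p
  p<q⇒0<q-p {p} {q} p<q = subst (_< q - p) (+-inverseʳ p) (+-monoˡ-< (- p) p<q)

-- p ≤ q (p < q) follows from an expression of q - p that is visibly
-- nonnegative (positive).
opaque
  by-≤ : ∀ {p q} d → q - p ≡ d → 0ℚ ≤ d → p ≤ q
  by-≤ {p} {q} d eq 0≤d = subst₂ _≤_ (+-identityʳ p)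
    (trans (cong (p +_) (sym eq)) (solve 2 (λ p q → p :+ (q :- p) := q) refl p q))
    (+-monoʳ-≤ p 0≤d)

opaque
  by-< : ∀ {p q} d → q - p ≡ d → 0ℚ < d → p < q
  by-< {p} {q} d eq 0<d = subst₂ _<_ (+-identityʳ p)
    (trans (cong (p +_) (sym eq)) (solve 2 (λ p q → p :+ (q :- p) := q) refl p q))
    (+-monoʳ-< p 0<d)

0≤+ : ∀ {p q} → 0ℚ ≤ p → 0ℚ ≤ q → 0ℚ ≤ p + q
0≤+ = +-mono-≤

0<+ : ∀ {p q} → 0ℚ ≤ p → 0ℚ < q → 0ℚ < p + q
0<+ = +-mono-≤-<

0≤* : ∀ {p q} → 0ℚ ≤ p → 0ℚ ≤ q → 0ℚ ≤ p * q
0≤* {p} {q} 0≤p 0≤q = nonNegative⁻¹ (p * q)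
  {{nonNeg*nonNeg⇒nonNeg p {{nonNegative 0≤p}} q {{nonNegative 0≤q}}}}

0<* : ∀ {p q} → 0ℚ < p → 0ℚ < q → 0ℚ < p * q
0<* {p} {q} 0<p 0<q = positive⁻¹ (p * q)
  {{pos*pos⇒pos p {{positive 0<p}} q {{positive 0<q}}}}

opaque
  0≤p² : ∀ p → 0ℚ ≤ p * p
  0≤p² p with ≤-total 0ℚ p
  ... | inj₁ 0≤p = 0≤* 0≤p 0≤p
  ... | inj₂ p≤0 = subst (0ℚ ≤_) (solve 1 (λ p → (:- p) :* (:- p) := p :* p) refl p)
                     (0≤* (neg-antimono-≤ p≤0) (neg-antimono-≤ p≤0))

opaque
  *-mono-≤-0≤ : ∀ {p q r s} → 0ℚ ≤ r → 0ℚ ≤ q → p ≤ q → r ≤ s → p * r ≤ q * s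
  *-mono-≤-0≤ {p} {q} {r} {s} 0≤r 0≤q p≤q r≤s = by-≤ ((q - p) * r + q * (s - r))
    (solve 4 (λ p q r s → q :* s :- p :* r := (q :- p) :* r :+ q :* (s :- r)) refl p q r s)
    (0≤+ (0≤* (p≤q⇒0≤q-p p≤q) 0≤r) (0≤* 0≤q (p≤q⇒0≤q-p r≤s)))

opaque
  0<pq⇒0<p : ∀ {p q} → 0ℚ < p * q → 0ℚ ≤ q → 0ℚ < p
  0<pq⇒0<p {p} {q} 0<pq 0≤q with 0ℚ <? p
  ... | yes 0<p = 0<p
  ... | no ¬0<p = ⊥-elim (<-irrefl refl (<-≤-trans 0<pq
                    (subst (p * q ≤_) (*-zeroˡ q)
                      (*-monoʳ-≤-nonNeg q {{nonNegative 0≤q}} (≮⇒≥ ¬0<p)))))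

opaque
  inverse : ∀ {p} → 0ℚ < p → ∃[ q ] 0ℚ < q × p * q ≡ 1ℚ
  inverse {p} 0<p = 1/ p , positive⁻¹ (1/ p) {{1/pos⇒pos p}} , *-inverseʳ p
    where instance
      _ : Positive p
      _ = positive 0<p
      _ : NonZero p
      _ = pos⇒nonZero p

fromℕᵣ : ℕ → ℚ
fromℕᵣ n = ℤ.+ n / 1

fromℕᵣ-suc : ∀ n → fromℕᵣ (suc n) ≡ 1ℚ + fromℕᵣ n
fromℕᵣ-suc n = toℚᵘ-injective (begin
  toℚᵘ (fromℕᵣ (suc n))           ≈⟨ toℚᵘ-fromℚᵘ (ℚᵘ.mkℚᵘ (ℤ.+ suc n) 0) ⟩
  ℚᵘ.mkℚᵘ (ℤ.+ suc n) 0           ≈⟨ ℚᵘ.*≡* (cong (ℤ._* ℤ.1ℤ) (cong (λ m → ℤ.1ℤ ℤ.+ m) (sym (ℤ.*-identityʳ (ℤ.+ n))))) ⟩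
  ℚᵘ.1ℚᵘ ℚᵘ.+ ℚᵘ.mkℚᵘ (ℤ.+ n) 0   ≈⟨ ℚᵘ.+-congʳ ℚᵘ.1ℚᵘ (ℚᵘ.≃-sym (toℚᵘ-fromℚᵘ (ℚᵘ.mkℚᵘ (ℤ.+ n) 0))) ⟩
  ℚᵘ.1ℚᵘ ℚᵘ.+ toℚᵘ (fromℕᵣ n)     ≈⟨ ℚᵘ.≃-sym (toℚᵘ-homo-+ 1ℚ (fromℕᵣ n)) ⟩
  toℚᵘ (1ℚ + fromℕᵣ n)            ∎)
  where open import Relation.Binary.Reasoning.Setoid ℚᵘ.≃-setoid

0≤fromℕᵣ : ∀ n → 0ℚ ≤ fromℕᵣ n
0≤fromℕᵣ n = nonNegative⁻¹ (fromℕᵣ n) {{normalize-nonNeg n 1}}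

0<fromℕᵣ-suc : ∀ n → 0ℚ < fromℕᵣ (suc n)
0<fromℕᵣ-suc n = subst (0ℚ <_) (sym (fromℕᵣ-suc n))
  (subst (_< 1ℚ + fromℕᵣ n) (+-identityʳ 0ℚ) (+-mono-<-≤ 0<1ℚ (0≤fromℕᵣ n)))

1≤fromℕᵣ-suc : ∀ n → 1ℚ ≤ fromℕᵣ (suc n)
1≤fromℕᵣ-suc n = subst₂ _≤_ (+-identityʳ 1ℚ) (sym (fromℕᵣ-suc n)) (+-monoʳ-≤ 1ℚ (0≤fromℕᵣ n))

fromℕᵣ-mono : ∀ {m n} → m ℕ.≤ n → fromℕᵣ m ≤ fromℕᵣ n
fromℕᵣ-mono {n = n} ℕ.z≤n = 0≤fromℕᵣ n
fromℕᵣ-mono {suc m} {suc n} (ℕ.s≤s m≤n) =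
  subst₂ _≤_ (sym (fromℕᵣ-suc m)) (sym (fromℕᵣ-suc n)) (+-monoʳ-≤ 1ℚ (fromℕᵣ-mono m≤n))

opaque
  archimedean : ∀ p → ∃[ n ] p ≤ fromℕᵣ (suc n)
  archimedean p@(mkℚ i d _) = ℤ.∣ i ∣ , toℚᵘ-cancel-≤ (ℚᵘ.≤-respʳ-≃ (ℚᵘ.≃-sym (toℚᵘ-fromℚᵘ i⁺)) p≤i⁺)
    where
    open ℤ.≤-Reasoning
    lem : i ℤ.* ℤ.1ℤ ℤ.≤ ℤ.+ suc ℤ.∣ i ∣ ℤ.* ℤ.+ suc d
    lem = begin
      i ℤ.* ℤ.1ℤ                       ≡⟨ ℤ.*-identityʳ i ⟩
      i                                ≤⟨ i≤∣i∣ i ⟩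
      ℤ.+ ℤ.∣ i ∣                      ≤⟨ ℤ.+≤+ (ℕ.n≤1+n _) ⟩
      ℤ.+ suc ℤ.∣ i ∣                  ≤⟨ ℤ.+≤+ (ℕ.m≤m*n (suc ℤ.∣ i ∣) (suc d)) ⟩
      ℤ.+ (suc ℤ.∣ i ∣ ℕ.* suc d)      ≡⟨ ℤ.pos-* (suc ℤ.∣ i ∣) (suc d) ⟩
      ℤ.+ suc ℤ.∣ i ∣ ℤ.* ℤ.+ suc d    ∎
      where
      i≤∣i∣ : ∀ j → j ℤ.≤ ℤ.+ ℤ.∣ j ∣
      i≤∣i∣ (ℤ.+ n)    = ℤ.≤-refl
      i≤∣i∣ ℤ.-[1+ n ] = ℤ.-≤+

    i⁺ : ℚᵘ.ℚᵘ
    i⁺ = ℚᵘ.mkℚᵘ (ℤ.+ suc ℤ.∣ i ∣) 0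

    p≤i⁺ : toℚᵘ p ℚᵘ.≤ i⁺
    p≤i⁺ = ℚᵘ.*≤* lem

unit-fraction : ∀ n → fromℕᵣ (suc n) * (ℤ.1ℤ / suc n) ≡ 1ℚ
unit-fraction n = toℚᵘ-injective (begin
  toℚᵘ (fromℕᵣ (suc n) * (ℤ.1ℤ / suc n))           ≈⟨ toℚᵘ-homo-* (fromℕᵣ (suc n)) (ℤ.1ℤ / suc n) ⟩
  toℚᵘ (fromℕᵣ (suc n)) ℚᵘ.* toℚᵘ (ℤ.1ℤ / suc n)   ≈⟨ ℚᵘ.*-cong (toℚᵘ-fromℚᵘ (ℚᵘ.mkℚᵘ (ℤ.+ suc n) 0)) (toℚᵘ-fromℚᵘ (ℚᵘ.mkℚᵘ ℤ.1ℤ n)) ⟩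
  ℚᵘ.mkℚᵘ (ℤ.+ suc n) 0 ℚᵘ.* ℚᵘ.mkℚᵘ ℤ.1ℤ n         ≈⟨ ℚᵘ.*≡* (cong ℤ.+_ (trans (cong (ℕ._* 1) (ℕ.*-identityʳ (suc n)))
                                                       (trans (ℕ.*-identityʳ (suc n)) (sym (trans (ℕ.*-identityˡ (1 ℕ.* suc n)) (ℕ.*-identityˡ (suc n))))))) ⟩
  ℚᵘ.1ℚᵘ                                          ∎)
  where open import Relation.Binary.Reasoning.Setoid ℚᵘ.≃-setoid

0≤unit-fraction : ∀ n → 0ℚ ≤ ℤ.1ℤ / suc n
0≤unit-fraction n = nonNegative⁻¹ (ℤ.1ℤ / suc n) {{normalize-nonNeg 1 (suc n)}}

unit-fraction≤1 : ∀ n → ℤ.1ℤ / suc n ≤ 1ℚ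
unit-fraction≤1 n = subst₂ _≤_ (*-identityˡ _) (unit-fraction n)
  (*-mono-≤-0≤ (0≤unit-fraction n) (0≤fromℕᵣ (suc n)) (1≤fromℕᵣ-suc n) ≤-refl)

0≤^ : ∀ {p} n → 0ℚ ≤ p → 0ℚ ≤ p ^ n
0≤^ zero    0≤p = 0≤1ℚ
0≤^ (suc n) 0≤p = 0≤* 0≤p (0≤^ n 0≤p)

0<^ : ∀ {p} n → 0ℚ < p → 0ℚ < p ^ n
0<^ zero    0<p = 0<1ℚ
0<^ (suc n) 0<p = 0<* 0<p (0<^ n 0<p)

^-mono : ∀ {p q} n → 0ℚ ≤ p → p ≤ q → p ^ n ≤ q ^ n
^-mono zero    0≤p p≤q = ≤-refl
^-mono (suc n) 0≤p p≤q = *-mono-≤-0≤ (0≤^ n 0≤p) (≤-trans 0≤p p≤q) p≤q (^-mono n 0≤p p≤q)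

1^ : ∀ n → 1ℚ ^ n ≡ 1ℚ
1^ zero    = refl
1^ (suc n) = trans (*-identityˡ _) (1^ n)

opaque
  bernoulli : ∀ n {h} → 0ℚ ≤ 1ℚ + h → 1ℚ + fromℕᵣ n * h ≤ (1ℚ + h) ^ n
  bernoulli zero    {h} _ = ≤-reflexive (trans (cong (1ℚ +_) (*-zeroˡ h)) (+-identityʳ 1ℚ))
  bernoulli (suc n) {h} 0≤1+h = ≤-trans
    (by-≤ (fromℕᵣ n * (h * h)) (step (fromℕᵣ n) (fromℕᵣ-suc n)) (0≤* (0≤fromℕᵣ n) (0≤p² h)))
    (*-monoˡ-≤-nonNeg (1ℚ + h) {{nonNegative 0≤1+h}} (bernoulli n 0≤1+h))
    where
    step : ∀ m {m⁺} → m⁺ ≡ 1ℚ + m → (1ℚ + h) * (1ℚ + m * h) - (1ℚ + m⁺ * h) ≡ m * (h * h)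
    step m refl = solve 2
      (λ m h → (con 1ℚ :+ h) :* (con 1ℚ :+ m :* h) :- (con 1ℚ :+ (con 1ℚ :+ m) :* h) := m :* (h :* h))
      refl m h

record ℝ : Set₁ where
  field
    L U         : ℚ → Set
    L-inhabited : ∃ L
    U-inhabited : ∃ U
    L-rounded   : ∀ q → L q ⇔ (∃[ r ] q < r × L r)
    U-rounded   : ∀ q → U q ⇔ (∃[ r ] r < q × U r)
    disjoint    : ∀ q → ¬ (L q × U q)
    located     : ∀ {p q} → p < q → L p ⊎ U q

open ℝ

infix 4 _≤ᴿ_ _<ᴿ_

_≤ᴿ_ : ℝ → ℝ → Set
x ≤ᴿ y = ∀ q → L x q → L y q

_<ᴿ_ : ℝ → ℝ → Set
x <ᴿ y = ∃[ q ] U x q × L y q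

L-down : ∀ x {p q} → p < q → L x q → L x p
L-down x {p} {q} p<q q∈L = Equivalence.from (L-rounded x p) (q , p<q , q∈L)

U-up : ∀ x {p q} → p < q → U x p → U x q
U-up x {p} {q} p<q p∈U = Equivalence.from (U-rounded x q) (p , p<q , p∈U)

L<U : ∀ x {p q} → L x p → U x q → p < q
L<U x {p} {q} p∈L q∈U with <-cmp p q
... | tri< p<q _ _  = p<q
... | tri≈ _ refl _ = ⊥-elim (disjoint x p (p∈L , q∈U))
... | tri> _ _ q<p  = ⊥-elim (disjoint x p (p∈L , U-up x q<p q∈U))

-- The real number sup L = inf U, for a set L of lower bounds and a set U
-- of upper bounds.  The rounding in `below` and `above` makes it
-- irrelevant whether L and U contain that number itself.
module _ (L U : ℚ → Set) where

  below above : ℚ → Set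
  below q = ∃[ r ] q < r × L r
  above q = ∃[ r ] r < q × U r

  fromBounds : ∃ L → ∃ U → (∀ {p q} → L p → U q → p ≤ q) →
               (∀ {p q} → p < q → L p ⊎ U q) → ℝ
  fromBounds (l , l∈L) (u , u∈U) L≤U loc = record
    { L           = below
    ; U           = above
    ; L-inhabited = l - 1ℚ , l , by-< 1ℚ (solve 1 (λ l → l :- (l :- con 1ℚ) := con 1ℚ) refl l) 0<1ℚ , l∈L
    ; U-inhabited = u + 1ℚ , u , by-< 1ℚ (solve 1 (λ u → u :+ con 1ℚ :- u := con 1ℚ) refl u) 0<1ℚ , u∈U
    ; L-rounded   = λ q → mk⇔ below⇒ below⇐
    ; U-rounded   = λ q → mk⇔ above⇒ above⇐
    ; disjoint    = λ q → disj
    ; located     = located′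
    }
    where
    below⇒ : ∀ {q} → below q → ∃[ r ] q < r × below r
    below⇒ (s , q<s , s∈L) with <-dense q<s
    ... | r , q<r , r<s = r , q<r , s , r<s , s∈L

    below⇐ : ∀ {q} → (∃[ r ] q < r × below r) → below q
    below⇐ (r , q<r , s , r<s , s∈L) = s , <-trans q<r r<s , s∈L

    above⇒ : ∀ {q} → above q → ∃[ r ] r < q × above r
    above⇒ (s , s<q , s∈U) with <-dense s<q
    ... | r , s<r , r<q = r , r<q , s , s<r , s∈U

    above⇐ : ∀ {q} → (∃[ r ] r < q × above r) → above q
    above⇐ (r , r<q , s , s<r , s∈U) = s , <-trans s<r r<q , s∈U

    disj : ∀ {q} → ¬ (below q × above q)
    disj ((r , q<r , r∈L) , (s , s<q , s∈U)) =
      <-irrefl refl (<-≤-trans (<-trans s<q q<r) (L≤U r∈L s∈U))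

    located′ : ∀ {p q} → p < q → below p ⊎ above q
    located′ p<q with <-dense p<q
    ... | s , p<s , s<q with <-dense s<q
    ... | t , s<t , t<q with loc s<t
    ... | inj₁ s∈L = inj₁ (s , p<s , s∈L)
    ... | inj₂ t∈U = inj₂ (t , t<q , t∈U)

opaque
  steps : ∀ a b {η} → 0ℚ < η → ∃[ n ] b < a + fromℕᵣ n * η
  steps a b {η} 0<η with inverse 0<η
  ... | 1/η , _ , η*1/η≡1 with archimedean ((b - a) * 1/η)
  ... | m , bound = suc (suc m) , bounded (fromℕᵣ (suc m)) (fromℕᵣ-suc (suc m)) bound
    where
    bounded : ∀ k {k⁺} → k⁺ ≡ 1ℚ + k → (b - a) * 1/η ≤ k → b < a + k⁺ * η
    bounded k refl bound = by-< (k * η - (b - a) + η)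
      (solve 4 (λ a b k η → a :+ (con 1ℚ :+ k) :* η :- b := (k :* η :- (b :- a)) :+ η) refl a b k η)
      (0<+ (p≤q⇒0≤q-p b-a≤) 0<η)
      where
      b-a≤ : b - a ≤ k * η
      b-a≤ = subst (_≤ k * η)
        (trans (*-assoc (b - a) 1/η η)
          (trans (cong ((b - a) *_) (trans (*-comm 1/η η) η*1/η≡1)) (*-identityʳ (b - a))))
        (*-monoʳ-≤-nonNeg η {{nonNegative (<⇒≤ 0<η)}} bound)

opaque
  approximate : ∀ x {δ} → 0ℚ < δ → ∃[ r ] L x r × U x (r + δ)
  approximate x {δ} 0<δ with <-dense 0<δ
  ... | η , 0<η , η<δ with L-inhabited x | U-inhabited x
  ... | a , a∈L | b , b∈U with steps a b 0<η
  ... | n , b< = go n a∈L (U-up x b< b∈U)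
    where
    step : ∀ a k {k⁺} → k⁺ ≡ 1ℚ + k → a + k⁺ * η ≡ a + η + k * η
    step a k refl = solve 3 (λ a k η → a :+ (con 1ℚ :+ k) :* η := a :+ η :+ k :* η) refl a k η

    go : ∀ n {a} → L x a → U x (a + fromℕᵣ n * η) → ∃[ r ] L x r × U x (r + δ)
    go zero {a} a∈L a∈U = ⊥-elim (disjoint x a
      (a∈L , subst (U x) (trans (cong (a +_) (*-zeroˡ η)) (+-identityʳ a)) a∈U))
    go (suc n) {a} a∈L u∈U with located x (+-monoʳ-< a η<δ)
    ... | inj₂ a+δ∈U = a , a∈L , a+δ∈U
    ... | inj₁ a+η∈L = go n a+η∈L (subst (U x) (step a (fromℕᵣ n) (fromℕᵣ-suc n)) u∈U)

fromℚ : ℚ → ℝ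
fromℚ a = fromBounds (_≤ a) (a ≤_) (a , ≤-refl) (a , ≤-refl) ≤-trans loc
  where
  loc : ∀ {p q} → p < q → p ≤ a ⊎ a ≤ q
  loc {p} {q} p<q with ≤-total p a
  ... | inj₁ p≤a = inj₁ p≤a
  ... | inj₂ a≤p = inj₂ (≤-trans a≤p (<⇒≤ p<q))

fromℕ : ℕ → ℝ
fromℕ n = fromℚ (fromℕᵣ n)

0ᴿ 1ᴿ : ℝ
0ᴿ = fromℚ 0ℚ
1ᴿ = fromℚ 1ℚ

infix  8 -ᴿ_

-ᴿ_ : ℝ → ℝ
-ᴿ x = fromBounds (λ q → U x (- q)) (λ q → L x (- q))
  (- proj₁ (U-inhabited x) , subst (U x) (sym (neg-involutive _)) (proj₂ (U-inhabited x)))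
  (- proj₁ (L-inhabited x) , subst (L x) (sym (neg-involutive _)) (proj₂ (L-inhabited x)))
  (λ -p∈U -q∈L → <⇒≤ (subst₂ _<_ (neg-involutive _) (neg-involutive _) (neg-antimono-< (L<U x -q∈L -p∈U))))
  (λ p<q → [ inj₂ , inj₁ ]′ (located x (neg-antimono-< p<q)))
  where
  neg-involutive : ∀ p → - (- p) ≡ p
  neg-involutive = solve 1 (λ p → :- (:- p) := p) refl

-- Multiplication: for rationals a < x < b and c < y < d, the product x y lies
-- between the least and the greatest of a c, a d, b c and b d.
record Box (x y : ℝ) : Set where
  field
    {a b c d} : ℚ
    a∈L : L x a
    b∈U : U x b
    c∈L : L y c
    d∈U : U y d

  Corners : (ℚ → Set) → Set
  Corners P = P (a * c) × P (a * d) × P (b * c) × P (b * d)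

open Box using (Corners)

interpolate-≤ : ∀ {a b s t q} → a ≤ s → s ≤ b → q ≤ a * t → q ≤ b * t → q ≤ s * t
interpolate-≤ {t = t} a≤s s≤b q≤at q≤bt with ≤-total 0ℚ t
... | inj₁ 0≤t = ≤-trans q≤at (*-monoʳ-≤-nonNeg t {{nonNegative 0≤t}} a≤s)
... | inj₂ t≤0 = ≤-trans q≤bt (*-monoʳ-≤-nonPos t {{nonPositive t≤0}} s≤b)

interpolate-≥ : ∀ {a b s t q} → a ≤ s → s ≤ b → a * t ≤ q → b * t ≤ q → s * t ≤ q
interpolate-≥ {t = t} a≤s s≤b at≤q bt≤q with ≤-total 0ℚ t
... | inj₁ 0≤t = ≤-trans (*-monoʳ-≤-nonNeg t {{nonNegative 0≤t}} s≤b) bt≤q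
... | inj₂ t≤0 = ≤-trans (*-monoʳ-≤-nonPos t {{nonPositive t≤0}} a≤s) at≤q

box-≤ : ∀ {a b c d s t q} → a ≤ s → s ≤ b → c ≤ t → t ≤ d →
        q ≤ a * c → q ≤ a * d → q ≤ b * c → q ≤ b * d → q ≤ s * t
box-≤ {a} {b} {c} {d} {s} {t} {q} a≤s s≤b c≤t t≤d ac ad bc bd =
  interpolate-≤ a≤s s≤b (side a ac ad) (side b bc bd)
  where
  side : ∀ e → q ≤ e * c → q ≤ e * d → q ≤ e * t
  side e ec ed = subst (q ≤_) (*-comm t e)
    (interpolate-≤ c≤t t≤d (subst (q ≤_) (*-comm e c) ec) (subst (q ≤_) (*-comm e d) ed))

box-≥ : ∀ {a b c d s t q} → a ≤ s → s ≤ b → c ≤ t → t ≤ d →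
        a * c ≤ q → a * d ≤ q → b * c ≤ q → b * d ≤ q → s * t ≤ q
box-≥ {a} {b} {c} {d} {s} {t} {q} a≤s s≤b c≤t t≤d ac ad bc bd =
  interpolate-≥ a≤s s≤b (side a ac ad) (side b bc bd)
  where
  side : ∀ e → e * c ≤ q → e * d ≤ q → e * t ≤ q
  side e ec ed = subst (_≤ q) (*-comm t e)
    (interpolate-≥ c≤t t≤d (subst (_≤ q) (*-comm e c) ec) (subst (_≤ q) (*-comm e d) ed))

L-⊔ : ∀ x {p q} → L x p → L x q → L x (p ⊔ q)
L-⊔ x {p} {q} p∈L q∈L with ⊔-sel p q
... | inj₁ eq = subst (L x) (sym eq) p∈L
... | inj₂ eq = subst (L x) (sym eq) q∈L

opaque
  half : ∀ {ε} → 0ℚ < ε → ∃[ ε′ ] 0ℚ < ε′ × ε′ + ε′ ≡ ε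
  half {ε} 0<ε = ½ * ε , 0<* 0<½ 0<ε , trans (sym (*-distribʳ-+ ε ½ ½)) (*-identityˡ ε)

p≤∣p∣ : ∀ p → p ≤ ∣ p ∣
p≤∣p∣ p with ≤-total 0ℚ p
... | inj₁ 0≤p = ≤-reflexive (sym (0≤p⇒∣p∣≡p 0≤p))
... | inj₂ p≤0 = ≤-trans p≤0 (0≤∣p∣ p)

-∣p∣≤p : ∀ p → - ∣ p ∣ ≤ p
-∣p∣≤p p = subst (- ∣ p ∣ ≤_) (solve 1 (λ p → :- (:- p) := p) refl p)
  (neg-antimono-≤ (subst (- p ≤_) (∣-p∣≡∣p∣ p) (p≤∣p∣ (- p))))

module _ (x y : ℝ) where

  *-lower *-upper : ℚ → Set
  *-lower q = Σ[ B ∈ Box x y ] Corners B (q ≤_)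
  *-upper q = Σ[ B ∈ Box x y ] Corners B (_≤ q)

  box : Box x y
  box = record
    { a∈L = proj₂ (L-inhabited x) ; b∈U = proj₂ (U-inhabited x)
    ; c∈L = proj₂ (L-inhabited y) ; d∈U = proj₂ (U-inhabited y) }

  *-lower-inhabited : ∃ *-lower
  *-lower-inhabited = ac ⊓ ad ⊓ (bc ⊓ bd) , box ,
    ≤-trans (p⊓q≤p (ac ⊓ ad) (bc ⊓ bd)) (p⊓q≤p ac ad) ,
    ≤-trans (p⊓q≤p (ac ⊓ ad) (bc ⊓ bd)) (p⊓q≤q ac ad) ,
    ≤-trans (p⊓q≤q (ac ⊓ ad) (bc ⊓ bd)) (p⊓q≤p bc bd) ,
    ≤-trans (p⊓q≤q (ac ⊓ ad) (bc ⊓ bd)) (p⊓q≤q bc bd)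
    where
    open Box box
    ac = a * c
    ad = a * d
    bc = b * c
    bd = b * d

  *-upper-inhabited : ∃ *-upper
  *-upper-inhabited = ac ⊔ ad ⊔ (bc ⊔ bd) , box ,
    ≤-trans (p≤p⊔q ac ad) (p≤p⊔q (ac ⊔ ad) (bc ⊔ bd)) ,
    ≤-trans (p≤q⊔p ac ad) (p≤p⊔q (ac ⊔ ad) (bc ⊔ bd)) ,
    ≤-trans (p≤p⊔q bc bd) (p≤q⊔p (ac ⊔ ad) (bc ⊔ bd)) ,
    ≤-trans (p≤q⊔p bc bd) (p≤q⊔p (ac ⊔ ad) (bc ⊔ bd))
    where
    open Box box
    ac = a * c
    ad = a * d
    bc = b * c
    bd = b * d

  *-consistent : ∀ {p q} → *-lower p → *-upper q → p ≤ q
  *-consistent (B , ac , ad , bc , bd) (B′ , ac′ , ad′ , bc′ , bd′) = ≤-trans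
    (box-≤ (p≤p⊔q B.a B′.a) (<⇒≤ (L<U x s∈L B.b∈U)) (p≤p⊔q B.c B′.c) (<⇒≤ (L<U y t∈L B.d∈U)) ac ad bc bd)
    (box-≥ (p≤q⊔p B.a B′.a) (<⇒≤ (L<U x s∈L B′.b∈U)) (p≤q⊔p B.c B′.c) (<⇒≤ (L<U y t∈L B′.d∈U)) ac′ ad′ bc′ bd′)
    where
    module B = Box B
    module B′ = Box B′
    s∈L = L-⊔ x B.a∈L B′.a∈L
    t∈L = L-⊔ y B.c∈L B′.c∈L

  -- A square box of side δ ≤ 1 whose vertices are bounded by M has
  -- corner products within δ * (M + M + 1) of each other.
  module Spread {δ M ε : ℚ} (0≤δ : 0ℚ ≤ δ) (δ≤1 : δ ≤ 1ℚ) (0≤M : 0ℚ ≤ M)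
                (small : δ * (M + M + 1ℚ) ≤ ε) where

    module _ {e} (-M≤e : - M ≤ e) (e≤M : e ≤ M) where

      δe≤δM : δ * e ≤ δ * M
      δe≤δM = *-monoˡ-≤-nonNeg δ {{nonNegative 0≤δ}} e≤M

      -δM≤δe : δ * - M ≤ δ * e
      -δM≤δe = *-monoˡ-≤-nonNeg δ {{nonNegative 0≤δ}} -M≤e

    0≤δM : 0ℚ ≤ δ * M
    0≤δM = 0≤* 0≤δ 0≤M

    δ²≤δ : δ * δ ≤ δ
    δ²≤δ = subst (δ * δ ≤_) (*-identityʳ δ) (*-monoˡ-≤-nonNeg δ {{nonNegative 0≤δ}} δ≤1)

    module _ {a c} (-M≤a : - M ≤ a) (a≤M : a ≤ M) (-M≤c : - M ≤ c) (c≤M : c ≤ M) where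

      slack : 0ℚ ≤ ε - (δ * M + δ * M + δ)
      slack = subst (λ z → 0ℚ ≤ ε - z)
        (solve 2 (λ δ M → δ :* (M :+ M :+ con 1ℚ) := δ :* M :+ δ :* M :+ δ) refl δ M)
        (p≤q⇒0≤q-p small)

      above-ad : a * c - ε ≤ a * (c + δ)
      above-ad = by-≤ ((δ * a - δ * - M) + δ * M + δ + (ε - (δ * M + δ * M + δ)))
        (solve 5 (λ a c δ M ε → a :* (c :+ δ) :- (a :* c :- ε) :=
          (δ :* a :- δ :* (:- M)) :+ δ :* M :+ δ :+ (ε :- (δ :* M :+ δ :* M :+ δ))) refl a c δ M ε)
        (0≤+ (0≤+ (0≤+ (p≤q⇒0≤q-p (-δM≤δe -M≤a a≤M)) 0≤δM) 0≤δ) slack)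

      above-bc : a * c - ε ≤ (a + δ) * c
      above-bc = by-≤ ((δ * c - δ * - M) + δ * M + δ + (ε - (δ * M + δ * M + δ)))
        (solve 5 (λ a c δ M ε → (a :+ δ) :* c :- (a :* c :- ε) :=
          (δ :* c :- δ :* (:- M)) :+ δ :* M :+ δ :+ (ε :- (δ :* M :+ δ :* M :+ δ))) refl a c δ M ε)
        (0≤+ (0≤+ (0≤+ (p≤q⇒0≤q-p (-δM≤δe -M≤c c≤M)) 0≤δM) 0≤δ) slack)

      above-bd : a * c - ε ≤ (a + δ) * (c + δ)
      above-bd = by-≤ ((δ * a - δ * - M) + (δ * c - δ * - M) + δ * δ + δ + (ε - (δ * M + δ * M + δ)))
        (solve 5 (λ a c δ M ε → (a :+ δ) :* (c :+ δ) :- (a :* c :- ε) :=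
          (δ :* a :- δ :* (:- M)) :+ (δ :* c :- δ :* (:- M)) :+ δ :* δ :+ δ :+ (ε :- (δ :* M :+ δ :* M :+ δ)))
          refl a c δ M ε)
        (0≤+ (0≤+ (0≤+ (0≤+ (p≤q⇒0≤q-p (-δM≤δe -M≤a a≤M)) (p≤q⇒0≤q-p (-δM≤δe -M≤c c≤M))) (0≤* 0≤δ 0≤δ)) 0≤δ) slack)

      below-ad : a * (c + δ) ≤ a * c + ε
      below-ad = by-≤ ((δ * M - δ * a) + δ * M + δ + (ε - (δ * M + δ * M + δ)))
        (solve 5 (λ a c δ M ε → a :* c :+ ε :- a :* (c :+ δ) :=
          (δ :* M :- δ :* a) :+ δ :* M :+ δ :+ (ε :- (δ :* M :+ δ :* M :+ δ))) refl a c δ M ε)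
        (0≤+ (0≤+ (0≤+ (p≤q⇒0≤q-p (δe≤δM -M≤a a≤M)) 0≤δM) 0≤δ) slack)

      below-bc : (a + δ) * c ≤ a * c + ε
      below-bc = by-≤ ((δ * M - δ * c) + δ * M + δ + (ε - (δ * M + δ * M + δ)))
        (solve 5 (λ a c δ M ε → a :* c :+ ε :- (a :+ δ) :* c :=
          (δ :* M :- δ :* c) :+ δ :* M :+ δ :+ (ε :- (δ :* M :+ δ :* M :+ δ))) refl a c δ M ε)
        (0≤+ (0≤+ (0≤+ (p≤q⇒0≤q-p (δe≤δM -M≤c c≤M)) 0≤δM) 0≤δ) slack)

      below-bd : (a + δ) * (c + δ) ≤ a * c + ε
      below-bd = by-≤ ((δ * M - δ * a) + (δ * M - δ * c) + (δ - δ * δ) + (ε - (δ * M + δ * M + δ)))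
        (solve 5 (λ a c δ M ε → a :* c :+ ε :- (a :+ δ) :* (c :+ δ) :=
          (δ :* M :- δ :* a) :+ (δ :* M :- δ :* c) :+ (δ :- δ :* δ) :+ (ε :- (δ :* M :+ δ :* M :+ δ)))
          refl a c δ M ε)
        (0≤+ (0≤+ (0≤+ (p≤q⇒0≤q-p (δe≤δM -M≤a a≤M)) (p≤q⇒0≤q-p (δe≤δM -M≤c c≤M))) (p≤q⇒0≤q-p δ²≤δ)) slack)

  opaque
    bounded : ∀ z → ∃[ M ] 0ℚ ≤ M × (∀ {δ e} → 0ℚ ≤ δ → δ ≤ 1ℚ → L z e → U z (e + δ) → - M ≤ e × e ≤ M)
    bounded z with L-inhabited z | U-inhabited z
    ... | l , l∈L | u , u∈U = M , 0≤M , bound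
      where
      M : ℚ
      M = ∣ l ∣ + ∣ u ∣ + 1ℚ
      0≤M : 0ℚ ≤ M
      0≤M = 0≤+ (0≤+ (0≤∣p∣ l) (0≤∣p∣ u)) 0≤1ℚ

      bound : ∀ {δ e} → 0ℚ ≤ δ → δ ≤ 1ℚ → L z e → U z (e + δ) → - M ≤ e × e ≤ M
      bound {δ} {e} 0≤δ δ≤1 e∈L e+δ∈U =
        by-≤ ((e + δ - l) + (l - - ∣ l ∣) + ∣ u ∣ + (1ℚ - δ))
          (solve 5 (λ e δ l ∣l∣ ∣u∣ → e :- (:- (∣l∣ :+ ∣u∣ :+ con 1ℚ)) :=
            (e :+ δ :- l) :+ (l :- (:- ∣l∣)) :+ ∣u∣ :+ (con 1ℚ :- δ)) refl e δ l ∣ l ∣ ∣ u ∣)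
          (0≤+ (0≤+ (0≤+ (p≤q⇒0≤q-p (<⇒≤ (L<U z l∈L e+δ∈U))) (p≤q⇒0≤q-p (-∣p∣≤p l))) (0≤∣p∣ u)) (p≤q⇒0≤q-p δ≤1)) ,
        by-≤ ((u - e) + (∣ u ∣ - u) + ∣ l ∣ + 1ℚ)
          (solve 4 (λ e u ∣l∣ ∣u∣ → ∣l∣ :+ ∣u∣ :+ con 1ℚ :- e :=
            (u :- e) :+ (∣u∣ :- u) :+ ∣l∣ :+ con 1ℚ) refl e u ∣ l ∣ ∣ u ∣)
          (0≤+ (0≤+ (0≤+ (p≤q⇒0≤q-p (<⇒≤ (L<U z e∈L u∈U))) (p≤q⇒0≤q-p (p≤∣p∣ u))) (0≤∣p∣ l)) 0≤1ℚ)

  opaque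
    scale : ∀ {M ε} → 0ℚ ≤ M → 0ℚ < ε → ∃[ δ ] 0ℚ < δ × δ ≤ 1ℚ × δ * (M + M + 1ℚ) ≤ ε
    scale {M} {ε} 0≤M 0<ε with inverse (0<+ (0≤+ (0≤+ 0≤M 0≤M) 0≤1ℚ) 0<ε)
    ... | η , 0<η , Kη≡1 = ε * η , 0<* 0<ε 0<η ,
      by-≤ ((M + M + 1ℚ) * η)
        (trans (cong (_- ε * η) (sym Kη≡1))
          (solve 3 (λ M ε η → (M :+ M :+ con 1ℚ :+ ε) :* η :- ε :* η := (M :+ M :+ con 1ℚ) :* η) refl M ε η))
        (0≤* (0≤+ (0≤+ 0≤M 0≤M) 0≤1ℚ) (<⇒≤ 0<η)) ,
      by-≤ (ε * (ε * η))
        (trans (cong (_- ε * η * (M + M + 1ℚ)) (trans (sym (*-identityʳ ε)) (cong (ε *_) (sym Kη≡1))))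
          (solve 3 (λ M ε η → ε :* ((M :+ M :+ con 1ℚ :+ ε) :* η) :- ε :* η :* (M :+ M :+ con 1ℚ) := ε :* (ε :* η))
            refl M ε η))
        (0≤* (<⇒≤ 0<ε) (0≤* (<⇒≤ 0<ε) (<⇒≤ 0<η)))

  module _ {p q ε δ M : ℚ} (0<ε : 0ℚ < ε) (2ε≡q-p : ε + ε ≡ q - p)
           (0<δ : 0ℚ < δ) (δ≤1 : δ ≤ 1ℚ) (0≤M : 0ℚ ≤ M) (small : δ * (M + M + 1ℚ) ≤ ε)
           {a c : ℚ} (B : L x a × U x (a + δ) × L y c × U y (c + δ))
           (-M≤a : - M ≤ a) (a≤M : a ≤ M) (-M≤c : - M ≤ c) (c≤M : c ≤ M) where

    open Spread {δ} {M} {ε} (<⇒≤ 0<δ) δ≤1 0≤M small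

    square : Box x y
    square = record
      { a∈L = proj₁ B ; b∈U = proj₁ (proj₂ B)
      ; c∈L = proj₁ (proj₂ (proj₂ B)) ; d∈U = proj₂ (proj₂ (proj₂ B)) }

    square-lower : p + ε ≤ a * c → *-lower p
    square-lower p+ε≤ac = square ,
      ≤-trans p≤ (by-≤ ε (solve 2 (λ s ε → s :- (s :- ε) := ε) refl (a * c) ε) (<⇒≤ 0<ε)) ,
      ≤-trans p≤ (above-ad -M≤a a≤M -M≤c c≤M) ,
      ≤-trans p≤ (above-bc -M≤a a≤M -M≤c c≤M) ,
      ≤-trans p≤ (above-bd -M≤a a≤M -M≤c c≤M)
      where
      p≤ : p ≤ a * c - ε
      p≤ = by-≤ (a * c - (p + ε)) (solve 3 (λ s p ε → s :- ε :- p := s :- (p :+ ε)) refl (a * c) p ε)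
             (p≤q⇒0≤q-p p+ε≤ac)

    square-upper : a * c ≤ p + ε → *-upper q
    square-upper ac≤p+ε = square ,
      ≤-trans (by-≤ ε (solve 2 (λ s ε → s :+ ε :- s := ε) refl (a * c) ε) (<⇒≤ 0<ε)) ≤q ,
      ≤-trans (below-ad -M≤a a≤M -M≤c c≤M) ≤q ,
      ≤-trans (below-bc -M≤a a≤M -M≤c c≤M) ≤q ,
      ≤-trans (below-bd -M≤a a≤M -M≤c c≤M) ≤q
      where
      ≤q : a * c + ε ≤ q
      ≤q = subst (a * c + ε ≤_)
        (trans (solve 2 (λ p ε → p :+ ε :+ ε := p :+ (ε :+ ε)) refl p ε)
          (trans (cong (p +_) 2ε≡q-p) (solve 2 (λ p q → p :+ (q :- p) := q) refl p q)))
        (+-monoˡ-≤ ε ac≤p+ε)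

    square-decides : *-lower p ⊎ *-upper q
    square-decides with ≤-total (p + ε) (a * c)
    ... | inj₁ p+ε≤ac = inj₁ (square-lower p+ε≤ac)
    ... | inj₂ ac≤p+ε = inj₂ (square-upper ac≤p+ε)

  widenˡ : ∀ {m n e} → 0ℚ ≤ n → - m ≤ e × e ≤ m → - (m + n) ≤ e × e ≤ m + n
  widenˡ {m} {n} 0≤n (-m≤e , e≤m) =
    ≤-trans (by-≤ n (solve 2 (λ m n → (:- m) :- (:- (m :+ n)) := n) refl m n) 0≤n) -m≤e ,
    ≤-trans e≤m (by-≤ n (solve 2 (λ m n → m :+ n :- m := n) refl m n) 0≤n)

  widenʳ : ∀ {m n e} → 0ℚ ≤ m → - n ≤ e × e ≤ n → - (m + n) ≤ e × e ≤ m + n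
  widenʳ {m} {n} {e} 0≤m b = subst (λ k → - k ≤ e × e ≤ k) (+-comm n m) (widenˡ 0≤m b)

  *-located : ∀ {p q} → p < q → *-lower p ⊎ *-upper q
  *-located {p} {q} p<q =
    let ε , 0<ε , 2ε≡q-p = half (p<q⇒0<q-p p<q)
        M₁ , 0≤M₁ , bound₁ = bounded x
        M₂ , 0≤M₂ , bound₂ = bounded y
        0≤M = 0≤+ {M₁} {M₂} 0≤M₁ 0≤M₂
        δ , 0<δ , δ≤1 , small = scale {M₁ + M₂} {ε} 0≤M 0<ε
        a , a∈L , a+δ∈U = approximate x 0<δ
        c , c∈L , c+δ∈U = approximate y 0<δ
        -M≤a , a≤M = widenˡ {M₁} {M₂} {a} 0≤M₂ (bound₁ {δ} {a} (<⇒≤ 0<δ) δ≤1 a∈L a+δ∈U)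
        -M≤c , c≤M = widenʳ {M₁} {M₂} {c} 0≤M₁ (bound₂ {δ} {c} (<⇒≤ 0<δ) δ≤1 c∈L c+δ∈U)
    in square-decides {p} {q} {ε} {δ} {M₁ + M₂} 0<ε 2ε≡q-p 0<δ δ≤1 0≤M small {a} {c} (a∈L , a+δ∈U , c∈L , c+δ∈U) -M≤a a≤M -M≤c c≤M

  product : ℝ
  product = fromBounds *-lower *-upper *-lower-inhabited *-upper-inhabited *-consistent *-located

infixl 7 _*ᴿ_

_*ᴿ_ : ℝ → ℝ → ℝ
_*ᴿ_ = product

0<⇒∃L : ∀ x → 0ᴿ <ᴿ x → ∃[ s ] 0ℚ < s × L x s
0<⇒∃L x (q , (r , r<q , 0≤r) , q∈L) = q , ≤-<-trans 0≤r r<q , q∈L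

opaque
  p≤q-from-* : ∀ {p q a b} → 0ℚ < a → a < b → p * b ≤ 1ℚ → 1ℚ ≤ q * a → p ≤ q
  p≤q-from-* {p} {q} {a} {b} 0<a a<b pb≤1 1≤qa with p ≤? q
  ... | yes p≤q = p≤q
  ... | no p≰q = ⊥-elim (<-irrefl refl (<-≤-trans
          (*-monoʳ-<-pos q {{positive 0<q}} a<b)
          (≤-trans (*-monoʳ-≤-nonNeg b {{nonNegative (<⇒≤ (<-trans 0<a a<b))}} (<⇒≤ (≰⇒> p≰q)))
            (≤-trans pb≤1 1≤qa))))
    where
    0<q : 0ℚ < q
    0<q = 0<pq⇒0<p (<-≤-trans 0<1ℚ 1≤qa) (<⇒≤ 0<a)

opaque
  inverse-antitone : ∀ {p q a b} → p < q → 0ℚ < a → 0ℚ < b → p * b ≡ 1ℚ → q * a ≡ 1ℚ → a < b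
  inverse-antitone {p} {q} {a} {b} p<q 0<a 0<b pb≡1 qa≡1 = by-< ((q - p) * (a * b))
    (trans (cong₂ _-_ (trans (sym (*-identityʳ b)) (cong (b *_) (sym qa≡1)))
                      (trans (sym (*-identityʳ a)) (cong (a *_) (sym pb≡1))))
      (solve 4 (λ p q a b → b :* (q :* a) :- a :* (p :* b) := (q :- p) :* (a :* b)) refl p q a b))
    (0<* (p<q⇒0<q-p p<q) (0<* 0<a 0<b))

module _ (x : ℝ) where

  recip-lower recip-upper : ℚ → Set
  recip-lower q = q ≤ 0ℚ ⊎ (∃[ b ] U x b × q * b ≤ 1ℚ)
  recip-upper q = ∃[ a ] L x a × 0ℚ < a × 1ℚ ≤ q * a

  inverse-upper : ∃[ a ] 0ℚ < a × L x a → ∃ recip-upper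
  inverse-upper (a , 0<a , a∈L) =
    let q , 0<q , aq≡1 = inverse {a} 0<a
    in q , a , a∈L , 0<a , ≤-reflexive (trans (sym aq≡1) (*-comm a q))

  recip-consistent : ∀ {p q} → recip-lower p → recip-upper q → p ≤ q
  recip-consistent {p} {q} (inj₁ p≤0) (a , _ , 0<a , 1≤qa) =
    ≤-trans p≤0 (<⇒≤ (0<pq⇒0<p {q} {a} (<-≤-trans 0<1ℚ 1≤qa) (<⇒≤ 0<a)))
  recip-consistent {p} {q} (inj₂ (b , b∈U , pb≤1)) (a , a∈L , 0<a , 1≤qa) =
    p≤q-from-* {p} {q} {a} {b} 0<a (L<U x a∈L b∈U) pb≤1 1≤qa

  recip-locate : ∀ {p q} → p < q → (∃[ b ] 0ℚ < b × p * b ≡ 1ℚ) → (∃[ a ] 0ℚ < a × q * a ≡ 1ℚ) → recip-lower p ⊎ recip-upper q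
  recip-locate {p} {q} p<q (b , 0<b , pb≡1) (a , 0<a , qa≡1)
      with located x {a} {b} (inverse-antitone {p} {q} {a} {b} p<q 0<a 0<b pb≡1 qa≡1)
  ... | inj₁ a∈L = inj₂ (a , a∈L , 0<a , ≤-reflexive (sym qa≡1))
  ... | inj₂ b∈U = inj₁ (inj₂ (b , b∈U , ≤-reflexive pb≡1))

  recip-located : ∀ {p q} → p < q → recip-lower p ⊎ recip-upper q
  recip-located {p} {q} p<q with p ≤? 0ℚ
  ... | yes p≤0 = inj₁ (inj₁ p≤0)
  ... | no p≰0  = recip-locate {p} {q} p<q (inverse {p} (≰⇒> p≰0)) (inverse {q} (<-trans (≰⇒> p≰0) p<q))

  recip : 0ᴿ <ᴿ x → ℝ
  recip 0<x = fromBounds recip-lower recip-upper (0ℚ , inj₁ ≤-refl) (inverse-upper (0<⇒∃L x 0<x)) recip-consistent recip-located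

infixl 7 _÷ᴿ_[_]

_÷ᴿ_[_] : (x y : ℝ) → 0ᴿ <ᴿ y → ℝ
x ÷ᴿ y [ 0<y ] = x *ᴿ recip y 0<y

opaque
  p²<q² : ∀ {p q} → 0ℚ < p → p < q → p * p < q * q
  p²<q² {p} {q} 0<p p<q = by-< ((q - p) * (p + q))
    (solve 2 (λ p q → q :* q :- p :* p := (q :- p) :* (p :+ q)) refl p q)
    (0<* (p<q⇒0<q-p p<q) (0<+ (<⇒≤ 0<p) (<-trans 0<p p<q)))

-- The square root of max(x, 0).
√ : ℝ → ℝ
√ x = fromBounds lower upper (0ℚ , inj₁ ≤-refl) (upper-inhabited (U-inhabited x)) lower≤upper √-located
  where
  lower upper : ℚ → Set
  lower q = q ≤ 0ℚ ⊎ L x (q * q)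
  upper q = 0ℚ ≤ q × U x (q * q)

  u<[∣u∣+1]² : ∀ u → u < (∣ u ∣ + 1ℚ) * (∣ u ∣ + 1ℚ)
  u<[∣u∣+1]² u = by-< (∣ u ∣ * ∣ u ∣ + ∣ u ∣ + (∣ u ∣ - u) + 1ℚ)
    (solve 2 (λ u ∣u∣ → (∣u∣ :+ con 1ℚ) :* (∣u∣ :+ con 1ℚ) :- u :=
      ∣u∣ :* ∣u∣ :+ ∣u∣ :+ (∣u∣ :- u) :+ con 1ℚ) refl u ∣ u ∣)
    (0<+ (0≤+ (0≤+ (0≤p² ∣ u ∣) (0≤∣p∣ u)) (p≤q⇒0≤q-p (p≤∣p∣ u))) 0<1ℚ)

  upper-inhabited : ∃ (U x) → ∃ upper
  upper-inhabited (u , u∈U) = ∣ u ∣ + 1ℚ , 0≤+ (0≤∣p∣ u) 0≤1ℚ , U-up x (u<[∣u∣+1]² u) u∈U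

  lower≤upper : ∀ {p q} → lower p → upper q → p ≤ q
  lower≤upper (inj₁ p≤0) (0≤q , _) = ≤-trans p≤0 0≤q
  lower≤upper {p} {q} (inj₂ p²∈L) (0≤q , q²∈U) with p ≤? q
  ... | yes p≤q = p≤q
  ... | no p≰q = ⊥-elim (<-irrefl refl (<-≤-trans (L<U x p²∈L q²∈U)
          (*-mono-≤-0≤ {q} {p} {q} {p} 0≤q (≤-trans 0≤q (<⇒≤ (≰⇒> p≰q))) (<⇒≤ (≰⇒> p≰q)) (<⇒≤ (≰⇒> p≰q)))))

  √-located : ∀ {p q} → p < q → lower p ⊎ upper q
  √-located {p} {q} p<q with p ≤? 0ℚ
  ... | yes p≤0 = inj₁ (inj₁ p≤0)
  ... | no p≰0 with located x {p * p} {q * q} (p²<q² {p} {q} (≰⇒> p≰0) p<q)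
  ... | inj₁ p²∈L = inj₁ (inj₂ p²∈L)
  ... | inj₂ q²∈U = inj₂ (<⇒≤ (<-trans (≰⇒> p≰0) p<q) , q²∈U)

infix 6 1+_÷suc_

1+_÷suc_ : ℚ → ℕ → ℚ
1+ r ÷suc n = 1ℚ + r * (ℤ.1ℤ / suc n)

opaque
  1+u≤[1+uh]^n : ∀ n {u h} → 0ℚ ≤ h → h ≤ 1ℚ → fromℕᵣ n * h ≡ 1ℚ → 0ℚ ≤ 1ℚ + u →
                 0ℚ ≤ 1ℚ + u * h × 1ℚ + u ≤ (1ℚ + u * h) ^ n
  1+u≤[1+uh]^n n {u} {h} 0≤h h≤1 nh≡1 0≤1+u = 0≤1+uh , subst (_≤ (1ℚ + u * h) ^ n)
    (trans (solve 3 (λ k u h → con 1ℚ :+ k :* (u :* h) := con 1ℚ :+ u :* (k :* h)) refl (fromℕᵣ n) u h)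
      (trans (cong (λ z → 1ℚ + u * z) nh≡1) (cong (1ℚ +_) (*-identityʳ u))))
    (bernoulli n {u * h} 0≤1+uh)
    where
    0≤1+uh : 0ℚ ≤ 1ℚ + u * h
    0≤1+uh = subst (0ℚ ≤_)
      (solve 2 (λ u h → (con 1ℚ :- h) :+ h :* (con 1ℚ :+ u) := con 1ℚ :+ u :* h) refl u h)
      (0≤+ (p≤q⇒0≤q-p h≤1) (0≤* 0≤h 0≤1+u))

  1+u≤1+u/n^n : ∀ n {u} → 0ℚ ≤ 1ℚ + u → 0ℚ ≤ 1+ u ÷suc n × 1ℚ + u ≤ (1+ u ÷suc n) ^ suc n
  1+u≤1+u/n^n n {u} = 1+u≤[1+uh]^n (suc n) {u} {ℤ.1ℤ / suc n}
    (0≤unit-fraction n) (unit-fraction≤1 n) (unit-fraction n)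

  product≤1 : ∀ {r s h k} → r ≤ s → 0ℚ ≤ h → 0ℚ ≤ k → 0ℚ ≤ 1ℚ + (- s * k) * h →
              (1ℚ + (r * h) * k) * (1ℚ + (- s * k) * h) ≤ 1ℚ
  product≤1 {r} {s} {h} {k} r≤s 0≤h 0≤k 0≤D =
    by-≤ ((- s * k * h) * (- s * k * h) + (s - r) * (h * k) * (1ℚ + - s * k * h))
      (solve 4 (λ r s h k → con 1ℚ :- (con 1ℚ :+ r :* h :* k) :* (con 1ℚ :+ :- s :* k :* h) :=
        (:- s :* k :* h) :* (:- s :* k :* h) :+ (s :- r) :* (h :* k) :* (con 1ℚ :+ :- s :* k :* h))
        refl r s h k)
      (0≤+ (0≤p² (- s * k * h)) (0≤* (0≤* (p≤q⇒0≤q-p r≤s) (0≤* 0≤h 0≤k)) 0≤D))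

  exp-bounds-product : ∀ m n {r s} → r ≤ s → 0ℚ ≤ 1+ r ÷suc m → 0ℚ ≤ 1+ (- s) ÷suc n →
                       (1+ r ÷suc m) ^ suc m * (1+ (- s) ÷suc n) ^ suc n ≤ 1ℚ
  exp-bounds-product m n {r} {s} r≤s 0≤A 0≤B =
    let h = ℤ.1ℤ / suc m
        k = ℤ.1ℤ / suc n
        C = 1+ (r * h) ÷suc n
        D = 1+ (- s * k) ÷suc m
        0≤C , A≤C^ = 1+u≤1+u/n^n n {r * h} 0≤A
        0≤D , B≤D^ = 1+u≤1+u/n^n m {(- s) * k} 0≤B
        N = suc n ℕ.* suc m
        A^≤ : (1+ r ÷suc m) ^ suc m ≤ C ^ N
        A^≤ = subst ((1+ r ÷suc m) ^ suc m ≤_) (^-assocʳ C (suc n) (suc m)) (^-mono (suc m) 0≤A A≤C^)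
        B^≤ : (1+ (- s) ÷suc n) ^ suc n ≤ D ^ N
        B^≤ = subst ((1+ (- s) ÷suc n) ^ suc n ≤_)
          (trans (^-assocʳ D (suc m) (suc n)) (cong (D ^_) (ℕ.*-comm (suc m) (suc n))))
          (^-mono (suc n) 0≤B B≤D^)
        CD≤1 : C * D ≤ 1ℚ
        CD≤1 = product≤1 {r} {s} {h} {k} r≤s (0≤unit-fraction m) (0≤unit-fraction n) 0≤D
    in ≤-trans
      (*-mono-≤-0≤ {(1+ r ÷suc m) ^ suc m} {C ^ N} {(1+ (- s) ÷suc n) ^ suc n} {D ^ N}
        (0≤^ (suc n) 0≤B) (0≤^ N 0≤C) A^≤ B^≤)
      (subst₂ _≤_ (^-distrib-* C D N) (1^ N) (^-mono N (0≤* 0≤C 0≤D) CD≤1))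

  cancel-bounds : ∀ {p q X Y} → 0ℚ ≤ Y → X * Y ≤ 1ℚ → p ≤ X → 1ℚ ≤ q * Y → p ≤ q
  cancel-bounds {p} {q} {X} {Y} 0≤Y XY≤1 p≤X 1≤qY with ≤-total X q
  ... | inj₁ X≤q = ≤-trans p≤X X≤q
  ... | inj₂ q≤X = ≤-trans p≤X (by-≤ (X * (q * Y - 1ℚ) + q * (1ℚ - X * Y))
      (solve 3 (λ q X Y → q :- X := X :* (q :* Y :- con 1ℚ) :+ q :* (con 1ℚ :- X :* Y)) refl q X Y)
      (0≤+ (0≤* (≤-trans 0≤q q≤X) (p≤q⇒0≤q-p 1≤qY)) (0≤* 0≤q (p≤q⇒0≤q-p XY≤1))))
    where
    0≤q : 0ℚ ≤ q
    0≤q = <⇒≤ (0<pq⇒0<p {q} {Y} (<-≤-trans 0<1ℚ 1≤qY) 0≤Y)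

  0≤1+rh : ∀ {r h k} → 0ℚ ≤ h → k * h ≡ 1ℚ → - r ≤ k → 0ℚ ≤ 1ℚ + r * h
  0≤1+rh {r} {h} {k} 0≤h kh≡1 -r≤k = subst (0ℚ ≤_)
    (trans (solve 3 (λ r h k → (k :- (:- r)) :* h := k :* h :+ r :* h) refl r h k) (cong (_+ r * h) kh≡1))
    (0≤* (p≤q⇒0≤q-p -r≤k) 0≤h)

  0<1-sh : ∀ {s h k} → 0ℚ < h → k * h ≡ 1ℚ → s + 1ℚ ≤ k → 0ℚ < 1ℚ + - s * h
  0<1-sh {s} {h} {k} 0<h kh≡1 s+1≤k = subst (0ℚ <_)
    (trans (solve 3 (λ s h k → (k :- (s :+ con 1ℚ) :+ con 1ℚ) :* h := k :* h :+ :- s :* h) refl s h k) (cong (_+ - s * h) kh≡1))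
    (0<* (0<+ (p≤q⇒0≤q-p s+1≤k) 0<1ℚ) 0<h)

  0<unit-fraction : ∀ n → 0ℚ < ℤ.1ℤ / suc n
  0<unit-fraction n = positive⁻¹ (ℤ.1ℤ / suc n) {{normalize-pos 1 (suc n)}}

  0≤1+r/n : ∀ n {r} → - r ≤ fromℕᵣ (suc n) → 0ℚ ≤ 1+ r ÷suc n
  0≤1+r/n n {r} = 0≤1+rh {r} {ℤ.1ℤ / suc n} {fromℕᵣ (suc n)} (0≤unit-fraction n) (unit-fraction n)

  0<1-s/n : ∀ n {s} → s + 1ℚ ≤ fromℕᵣ (suc n) → 0ℚ < 1+ (- s) ÷suc n
  0<1-s/n n {s} = 0<1-sh {s} {ℤ.1ℤ / suc n} {fromℕᵣ (suc n)} (0<unit-fraction n) (unit-fraction n)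

  large : ∀ p q r → ∃[ n ] p ≤ fromℕᵣ (suc n) × q ≤ fromℕᵣ (suc n) × r ≤ fromℕᵣ (suc n)
  large p q r with archimedean (p ⊔ q ⊔ r)
  ... | n , bound = n ,
    ≤-trans (≤-trans (p≤p⊔q p q) (p≤p⊔q (p ⊔ q) r)) bound ,
    ≤-trans (≤-trans (p≤q⊔p p q) (p≤p⊔q (p ⊔ q) r)) bound ,
    ≤-trans (p≤q⊔p (p ⊔ q) r) bound

  -- With A = 1 + r h, B = 1 - (r + δ) h and H = A B - 1, Bernoulli's
  -- inequality gives q (A B)ⁿ ≥ q (1 + n H) = q - q δ - q r (r + δ) h ≥ p.
  exp-close : ∀ n {p q r δ ε e h} → 0ℚ ≤ h → fromℕᵣ n * h ≡ 1ℚ → 0ℚ ≤ q →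
              0ℚ < ε → ε + ε ≡ q - p → ε * e ≡ 1ℚ → q * δ ≡ ε →
              q * r * (r + δ) * e ≤ fromℕᵣ n → 0ℚ ≤ 1ℚ + r * h → 0ℚ ≤ 1ℚ + - (r + δ) * h →
              p ≤ q * ((1ℚ + r * h) ^ n * (1ℚ + - (r + δ) * h) ^ n)
  exp-close n {p} {q} {r} {δ} {ε} {e} {h} 0≤h nh≡1 0≤q 0<ε 2ε≡ εe≡1 qδ≡ε te≤n 0≤A 0≤B =
    ≤-trans (by-≤ (ε * h * (k - t * e)) difference (0≤* (0≤* (<⇒≤ 0<ε) 0≤h) (p≤q⇒0≤q-p te≤n)))
      (*-monoˡ-≤-nonNeg q {{nonNegative 0≤q}} (subst (1ℚ + k * H ≤_) power
        (bernoulli n {H} (subst (0ℚ ≤_) AB≡1+H (0≤* 0≤A 0≤B)))))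
    where
    k t A B H : ℚ
    k = fromℕᵣ n
    t = q * r * (r + δ)
    A = 1ℚ + r * h
    B = 1ℚ + - (r + δ) * h
    H = - (δ * h) - r * (r + δ) * (h * h)

    AB≡1+H : A * B ≡ 1ℚ + H
    AB≡1+H = solve 3 (λ r δ h → (con 1ℚ :+ r :* h) :* (con 1ℚ :+ :- (r :+ δ) :* h) :=
      con 1ℚ :+ (:- (δ :* h) :- r :* (r :+ δ) :* (h :* h))) refl r δ h

    power : (1ℚ + H) ^ n ≡ A ^ n * B ^ n
    power = trans (cong (_^ n) (sym AB≡1+H)) (^-distrib-* A B n)

    difference : q * (1ℚ + k * H) - p ≡ ε * h * (k - t * e)
    difference = begin
      q * (1ℚ + k * H) - p
        ≡⟨ solve 6 (λ p q r δ h k → q :* (con 1ℚ :+ k :* (:- (δ :* h) :- r :* (r :+ δ) :* (h :* h))) :- p :=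
             (q :- p) :- q :* δ :* (k :* h) :- q :* r :* (r :+ δ) :* (k :* h) :* h) refl p q r δ h k ⟩
      (q - p) - q * δ * (k * h) - t * (k * h) * h
        ≡⟨ cong₂ (λ x y → x - q * δ * y - t * y * h) (sym 2ε≡) nh≡1 ⟩
      (ε + ε) - q * δ * 1ℚ - t * 1ℚ * h
        ≡⟨ cong₂ (λ x y → (ε + ε) - x * 1ℚ - t * y * h) qδ≡ε (sym εe≡1) ⟩
      (ε + ε) - ε * 1ℚ - t * (ε * e) * h
        ≡⟨ solve 4 (λ ε t e h → (ε :+ ε) :- ε :* con 1ℚ :- t :* (ε :* e) :* h := ε :* con 1ℚ :- t :* (ε :* e) :* h) refl ε t e h ⟩
      ε * 1ℚ - t * (ε * e) * h
        ≡⟨ cong (λ x → ε * x - t * (ε * e) * h) (sym nh≡1) ⟩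
      ε * (k * h) - t * (ε * e) * h
        ≡⟨ solve 5 (λ ε t e h k → ε :* (k :* h) :- t :* (ε :* e) :* h := ε :* h :* (k :- t :* e)) refl ε t e h k ⟩
      ε * h * (k - t * e) ∎
      where open ≡-Reasoning

  1≤qY : ∀ {p q X Y} → 0ℚ ≤ X → X ≤ p → 0ℚ < p → p ≤ q * (X * Y) → 0ℚ ≤ Y → 0ℚ ≤ q → 1ℚ ≤ q * Y
  1≤qY {p} {q} {X} {Y} 0≤X X≤p 0<p p≤qXY 0≤Y 0≤q = *-cancelˡ-≤-pos p {{positive 0<p}}
    (subst₂ _≤_ (sym (*-identityʳ p)) refl
      (≤-trans p≤qXY (subst (_≤ p * (q * Y))
        (solve 3 (λ q X Y → X :* (q :* Y) := q :* (X :* Y)) refl q X Y)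
        (*-monoʳ-≤-nonNeg (q * Y) {{nonNegative (0≤* 0≤q 0≤Y)}} X≤p))))

-- exp x is the supremum of (1 + r / n) ^ n over rational r < x and positive
-- integers n with 1 + r / n ≥ 0, and the infimum of (1 - r / n) ^ (- n) over
-- rational r > x and positive integers n with 1 - r / n > 0.
module _ (x : ℝ) where

  exp-lower exp-upper : ℚ → Set
  exp-lower q = ∃[ r ] ∃[ n ] L x r × 0ℚ ≤ 1+ r ÷suc n × q ≤ (1+ r ÷suc n) ^ suc n
  exp-upper q = ∃[ r ] ∃[ n ] U x r × 0ℚ < 1+ (- r) ÷suc n × 1ℚ ≤ q * (1+ (- r) ÷suc n) ^ suc n

  opaque
    exp-lower-nonPos : ∀ {q} → q ≤ 0ℚ → exp-lower q
    exp-lower-nonPos {q} q≤0 =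
      let r , r∈L = L-inhabited x
          n , -r≤n = archimedean (- r)
          0≤A = 0≤1+r/n n {r} -r≤n
      in r , n , r∈L , 0≤A , ≤-trans q≤0 (0≤^ (suc n) 0≤A)

    exp-upper-inhabited : ∃ exp-upper
    exp-upper-inhabited =
      let r , r∈U = U-inhabited x
          n , r+1≤n = archimedean (r + 1ℚ)
          0<B = 0<1-s/n n {r} r+1≤n
          q , 0<q , Bq≡1 = inverse {(1+ (- r) ÷suc n) ^ suc n} (0<^ (suc n) 0<B)
      in q , r , n , r∈U , 0<B , ≤-reflexive (trans (sym Bq≡1) (*-comm ((1+ (- r) ÷suc n) ^ suc n) q))

    exp-consistent : ∀ {p q} → exp-lower p → exp-upper q → p ≤ q
    exp-consistent {p} {q} (r , m , r∈L , 0≤A , p≤) (s , n , s∈U , 0<B , 1≤) =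
      cancel-bounds {p} {q} {(1+ r ÷suc m) ^ suc m} {(1+ (- s) ÷suc n) ^ suc n} (0≤^ (suc n) (<⇒≤ 0<B))
        (exp-bounds-product m n {r} {s} (<⇒≤ (L<U x r∈L s∈U)) 0≤A (<⇒≤ 0<B)) p≤ 1≤

    exp-decide : ∀ {p q r s n} → 0ℚ < p → 0ℚ ≤ q → L x r → U x s → 0ℚ ≤ 1+ r ÷suc n → 0ℚ < 1+ (- s) ÷suc n →
                 p ≤ q * ((1+ r ÷suc n) ^ suc n * (1+ (- s) ÷suc n) ^ suc n) → exp-lower p ⊎ exp-upper q
    exp-decide {p} {q} {r} {s} {n} 0<p 0≤q r∈L s∈U 0≤A 0<B close = [
      (λ p≤A^ → inj₁ (r , n , r∈L , 0≤A , p≤A^)) ,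
      (λ A^≤p → inj₂ (s , n , s∈U , 0<B ,
        1≤qY {p} {q} {(1+ r ÷suc n) ^ suc n} {(1+ (- s) ÷suc n) ^ suc n}
          (0≤^ (suc n) 0≤A) A^≤p 0<p close (0≤^ (suc n) (<⇒≤ 0<B)) 0≤q)) ]′
      (≤-total p ((1+ r ÷suc n) ^ suc n))

    exp-located-pos : ∀ {p q} → 0ℚ < p → p < q → exp-lower p ⊎ exp-upper q
    exp-located-pos {p} {q} 0<p p<q =
      let 0<q = <-trans 0<p p<q
          ε , 0<ε , 2ε≡ = half {q - p} (p<q⇒0<q-p p<q)
          e , 0<e , εe≡1 = inverse {ε} 0<ε
          q⁻¹ , 0<q⁻¹ , qq⁻¹≡1 = inverse {q} 0<q
          δ = q⁻¹ * ε
          r , r∈L , s∈U = approximate x {δ} (0<* {q⁻¹} {ε} 0<q⁻¹ 0<ε)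
          n , -r≤n , s+1≤n , t≤n = large (- r) (r + δ + 1ℚ) (q * r * (r + δ) * e)
          0≤A = 0≤1+r/n n {r} -r≤n
          0<B = 0<1-s/n n {r + δ} s+1≤n
          qδ≡ε = trans (sym (*-assoc q q⁻¹ ε)) (trans (cong (_* ε) qq⁻¹≡1) (*-identityˡ ε))
      in exp-decide {p} {q} {r} {r + δ} {n} 0<p (<⇒≤ 0<q) r∈L s∈U 0≤A 0<B
           (exp-close (suc n) {p} {q} {r} {δ} {ε} {e} {ℤ.1ℤ / suc n} (0≤unit-fraction n) (unit-fraction n)
             (<⇒≤ 0<q) 0<ε 2ε≡ εe≡1 qδ≡ε t≤n 0≤A (<⇒≤ 0<B))

    exp-located : ∀ {p q} → p < q → exp-lower p ⊎ exp-upper q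
    exp-located {p} {q} p<q with p ≤? 0ℚ
    ... | yes p≤0 = inj₁ (exp-lower-nonPos p≤0)
    ... | no p≰0  = exp-located-pos (≰⇒> p≰0) p<q

  exp : ℝ
  exp = fromBounds exp-lower exp-upper (0ℚ , exp-lower-nonPos ≤-refl) exp-upper-inhabited exp-consistent exp-located

opaque
  fromℚ-mono-< : ∀ {p q} → p < q → fromℚ p <ᴿ fromℚ q
  fromℚ-mono-< {p} {q} p<q with <-dense p<q
  ... | m , p<m , m<q = m , (p , p<m , ≤-refl) , (q , m<q , ≤-refl)

  exp-mono-≤ : ∀ {x y} → x ≤ᴿ y → exp x ≤ᴿ exp y
  exp-mono-≤ x≤y q (s , q<s , r , n , r∈L , 0≤A , s≤) = s , q<s , r , n , x≤y r r∈L , 0≤A , s≤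

  fromℚ-mono-≤ : ∀ {p q} → p ≤ q → fromℚ p ≤ᴿ fromℚ q
  fromℚ-mono-≤ p≤q s (t , s<t , t≤p) = t , s<t , ≤-trans t≤p p≤q

  -- With H = (1 + s h) (1 - r h) - 1, Bernoulli's inequality gives
  -- (1 + s h)ⁿ (1 - r h)ⁿ ≥ 1 + n H > 1.
  exp-apart : ∀ n {r s e h} → 0ℚ < h → fromℕᵣ n * h ≡ 1ℚ → r < s → (s - r) * e ≡ 1ℚ →
              r * s * e + 1ℚ ≤ fromℕᵣ n → 0ℚ ≤ 1ℚ + s * h → 0ℚ ≤ 1ℚ + - r * h →
              1ℚ < (1ℚ + s * h) ^ n * (1ℚ + - r * h) ^ n
  exp-apart n {r} {s} {e} {h} 0<h nh≡1 r<s de≡1 bound 0≤A 0≤B =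
    <-≤-trans 1<1+kH (subst (1ℚ + k * H ≤_) power (bernoulli n {H} (subst (0ℚ ≤_) AB≡1+H (0≤* 0≤A 0≤B))))
    where
    k d A B H : ℚ
    k = fromℕᵣ n
    d = s - r
    A = 1ℚ + s * h
    B = 1ℚ + - r * h
    H = d * h - r * s * (h * h)

    AB≡1+H : A * B ≡ 1ℚ + H
    AB≡1+H = solve 3 (λ r s h → (con 1ℚ :+ s :* h) :* (con 1ℚ :+ :- r :* h) :=
      con 1ℚ :+ ((s :- r) :* h :- r :* s :* (h :* h))) refl r s h

    power : (1ℚ + H) ^ n ≡ A ^ n * B ^ n
    power = trans (cong (_^ n) (sym AB≡1+H)) (^-distrib-* A B n)

    difference : 1ℚ + k * H - 1ℚ ≡ d * h * (k - (r * s * e + 1ℚ)) + d * h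
    difference = begin
      1ℚ + k * H - 1ℚ
        ≡⟨ solve 4 (λ r s h k → con 1ℚ :+ k :* ((s :- r) :* h :- r :* s :* (h :* h)) :- con 1ℚ :=
             (s :- r) :* (k :* h) :- r :* s :* (k :* h) :* h) refl r s h k ⟩
      d * (k * h) - r * s * (k * h) * h
        ≡⟨ cong (λ z → d * (k * h) - r * s * z * h) (trans nh≡1 (sym de≡1)) ⟩
      d * (k * h) - r * s * (d * e) * h
        ≡⟨ solve 6 (λ r s d e h k → d :* (k :* h) :- r :* s :* (d :* e) :* h :=
             d :* h :* (k :- (r :* s :* e :+ con 1ℚ)) :+ d :* h) refl r s d e h k ⟩
      d * h * (k - (r * s * e + 1ℚ)) + d * h ∎
      where open ≡-Reasoning

    0<dh : 0ℚ < d * h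
    0<dh = 0<* (p<q⇒0<q-p r<s) 0<h

    1<1+kH : 1ℚ < 1ℚ + k * H
    1<1+kH = by-< (d * h * (k - (r * s * e + 1ℚ)) + d * h) difference
      (0<+ (0≤* (<⇒≤ 0<dh) (p≤q⇒0≤q-p bound)) 0<dh)

  1<XY⇒y⁻¹<X : ∀ {X Y z} → 0ℚ < z → Y * z ≡ 1ℚ → 1ℚ < X * Y → z < X
  1<XY⇒y⁻¹<X {X} {Y} {z} 0<z Yz≡1 1<XY = subst₂ _<_ (*-identityˡ z)
    (trans (*-assoc X Y z) (trans (cong (X *_) Yz≡1) (*-identityʳ X)))
    (*-monoˡ-<-pos z {{positive 0<z}} 1<XY)

  exp-fromℚ-mono-< : ∀ {p q} → p < q → exp (fromℚ p) <ᴿ exp (fromℚ q)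
  exp-fromℚ-mono-< {p} {q} p<q =
    let r , p<r , r<q = <-dense {p} {q} p<q
        s , r<s , s<q = <-dense {r} {q} r<q
        e , 0<e , de≡1 = inverse {s - r} (p<q⇒0<q-p r<s)
        n , -s≤n , r+1≤n , bound = large (- s) (r + 1ℚ) (r * s * e + 1ℚ)
        0≤A = 0≤1+r/n n {s} -s≤n
        0<B = 0<1-s/n n {r} r+1≤n
        X = (1+ s ÷suc n) ^ suc n
        Y = (1+ (- r) ÷suc n) ^ suc n
        1<XY = exp-apart (suc n) {r} {s} {e} {ℤ.1ℤ / suc n} (0<unit-fraction n) (unit-fraction n)
                 r<s de≡1 bound 0≤A (<⇒≤ 0<B)
        z , 0<z , Yz≡1 = inverse {Y} (0<^ (suc n) 0<B)
        a , z<a , a<X = <-dense {z} {X} (1<XY⇒y⁻¹<X {X} {Y} {z} 0<z Yz≡1 1<XY)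
    in a ,
       (z , z<a , r , n , (p , p<r , ≤-refl) , 0<B , ≤-reflexive (trans (sym Yz≡1) (*-comm Y z))) ,
       (X , a<X , s , n , (q , s<q , ≤-refl) , 0≤A , ≤-refl)

  <ᴿ-cotrans : ∀ {x y} z → x <ᴿ y → x <ᴿ z ⊎ z <ᴿ y
  <ᴿ-cotrans {x} {y} z (q , q∈U , q∈L) with Equivalence.to (L-rounded y q) q∈L
  ... | r , q<r , r∈L with located z q<r
  ... | inj₁ q∈Lz = inj₁ (q , q∈U , q∈Lz)
  ... | inj₂ r∈Uz = inj₂ (r , r∈Uz , r∈L)

  1≤q[1-r]¹ : ∀ {q r h} → h ≡ 1ℚ → q * (1ℚ - r) ≡ 1ℚ → 1ℚ ≤ q * ((1ℚ + - r * h) * 1ℚ)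
  1≤q[1-r]¹ {q} {r} refl eq = ≤-reflexive (trans (sym eq)
    (solve 2 (λ q r → q :* (con 1ℚ :- r) := q :* ((con 1ℚ :+ :- r :* con 1ℚ) :* con 1ℚ)) refl q r))

  -- For a > 0 and r = 1 - 1 / a the number a is an upper bound of exp r.
  exp-upper-at : ∀ {a b} → 0ℚ < a → a * b ≡ 1ℚ → ∀ {q} → q < 1ℚ - b → exp-upper (fromℚ q) a
  exp-upper-at {a} {b} 0<a ab≡1 {q} q<r = 1ℚ - b , 0 , (q , q<r , ≤-refl) ,
    0<pq⇒0<p {1+ (- (1ℚ - b)) ÷suc 0} {a} (subst (0ℚ <_) (sym eq′) 0<1ℚ) (<⇒≤ 0<a) ,
    1≤q[1-r]¹ {a} {1ℚ - b} {ℤ.1ℤ / 1} refl eq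
    where
    eq : a * (1ℚ - (1ℚ - b)) ≡ 1ℚ
    eq = trans (solve 2 (λ a b → a :* (con 1ℚ :- (con 1ℚ :- b)) := a :* b) refl a b) ab≡1

    eq′ : (1+ (- (1ℚ - b)) ÷suc 0) * a ≡ 1ℚ
    eq′ = trans (solve 2 (λ a b → (con 1ℚ :+ :- (con 1ℚ :- b) :* con 1ℚ) :* a := a :* b) refl a b) ab≡1

module _ (x : ℝ) where

  log-lower log-upper : ℚ → Set
  log-lower q = exp (fromℚ q) <ᴿ x
  log-upper q = x <ᴿ exp (fromℚ q)

  opaque
    log-lower-inhabited : 0ᴿ <ᴿ x → ∃ log-lower
    log-lower-inhabited 0<x =
      let s , 0<s , s∈L = 0<⇒∃L x 0<x
          a , 0<a , a<s = <-dense {0ℚ} {s} 0<s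
          b , 0<b , ab≡1 = inverse {a} 0<a
      in 1ℚ - b - 1ℚ , s ,
         (a , a<s , exp-upper-at {a} {b} 0<a ab≡1
           (by-< 1ℚ (solve 1 (λ b → con 1ℚ :- b :- (con 1ℚ :- b :- con 1ℚ) := con 1ℚ) refl b) 0<1ℚ)) ,
         s∈L

    log-upper-inhabited : ∃ log-upper
    log-upper-inhabited =
      let t , t∈U = U-inhabited x
          r = ∣ t ∣
          0≤1+r = 0≤+ {1ℚ} {r} 0≤1ℚ (0≤∣p∣ t)
      in r + 1ℚ , t , t∈U , 1ℚ + r ,
         by-< (r - t + 1ℚ) (solve 2 (λ r t → con 1ℚ :+ r :- t := r :- t :+ con 1ℚ) refl r t)
           (0<+ (p≤q⇒0≤q-p (p≤∣p∣ t)) 0<1ℚ) ,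
         r , 0 ,
         (r + 1ℚ , by-< 1ℚ (solve 1 (λ r → r :+ con 1ℚ :- r := con 1ℚ) refl r) 0<1ℚ , ≤-refl) ,
         1+u≤1+u/n^n 0 {r} 0≤1+r

    log-consistent : ∀ {p q} → log-lower p → log-upper q → p ≤ q
    log-consistent {p} {q} (a , a∈U , a∈L) (b , b∈U , b∈L) with ≤-total p q
    ... | inj₁ p≤q = p≤q
    ... | inj₂ q≤p = ⊥-elim (<-irrefl refl (<-trans (L<U x a∈L b∈U)
      (L<U (exp (fromℚ p)) (exp-mono-≤ {fromℚ q} {fromℚ p} (fromℚ-mono-≤ q≤p) b b∈L) a∈U)))

    log-located : ∀ {p q} → p < q → log-lower p ⊎ log-upper q
    log-located {p} {q} p<q = <ᴿ-cotrans {exp (fromℚ p)} {exp (fromℚ q)} x (exp-fromℚ-mono-< {p} {q} p<q)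

  log : 0ᴿ <ᴿ x → ℝ
  log 0<x = fromBounds log-lower log-upper (log-lower-inhabited 0<x) log-upper-inhabited log-consistent log-located

opaque
  log-positive : ∀ {x} (0<x : 0ᴿ <ᴿ x) → 1ᴿ <ᴿ x → 0ᴿ <ᴿ log x 0<x
  log-positive {x} 0<x (s , (s′ , s′<s , 1≤s′) , s∈L) =
    let a , s′<a , a<s = <-dense {s′} {s} s′<s
        1<a = ≤-<-trans 1≤s′ s′<a
        0<a = <-trans 0<1ℚ 1<a
        b , 0<b , ab≡1 = inverse {a} 0<a
        0<r = subst (0ℚ <_) (trans (solve 2 (λ a b → (a :- con 1ℚ) :* b := a :* b :- b) refl a b)
                (cong (_- b) ab≡1)) (0<* {a - 1ℚ} {b} (p<q⇒0<q-p 1<a) 0<b)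
        q , 0<q , q<r = <-dense {0ℚ} {1ℚ - b} 0<r
        p , 0<p , p<q = <-dense {0ℚ} {q} 0<q
    in p , (0ℚ , 0<p , ≤-refl) , (q , p<q , s , (a , a<s , exp-upper-at {a} {b} 0<a ab≡1 q<r) , s∈L)

module _ {n : ℕ} (2≤n : 2 ℕ.≤ n) where

  fromℕ-positive : 0ᴿ <ᴿ fromℕ n
  fromℕ-positive = fromℚ-mono-< {0ℚ} {fromℕᵣ n} (<-≤-trans 0<1ℚ (fromℕᵣ-mono (ℕ.<⇒≤ 2≤n)))

  1<fromℕ : 1ᴿ <ᴿ fromℕ n
  1<fromℕ = fromℚ-mono-< {1ℚ} {fromℕᵣ n} (<-≤-trans (by-< 1ℚ refl 0<1ℚ) (fromℕᵣ-mono 2≤n))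

logℕ : (n : ℕ) → 2 ℕ.≤ n → ℝ
logℕ n 2≤n = log (fromℕ n) (fromℕ-positive 2≤n)

0<logℕ : ∀ {n} (2≤n : 2 ℕ.≤ n) → 0ᴿ <ᴿ logℕ n 2≤n
0<logℕ {n} 2≤n = log-positive {fromℕ n} (fromℕ-positive 2≤n) (1<fromℕ 2≤n)

-- A subset of [k]ⁿ is given by a list of its elements.  The list must be
-- free of duplicates (Unique) for its length to be the cardinality.
Family : ℕ → ℕ → Set
Family k n = List (Vec (Fin k) n)

density : ∀ {k n} .{{_ : ℕ.NonZero k}} → Family k n → ℚ
density {k} {n} A = (ℤ.+ length A / k ℕ.^ n) {{ℕ.m^n≢0 k n}}

VectorIntersecting : ∀ {k n} → Family k n → Set
VectorIntersecting A = ∀ x y → x ∈ A → y ∈ A → ∃[ i ] lookup x i ≡ lookup y i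

permute : ∀ {k n} → Permutation′ n → Vec (Fin k) n → Vec (Fin k) n
permute σ x = tabulate (λ i → lookup x (σ ⟨$⟩ʳ i))

TransitiveSymmetric : ∀ {k n} → Family k n → Set
TransitiveSymmetric A = ∀ i j → ∃[ σ ] (σ ⟨$⟩ʳ i ≡ j × (∀ x → x ∈ A ⇔ permute σ x ∈ A))

module Submission where

-- Read a vector x as its graph, the set of pairs (i , x i); then A is an
-- intersecting family of sets.  Let R = k / 4 and choose a set J of pairs that
-- maximises the weight R ^ ∣ J ∣ * #{ x ∈ A | J ⊆ x }.  By maximality the sets
-- x ─ J with J ⊆ x ∈ A are R-spread: at most a fraction R ^ (- ∣ S ∣) of them
-- contains a given set S.  As R is large compared with log n, the spread lemma
-- shows that a uniformly random set contains some x ─ J with probability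
-- greater than 1/2.
--
-- If A violates the bound, then J has fewer than √ n elements.  The coordinate
-- permutations that preserve A permute the maximisers, so transitivity and
-- double counting give two disjoint maximisers J and J′.  Few sets x ⊇ J meet J′
-- and vice versa, so for some random set U there are x ⊇ J and y ⊇ J′ in A with
-- x ─ J ⊆ U, y ─ J′ ⊆ ∁ U, x ∩ J′ = ∅ and y ∩ J = ∅.  Then x and y are disjoint.

open import Defs

-- The exponent min(k / log n, √n) reflects two demands. At most k^(n - ∣J∣) vectors have J in their
-- graph, so with R = k / 4 the weight of J is at most k^n 4^(-∣J∣), while the empty set already has
-- weight ∣A∣. Hence ∣A∣ ≥ k^n 4^(-g) forces every maximiser to have at most g points, and disjoint
-- maximisers exist once g² < n: this is the √n. The spread lemma halves the sizes in each round, so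
-- about log n rounds share the density ½, and each needs its own density times R to be at least 64:
-- this asks R to be a large multiple of log n. Members through J that meet J′ are at most a
-- fraction g / R of those through J, which asks for 4 g ≤ R. Both hold because the bound can only
-- be violated when the exponent exceeds 1, and then k is a large multiple of log n. The
-- combinatorics uses finite sums of rationals only. The reals enter at the end, where a violation
-- yields one rational τ below the exponent, together with a rational β above log n and a rational a
-- below √n.

module _ where

  open import Algebra.Bundles using (CommutativeSemiring)
  import Algebra.Properties.CommutativeSemiring.Exp as CommutativeExp
  import Algebra.Properties.Semiring.Exp as Exp
  import Data.Empty as Empty
  import Data.Fin as Fin
  open import Data.Fin using (Fin; zero; suc)
  open import Data.Fin.Permutation using (Permutation′; _⟨$⟩ʳ_; _⟨$⟩ˡ_; inverseʳ)
  import Data.Fin.Properties as Fin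
  import Data.Fin.Subset as S
  open import Data.Fin.Subset using (Subset; inside; outside; _⊆_; _∪_; _∩_; _─_; ∁; ∣_∣; ⁅_⁆; ⊥)
  open import Data.Fin.Subset.Properties
  import Data.Integer as ℤ
  import Data.Integer.Properties as ℤ
  open import Data.List using (List; []; _∷_; length; map; _++_; [_]; filter; allFin; cartesianProductWith)
  open import Data.List.Membership.Propositional using (_∈_; find; lose)
  open import Data.List.Membership.Propositional.Properties using
    (∈-map⁺; ∈-map⁻; ∈-++⁺ˡ; ∈-++⁺ʳ; ∈-++⁻; ∈-∃++; ∈-allFin; ∈-filter⁺; ∈-filter⁻; ∈-cartesianProductWith⁺)
  open import Data.List.Properties using (length-tabulate; map-tabulate)
  import Data.List.Relation.Unary.All as All
  open import Data.List.Relation.Unary.All using (All; all?)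
  open import Data.List.Relation.Unary.All.Properties using (¬All⇒Any¬)
  import Data.List.Relation.Unary.Any as Any
  open import Data.List.Relation.Unary.Any using (Any; any?; here; there)
  open import Data.List.Relation.Unary.Unique.Propositional using (Unique; []; _∷_)
  import Data.List.Relation.Unary.Unique.Propositional.Properties as Unique
  open import Data.Nat as ℕ using (ℕ; zero; suc)
  import Data.Nat.Properties as ℕ
  open import Data.Product using (∃-syntax; _×_; _,_; proj₁; proj₂)
  open import Data.Rational hiding (truncate; round; ∣_∣)
  open import Data.Rational.Properties
  import Data.Rational.Solver as Solver
  import Data.Rational.Unnormalised as ℚᵘ
  import Data.Rational.Unnormalised.Properties as ℚᵘ
  open import Data.Sum using (inj₁; inj₂; [_,_]′)
  open import Data.Vec as Vec using (Vec; []; _∷_; here; there; lookup; tabulate)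
  open import Data.Vec.Properties using
    (lookup∘tabulate; tabulate∘lookup; tabulate-cong; []=⇒lookup; lookup⇒[]=; lookup-++ˡ; lookup-++ʳ)
  open import Function using (_∘_; id; Equivalence)
  open import Relation.Binary using (DecTotalOrder)
  open import Relation.Binary.PropositionalEquality hiding ([_])
  open import Relation.Nullary using (Dec; ¬_; yes; no; contradiction)
  open import Relation.Nullary.Decidable using (True; toWitness; ¬?; _×-dec_; _→-dec_; decidable-stable)

  open import Data.List.Extrema (DecTotalOrder.totalOrder ≤-decTotalOrder) using (argmax; f[xs]≤f[argmax])

  open Solver.+-*-Solver using (solve; con; _:=_; _:+_; _:*_; _:-_; :-_)
  open Exp (CommutativeSemiring.semiring ℚ-commutativeSemiring) using (_^_; ^-homo-*)
  open CommutativeExp ℚ-commutativeSemiring using (^-distrib-*)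

  -- Finite sums and expectations

  ⟦_⟧ : {P : Set} → Dec P → ℚ
  ⟦ yes _ ⟧ = 1ℚ
  ⟦ no _ ⟧  = 0ℚ

  0≤⟦_⟧ : {P : Set} (P? : Dec P) → 0ℚ ≤ ⟦ P? ⟧
  0≤⟦ yes _ ⟧ = 0≤1ℚ
  0≤⟦ no _ ⟧  = ≤-refl

  ⟦_⟧≤1 : {P : Set} (P? : Dec P) → ⟦ P? ⟧ ≤ 1ℚ
  ⟦ yes _ ⟧≤1 = ≤-refl
  ⟦ no _ ⟧≤1  = 0≤1ℚ

  ⟦⟧-yes : {P : Set} (P? : Dec P) → P → ⟦ P? ⟧ ≡ 1ℚ
  ⟦⟧-yes (yes _) _ = refl
  ⟦⟧-yes (no ¬p) p = contradiction p ¬p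

  ⟦⟧-no : {P : Set} (P? : Dec P) → ¬ P → ⟦ P? ⟧ ≡ 0ℚ
  ⟦⟧-no (yes p) ¬p = contradiction p ¬p
  ⟦⟧-no (no _)  _  = refl

  ⟦⟧-≤ : {P : Set} {q : ℚ} (P? : Dec P) → 0ℚ ≤ q → (P → 1ℚ ≤ q) → ⟦ P? ⟧ ≤ q
  ⟦⟧-≤ (yes p) _   h = h p
  ⟦⟧-≤ (no _)  0≤q _ = 0≤q

  ⟦⟧-mono : {P Q : Set} (P? : Dec P) (Q? : Dec Q) → (P → Q) → ⟦ P? ⟧ ≤ ⟦ Q? ⟧
  ⟦⟧-mono P? Q? P⇒Q = ⟦⟧-≤ P? 0≤⟦ Q? ⟧ (λ p → ≤-reflexive (sym (⟦⟧-yes Q? (P⇒Q p))))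

  ∑ : {X : Set} → List X → (X → ℚ) → ℚ
  ∑ []       f = 0ℚ
  ∑ (x ∷ xs) f = f x + ∑ xs f

  module _ {X : Set} where

    ∑-mono : ∀ (xs : List X) {f g} → (∀ {x} → x ∈ xs → f x ≤ g x) → ∑ xs f ≤ ∑ xs g
    ∑-mono []       f≤g = ≤-refl
    ∑-mono (x ∷ xs) f≤g = +-mono-≤ (f≤g (here refl)) (∑-mono xs (f≤g ∘ there))

    ∑-cong : ∀ (xs : List X) {f g} → (∀ x → f x ≡ g x) → ∑ xs f ≡ ∑ xs g
    ∑-cong []       f≡g = refl
    ∑-cong (x ∷ xs) f≡g = cong₂ _+_ (f≡g x) (∑-cong xs f≡g)

    0≤∑ : ∀ (xs : List X) {f} → (∀ x → 0ℚ ≤ f x) → 0ℚ ≤ ∑ xs f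
    0≤∑ []       0≤f = ≤-refl
    0≤∑ (x ∷ xs) 0≤f = 0≤+ (0≤f x) (0≤∑ xs 0≤f)

    term≤∑ : ∀ {xs : List X} {f} → (∀ x → 0ℚ ≤ f x) → ∀ {x} → x ∈ xs → f x ≤ ∑ xs f
    term≤∑ {x ∷ xs} {f} 0≤f (here refl) =
      subst (_≤ f x + ∑ xs f) (+-identityʳ (f x)) (+-monoʳ-≤ (f x) (0≤∑ xs 0≤f))
    term≤∑ {x ∷ xs} {f} 0≤f (there x∈xs) =
      subst (_≤ f x + ∑ xs f) (+-identityˡ _) (+-mono-≤ (0≤f x) (term≤∑ 0≤f x∈xs))

    ∑-+ : ∀ (xs : List X) f g → ∑ xs (λ x → f x + g x) ≡ ∑ xs f + ∑ xs g
    ∑-+ []       f g = refl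
    ∑-+ (x ∷ xs) f g = trans (cong (f x + g x +_) (∑-+ xs f g))
      (solve 4 (λ a b c d → a :+ b :+ (c :+ d) := a :+ c :+ (b :+ d)) refl (f x) (g x) (∑ xs f) (∑ xs g))

    ∑-*ˡ : ∀ c (xs : List X) f → ∑ xs (λ x → c * f x) ≡ c * ∑ xs f
    ∑-*ˡ c []       f = sym (*-zeroʳ c)
    ∑-*ˡ c (x ∷ xs) f = trans (cong (c * f x +_) (∑-*ˡ c xs f)) (sym (*-distribˡ-+ c (f x) (∑ xs f)))

    ∑-const : ∀ (xs : List X) c → ∑ xs (λ _ → c) ≡ fromℕᵣ (length xs) * c
    ∑-const []       c = sym (*-zeroˡ c)
    ∑-const (x ∷ xs) c = trans (cong (c +_) (∑-const xs c))
      (trans (solve 2 (λ c m → c :+ m :* c := (con 1ℚ :+ m) :* c) refl c (fromℕᵣ (length xs)))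
        (cong (_* c) (sym (fromℕᵣ-suc (length xs)))))

    ∑-zero : ∀ (xs : List X) → ∑ xs (λ _ → 0ℚ) ≡ 0ℚ
    ∑-zero xs = trans (∑-const xs 0ℚ) (*-zeroʳ (fromℕᵣ (length xs)))

    ∑-++ : ∀ (xs ys : List X) f → ∑ (xs ++ ys) f ≡ ∑ xs f + ∑ ys f
    ∑-++ []       ys f = sym (+-identityˡ _)
    ∑-++ (x ∷ xs) ys f = trans (cong (f x +_) (∑-++ xs ys f)) (sym (+-assoc (f x) (∑ xs f) (∑ ys f)))

    ∑-map : ∀ {Y : Set} (h : Y → X) ys f → ∑ (map h ys) f ≡ ∑ ys (f ∘ h)
    ∑-map h []       f = refl
    ∑-map h (y ∷ ys) f = cong (f (h y) +_) (∑-map h ys f)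

  ∑-swap : {X Y : Set} (xs : List X) (ys : List Y) (f : X → Y → ℚ) →
           ∑ xs (λ x → ∑ ys (f x)) ≡ ∑ ys (λ y → ∑ xs (λ x → f x y))
  ∑-swap []       ys f = sym (∑-zero ys)
  ∑-swap (x ∷ xs) ys f = trans (cong (∑ ys (f x) +_) (∑-swap xs ys f)) (sym (∑-+ ys (f x) _))

  -- Subsets and random subsets

  subsets : ∀ n → List (Subset n)
  subsets zero    = [] ∷ []
  subsets (suc n) = map (inside ∷_) (subsets n) ++ map (outside ∷_) (subsets n)

  ∈-subsets : ∀ {n} (p : Subset n) → p ∈ subsets n
  ∈-subsets []            = here refl
  ∈-subsets (inside ∷ p)  = ∈-++⁺ˡ (∈-map⁺ (inside ∷_) (∈-subsets p))
  ∈-subsets (outside ∷ p) = ∈-++⁺ʳ (map (inside ∷_) (subsets _)) (∈-map⁺ (outside ∷_) (∈-subsets p))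

  2ℚ : ℚ
  2ℚ = 1ℚ + 1ℚ

  #⊆ : ∀ {n} (q : Subset n) → ∑ (subsets n) (λ p → ⟦ p ⊆? q ⟧) ≤ 2ℚ ^ ∣ q ∣
  #⊆ [] = ≤-reflexive (cong (_+ 0ℚ) (⟦⟧-yes ([] ⊆? []) ⊆-refl))
  #⊆ {suc n} (s ∷ q) = ≤-trans (≤-reflexive split) (bound s)
    where
    count : Subset (suc n) → ℚ
    count p = ⟦ p ⊆? (s ∷ q) ⟧

    split : ∑ (subsets (suc n)) count ≡ ∑ (subsets n) (count ∘ (inside ∷_)) + ∑ (subsets n) (count ∘ (outside ∷_))
    split = trans (∑-++ (map (inside ∷_) (subsets n)) _ count)
      (cong₂ _+_ (∑-map (inside ∷_) (subsets n) count) (∑-map (outside ∷_) (subsets n) count))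

    tail : ∀ t s → ∑ (subsets n) (λ p → ⟦ (t ∷ p) ⊆? (s ∷ q) ⟧) ≤ 2ℚ ^ ∣ q ∣
    tail t s = ≤-trans (∑-mono (subsets n) (λ {p} _ → ⟦⟧-mono ((t ∷ p) ⊆? (s ∷ q)) (p ⊆? q) drop-∷-⊆)) (#⊆ q)

    bound : ∀ s → ∑ (subsets n) (λ p → ⟦ (inside ∷ p) ⊆? (s ∷ q) ⟧) + ∑ (subsets n) (λ p → ⟦ (outside ∷ p) ⊆? (s ∷ q) ⟧)
          ≤ 2ℚ ^ ∣ s ∷ q ∣
    bound inside  = ≤-trans (+-mono-≤ (tail inside inside) (tail outside inside))
      (≤-reflexive (solve 1 (λ x → x :+ x := (con 1ℚ :+ con 1ℚ) :* x) refl (2ℚ ^ ∣ q ∣)))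
    bound outside = ≤-trans (+-mono-≤
      (≤-trans (∑-mono (subsets n) (λ {p} _ → ≤-reflexive (⟦⟧-no ((inside ∷ p) ⊆? (outside ∷ q)) (λ sub → absurd (sub here)))))
        (≤-reflexive (∑-zero (subsets n))))
      (tail outside outside))
      (≤-reflexive (+-identityˡ _))
      where
      absurd : ¬ (zero S.∈ outside ∷ q)
      absurd ()

  -- The expectation of f W for a random set W that contains each point
  -- independently with probability p.
  𝔼 : ∀ {n} → ℚ → (Subset n → ℚ) → ℚ
  𝔼 {zero}  p f = f []
  𝔼 {suc n} p f = p * 𝔼 p (f ∘ (inside ∷_)) + (1ℚ - p) * 𝔼 p (f ∘ (outside ∷_))

  𝔼-cong : ∀ {n} p {f g : Subset n → ℚ} → (∀ W → f W ≡ g W) → 𝔼 p f ≡ 𝔼 p g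
  𝔼-cong {zero}  p f≡g = f≡g []
  𝔼-cong {suc n} p f≡g = cong₂ _+_ (cong (p *_) (𝔼-cong p (f≡g ∘ (inside ∷_))))
                                   (cong ((1ℚ - p) *_) (𝔼-cong p (f≡g ∘ (outside ∷_))))

  𝔼-const : ∀ {n} p c → 𝔼 {n} p (λ _ → c) ≡ c
  𝔼-const {zero}  p c = refl
  𝔼-const {suc n} p c = trans (cong₂ (λ a b → p * a + (1ℚ - p) * b) (𝔼-const {n} p c) (𝔼-const {n} p c))
    (solve 2 (λ p c → p :* c :+ (con 1ℚ :- p) :* c := c) refl p c)

  𝔼-+ : ∀ {n} p (f g : Subset n → ℚ) → 𝔼 p (λ W → f W + g W) ≡ 𝔼 p f + 𝔼 p g
  𝔼-+ {zero}  p f g = refl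
  𝔼-+ {suc n} p f g = trans (cong₂ (λ a b → p * a + (1ℚ - p) * b)
      (𝔼-+ p (f ∘ (inside ∷_)) (g ∘ (inside ∷_))) (𝔼-+ p (f ∘ (outside ∷_)) (g ∘ (outside ∷_))))
    (solve 5 (λ p a b c d → p :* (a :+ b) :+ (con 1ℚ :- p) :* (c :+ d) :=
       p :* a :+ (con 1ℚ :- p) :* c :+ (p :* b :+ (con 1ℚ :- p) :* d)) refl p _ _ _ _)

  𝔼-*ˡ : ∀ {n} p c (f : Subset n → ℚ) → 𝔼 p (λ W → c * f W) ≡ c * 𝔼 p f
  𝔼-*ˡ {zero}  p c f = refl
  𝔼-*ˡ {suc n} p c f = trans (cong₂ (λ a b → p * a + (1ℚ - p) * b)
      (𝔼-*ˡ p c (f ∘ (inside ∷_))) (𝔼-*ˡ p c (f ∘ (outside ∷_))))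
    (solve 4 (λ p c a b → p :* (c :* a) :+ (con 1ℚ :- p) :* (c :* b) :=
       c :* (p :* a :+ (con 1ℚ :- p) :* b)) refl p c _ _)

  𝔼-∑ : ∀ {n} {X : Set} p (xs : List X) (f : Subset n → X → ℚ) →
        𝔼 p (λ W → ∑ xs (f W)) ≡ ∑ xs (λ x → 𝔼 p (λ W → f W x))
  𝔼-∑ {n} p []       f = 𝔼-const {n} p 0ℚ
  𝔼-∑ p (x ∷ xs) f = trans (𝔼-+ p (λ W → f W x) (λ W → ∑ xs (f W)))
    (cong (𝔼 p (λ W → f W x) +_) (𝔼-∑ p xs f))

  -- At density ½ the complement of a random set is again uniform, which lets a single U serve two
  -- families.
  𝔼-∁ : ∀ {n} {p} → 1ℚ - p ≡ p → (f : Subset n → ℚ) → 𝔼 p (f ∘ ∁) ≡ 𝔼 p f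
  𝔼-∁ {zero}  1-p≡p f = refl
  𝔼-∁ {suc n} {p} 1-p≡p f = trans
    (cong₂ (λ a b → p * a + (1ℚ - p) * b) (𝔼-∁ 1-p≡p (f ∘ (outside ∷_))) (𝔼-∁ 1-p≡p (f ∘ (inside ∷_))))
    (trans (cong (λ q → p * Y + q * X) 1-p≡p) (trans (+-comm (p * Y) (p * X)) (cong (λ q → p * X + q * Y) (sym 1-p≡p))))
    where
    X = 𝔼 p (f ∘ (inside ∷_))
    Y = 𝔼 p (f ∘ (outside ∷_))

  module _ {p : ℚ} (0≤p : 0ℚ ≤ p) (p≤1 : p ≤ 1ℚ) where

    0≤1-p : 0ℚ ≤ 1ℚ - p
    0≤1-p = p≤q⇒0≤q-p p≤1

    mix-mono : ∀ {a b c d} → a ≤ b → c ≤ d → p * a + (1ℚ - p) * c ≤ p * b + (1ℚ - p) * d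
    mix-mono a≤b c≤d = +-mono-≤ (*-monoˡ-≤-nonNeg p {{nonNegative 0≤p}} a≤b)
                                (*-monoˡ-≤-nonNeg (1ℚ - p) {{nonNegative 0≤1-p}} c≤d)

    𝔼-mono : ∀ {n} {f g : Subset n → ℚ} → (∀ W → f W ≤ g W) → 𝔼 p f ≤ 𝔼 p g
    𝔼-mono {zero}  f≤g = f≤g []
    𝔼-mono {suc n} f≤g = mix-mono (𝔼-mono (f≤g ∘ (inside ∷_))) (𝔼-mono (f≤g ∘ (outside ∷_)))

    0≤𝔼 : ∀ {n} {f : Subset n → ℚ} → (∀ W → 0ℚ ≤ f W) → 0ℚ ≤ 𝔼 p f
    0≤𝔼 {n} {f} 0≤f = subst (_≤ 𝔼 p f) (𝔼-const {n} p 0ℚ) (𝔼-mono 0≤f)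

    -- A set W disjoint from χ is at most p ^ (- ∣χ∣) times as likely as W ∪ χ.
    𝔼-shift : ∀ {n} (χ : Subset n) {g : Subset n → ℚ} → (∀ W → 0ℚ ≤ g W) →
              p ^ ∣ χ ∣ * 𝔼 p (λ W → ⟦ χ ⊆? ∁ W ⟧ * g (W ∪ χ)) ≤ 𝔼 p g
    𝔼-shift [] {g} 0≤g = ≤-reflexive (trans (*-identityˡ _)
      (trans (cong (_* g []) (⟦⟧-yes ([] ⊆? []) ⊆-refl)) (*-identityˡ _)))
    𝔼-shift {suc n} (outside ∷ χ) {g} 0≤g = ≤-trans
      (≤-reflexive (solve 4 (λ q p a b → q :* (p :* a :+ (con 1ℚ :- p) :* b) :=
        p :* (q :* a) :+ (con 1ℚ :- p) :* (q :* b)) refl (p ^ ∣ χ ∣) p _ _))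
      (mix-mono (part inside (g ∘ (inside ∷_)) (0≤g ∘ (inside ∷_))) (part outside (g ∘ (outside ∷_)) (0≤g ∘ (outside ∷_))))
      where
      part : ∀ s (h : Subset n → ℚ) → (∀ W → 0ℚ ≤ h W) →
             p ^ ∣ χ ∣ * 𝔼 p (λ W → ⟦ (outside ∷ χ) ⊆? ∁ (s ∷ W) ⟧ * h (W ∪ χ)) ≤ 𝔼 p h
      part s h 0≤h = ≤-trans
        (*-monoˡ-≤-nonNeg (p ^ ∣ χ ∣) {{nonNegative (0≤^ ∣ χ ∣ 0≤p)}} (𝔼-mono (λ W →
          *-monoʳ-≤-nonNeg (h (W ∪ χ)) {{nonNegative (0≤h (W ∪ χ))}}
            (⟦⟧-mono ((outside ∷ χ) ⊆? ∁ (s ∷ W)) (χ ⊆? ∁ W) drop-∷-⊆))))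
        (𝔼-shift χ 0≤h)
    𝔼-shift {suc n} (inside ∷ χ) {g} 0≤g = ≤-trans
      (≤-reflexive (solve 4 (λ q p a b → p :* q :* (p :* a :+ (con 1ℚ :- p) :* b) :=
        p :* p :* (q :* a) :+ (con 1ℚ :- p) :* (p :* (q :* b))) refl (p ^ ∣ χ ∣) p _ _))
      (≤-trans
        -- If W has the new point, it meets the set and contributes nothing. Otherwise the union
        -- gains the point, and (1 - p) * p ≤ p.
        (+-mono-≤ (≤-reflexive (trans (cong (λ z → p * p * (p ^ ∣ χ ∣ * z)) none)
                    (trans (cong (p * p *_) (*-zeroʳ (p ^ ∣ χ ∣))) (*-zeroʳ (p * p)))))
                  (*-monoˡ-≤-nonNeg (1ℚ - p) {{nonNegative 0≤1-p}}
                    (*-monoˡ-≤-nonNeg p {{nonNegative 0≤p}} some)))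
        (by-≤ (p * (p * X) + (1ℚ - p) * Y)
          (solve 3 (λ p X Y → p :* X :+ (con 1ℚ :- p) :* Y :- (con 0ℚ :+ (con 1ℚ :- p) :* (p :* X)) :=
            p :* (p :* X) :+ (con 1ℚ :- p) :* Y) refl p X Y)
          (0≤+ (0≤* 0≤p (0≤* 0≤p 0≤X)) (0≤* 0≤1-p 0≤Y))))
      where
      X = 𝔼 p (g ∘ (inside ∷_))
      Y = 𝔼 p (g ∘ (outside ∷_))
      0≤X : 0ℚ ≤ X
      0≤X = 0≤𝔼 (0≤g ∘ (inside ∷_))
      0≤Y : 0ℚ ≤ Y
      0≤Y = 0≤𝔼 (0≤g ∘ (outside ∷_))

      none : 𝔼 p (λ W → ⟦ (inside ∷ χ) ⊆? ∁ (inside ∷ W) ⟧ * g (inside ∷ (W ∪ χ))) ≡ 0ℚ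
      none = trans (𝔼-cong p (λ W → trans (cong (_* g (inside ∷ (W ∪ χ)))
          (⟦⟧-no ((inside ∷ χ) ⊆? ∁ (inside ∷ W)) (λ sub → absurd (sub here)))) (*-zeroˡ (g (inside ∷ (W ∪ χ))))))
        (𝔼-const {n} p 0ℚ)
        where
        absurd : ∀ {W} → ¬ (zero S.∈ outside ∷ W)
        absurd ()

      some : p ^ ∣ χ ∣ * 𝔼 p (λ W → ⟦ (inside ∷ χ) ⊆? ∁ (outside ∷ W) ⟧ * g (inside ∷ (W ∪ χ))) ≤ X
      some = ≤-trans
        (*-monoˡ-≤-nonNeg (p ^ ∣ χ ∣) {{nonNegative (0≤^ ∣ χ ∣ 0≤p)}} (𝔼-mono (λ W →
          *-monoʳ-≤-nonNeg (g (inside ∷ (W ∪ χ))) {{nonNegative (0≤g (inside ∷ (W ∪ χ)))}}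
            (⟦⟧-mono ((inside ∷ χ) ⊆? ∁ (outside ∷ W)) (χ ⊆? ∁ W) drop-∷-⊆))))
        (𝔼-shift χ (0≤g ∘ (inside ∷_)))

  -- A union of independent random sets of densities a and b has density
  -- a + b - a b ≤ a + b.
  𝔼-∪ : ∀ {n a b} → 0ℚ ≤ a → 0ℚ ≤ b → a + b ≤ 1ℚ → {f : Subset n → ℚ} →
        (∀ {V W} → V ⊆ W → f W ≤ f V) → 𝔼 (a + b) f ≤ 𝔼 a (λ W → 𝔼 b (λ V → f (W ∪ V)))
  𝔼-∪ {zero} 0≤a 0≤b a+b≤1 anti = ≤-refl
  𝔼-∪ {suc n} {a} {b} 0≤a 0≤b a+b≤1 {f} anti = ≤-trans
    -- Density a + b counts the event that both sets contain the first point twice. This moves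
    -- weight a b from Y to X, and X ≤ Y as f is antitone.
    (by-≤ (a * b * (Y - X)) (solve 4 (λ a b X Y →
        (a :* (b :* X :+ (con 1ℚ :- b) :* X) :+ (con 1ℚ :- a) :* (b :* X :+ (con 1ℚ :- b) :* Y))
          :- ((a :+ b) :* X :+ (con 1ℚ :- (a :+ b)) :* Y) := a :* b :* (Y :- X)) refl a b X Y)
      (0≤* (0≤* 0≤a 0≤b) (p≤q⇒0≤q-p X≤Y)))
    (≤-trans (mix-mono 0≤a a≤1 (mix-mono 0≤b b≤1 X≤ X≤) (mix-mono 0≤b b≤1 X≤ Y≤))
      (≤-reflexive (sym (cong₂ (λ c d → a * c + (1ℚ - a) * d)
        (mix (λ W V → f (inside ∷ (W ∪ V))) (λ W V → f (inside ∷ (W ∪ V))))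
        (mix (λ W V → f (inside ∷ (W ∪ V))) (λ W V → f (outside ∷ (W ∪ V))))))))
    where
    0≤a+b : 0ℚ ≤ a + b
    0≤a+b = 0≤+ 0≤a 0≤b
    a≤1 : a ≤ 1ℚ
    a≤1 = ≤-trans (subst (_≤ a + b) (+-identityʳ a) (+-monoʳ-≤ a 0≤b)) a+b≤1
    b≤1 : b ≤ 1ℚ
    b≤1 = ≤-trans (subst (_≤ a + b) (+-identityˡ b) (+-monoˡ-≤ b 0≤a)) a+b≤1
    X = 𝔼 (a + b) (f ∘ (inside ∷_))
    Y = 𝔼 (a + b) (f ∘ (outside ∷_))
    X≤Y : X ≤ Y
    X≤Y = 𝔼-mono 0≤a+b a+b≤1 {f = f ∘ (inside ∷_)} {f ∘ (outside ∷_)} (λ W → anti {outside ∷ W} {inside ∷ W} (out⊆ {p = W} ⊆-refl))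
    X≤ : X ≤ 𝔼 a (λ W → 𝔼 b (λ V → f (inside ∷ (W ∪ V))))
    X≤ = 𝔼-∪ 0≤a 0≤b a+b≤1 (λ V⊆W → anti (s⊆s V⊆W))
    Y≤ : Y ≤ 𝔼 a (λ W → 𝔼 b (λ V → f (outside ∷ (W ∪ V))))
    Y≤ = 𝔼-∪ 0≤a 0≤b a+b≤1 (λ V⊆W → anti (s⊆s V⊆W))

    mix : ∀ (F G : Subset n → Subset n → ℚ) →
          𝔼 a (λ W → b * 𝔼 b (F W) + (1ℚ - b) * 𝔼 b (G W)) ≡
          b * 𝔼 a (λ W → 𝔼 b (F W)) + (1ℚ - b) * 𝔼 a (λ W → 𝔼 b (G W))
    mix F G = trans (𝔼-+ a (λ W → b * 𝔼 b (F W)) (λ W → (1ℚ - b) * 𝔼 b (G W)))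
      (cong₂ _+_ (𝔼-*ˡ a b (λ W → 𝔼 b (F W))) (𝔼-*ˡ a (1ℚ - b) (λ W → 𝔼 b (G W))))

  -- The spread lemma

  x∈p─q⇒x∉q : ∀ {n} {x : Fin n} (p q : Subset n) → x S.∈ p ─ q → x S.∉ q
  x∈p─q⇒x∉q (_ ∷ p)      (_ ∷ q)       (there x∈p─q) (there x∈q) = x∈p─q⇒x∉q p q x∈p─q x∈q
  x∈p─q⇒x∉q (inside ∷ p)  (inside ∷ q) () here
  x∈p─q⇒x∉q (outside ∷ p) (inside ∷ q) () here

  p⊆q∪p─q : ∀ {n} (p q : Subset n) → p ⊆ q ∪ (p ─ q)
  p⊆q∪p─q p q {x} x∈p with x ∈? q
  ... | yes x∈q = p⊆p∪q (p ─ q) x∈q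
  ... | no  x∉q = q⊆p∪q q (p ─ q) (x∈p∧x∉q⇒x∈p─q x∈p x∉q)

  p⊆q∪r⇒p─q⊆r : ∀ {n} (p q r : Subset n) → p ⊆ q ∪ r → p ─ q ⊆ r
  p⊆q∪r⇒p─q⊆r p q r p⊆q∪r x∈p─q with x∈p∪q⁻ q r (p⊆q∪r (p─q⊆p p q x∈p─q))
  ... | inj₁ x∈q = contradiction x∈q (x∈p─q⇒x∉q p q x∈p─q)
  ... | inj₂ x∈r = x∈r

  ∪-monoʳ : ∀ {n} (W : Subset n) {V V′} → V ⊆ V′ → W ∪ V ⊆ W ∪ V′
  ∪-monoʳ W {V} V⊆V′ x∈ with x∈p∪q⁻ W V x∈
  ... | inj₁ x∈W = p⊆p∪q _ x∈W
  ... | inj₂ x∈V = q⊆p∪q W _ (V⊆V′ x∈V)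

  ⊆∧⊉⇒∣∣< : ∀ {n} {p q : Subset n} → p ⊆ q → ¬ (q ⊆ p) → ∣ p ∣ ℕ.< ∣ q ∣
  ⊆∧⊉⇒∣∣< {p = p} {q} p⊆q q⊈p with p ⊂? q
  ... | yes p⊂q = p⊂q⇒∣p∣<∣q∣ p⊂q
  ... | no  p⊄q = contradiction
    (λ {x} x∈q → decidable-stable (x ∈? p) (λ x∉p → p⊄q (p⊆q , x , x∈q , x∉p))) q⊈p

  ^-monoʳ : ∀ {p} → 1ℚ ≤ p → ∀ {m n} → m ℕ.≤ n → p ^ m ≤ p ^ n
  ^-monoʳ 1≤p {n = zero}  ℕ.z≤n = ≤-refl
  ^-monoʳ {p} 1≤p {n = suc n} ℕ.z≤n = subst (_≤ p ^ suc n) (*-identityˡ 1ℚ)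
    (*-mono-≤-0≤ 0≤1ℚ (≤-trans 0≤1ℚ 1≤p) 1≤p (^-monoʳ 1≤p {n = n} ℕ.z≤n))
  ^-monoʳ {p} 1≤p (ℕ.s≤s m≤n) = *-monoˡ-≤-nonNeg p {{nonNegative (≤-trans 0≤1ℚ 1≤p)}} (^-monoʳ 1≤p m≤n)

  size : {X : Set} → List X → ℚ
  size xs = ∑ xs (λ _ → 1ℚ)

  module _ {n : ℕ} where

    #⊇ : List (Subset n) → Subset n → ℚ
    #⊇ Φ S = ∑ Φ (λ φ → ⟦ S ⊆? φ ⟧)

    0≤#⊇ : ∀ Φ S → 0ℚ ≤ #⊇ Φ S
    0≤#⊇ Φ S = 0≤∑ Φ (λ φ → 0≤⟦ S ⊆? φ ⟧)

    -- M takes the place of the number of members. It stays fixed when members are dropped or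
    -- shrunk, so the condition survives both.
    Spread : ℚ → ℚ → List (Subset n) → Set
    Spread R M Φ = ∀ S → R ^ ∣ S ∣ * #⊇ Φ S ≤ M

    size≤M : ∀ {R M Φ} → Spread R M Φ → size Φ ≤ M
    size≤M {R} {M} {Φ} spread = subst (_≤ M)
      (trans (cong₂ (λ m c → R ^ m * c) (∣⊥∣≡0 n) (∑-cong Φ (λ φ → ⟦⟧-yes (⊥ ⊆? φ) (⊆-min φ)))) (*-identityˡ _))
      (spread ⊥)

    module Fragments (Φ : List (Subset n)) (t : ℕ) (W : Subset n) where

      -- Any member ψ may stand in for φ, provided its remainder lies inside φ. This freedom makes
      -- bad members rare.
      Good : Subset n → Set
      Good φ = Any (λ ψ → ψ ─ W ⊆ φ × ∣ ψ ─ W ∣ ℕ.< t) Φ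

      good? : ∀ φ → Dec (Good φ)
      good? φ = any? (λ ψ → (ψ ─ W ⊆? φ) ×-dec (∣ ψ ─ W ∣ ℕ.<? t)) Φ

      addFragment : ∀ {φ} → Dec (Good φ) → List (Subset n) → List (Subset n)
      addFragment (yes good) Ψ = (proj₁ (find good) ─ W) ∷ Ψ
      addFragment (no _)     Ψ = Ψ

      -- Repeated fragments are kept, so the length of the list still counts the good members.
      fragments : List (Subset n) → List (Subset n)
      fragments []      = []
      fragments (φ ∷ Ψ) = addFragment (good? φ) (fragments Ψ)

      fragment-of : ∀ Ψ {χ} → χ ∈ fragments Ψ → ∣ χ ∣ ℕ.< t × ∃[ ψ ] ψ ∈ Φ × χ ≡ ψ ─ W
      fragment-of (φ ∷ Ψ) χ∈ with good? φ
      fragment-of (φ ∷ Ψ) (here refl) | yes good =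
        let ψ , ψ∈Φ , _ , small = find good in small , ψ , ψ∈Φ , refl
      fragment-of (φ ∷ Ψ) (there χ∈)  | yes good = fragment-of Ψ χ∈
      fragment-of (φ ∷ Ψ) χ∈          | no _     = fragment-of Ψ χ∈

      -- A fragment lies inside the member that it replaces. Hence fragments inherit spreadness with
      -- the same R and M.
      #⊇-fragments : ∀ Ψ S → #⊇ (fragments Ψ) S ≤ #⊇ Ψ S
      #⊇-fragments []      S = ≤-refl
      #⊇-fragments (φ ∷ Ψ) S with good? φ
      ... | yes good = let ψ , _ , ψ─W⊆φ , _ = find good in
        +-mono-≤ (⟦⟧-mono (S ⊆? ψ ─ W) (S ⊆? φ) (λ S⊆ → ⊆-trans S⊆ ψ─W⊆φ)) (#⊇-fragments Ψ S)
      ... | no _     = subst (_≤ ⟦ S ⊆? φ ⟧ + #⊇ Ψ S) (+-identityˡ _)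
        (+-mono-≤ 0≤⟦ S ⊆? φ ⟧ (#⊇-fragments Ψ S))

      bad : List (Subset n) → ℚ
      bad Ψ = ∑ Ψ (λ φ → ⟦ ¬? (good? φ) ⟧)

      size-fragments : ∀ Ψ → size Ψ ≡ size (fragments Ψ) + bad Ψ
      size-fragments []      = refl
      size-fragments (φ ∷ Ψ) with good? φ
      ... | yes _ = trans (cong (1ℚ +_) (size-fragments Ψ))
        (solve 2 (λ a b → con 1ℚ :+ (a :+ b) := con 1ℚ :+ a :+ (con 0ℚ :+ b)) refl (size (fragments Ψ)) (bad Ψ))
      ... | no _  = trans (cong (1ℚ +_) (size-fragments Ψ))
        (solve 2 (λ a b → con 1ℚ :+ (a :+ b) := a :+ (con 1ℚ :+ b)) refl (size (fragments Ψ)) (bad Ψ))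

    module _ (Φ : List (Subset n)) where

      -- Given Z, only few χ are possible: χ is a subset of every member inside Z, and there is at
      -- least one.
      Critical : Subset n → Subset n → Set
      Critical Z χ = Any (_⊆ Z) Φ × All (λ ψ → ψ ⊆ Z → χ ⊆ ψ) Φ

      critical? : ∀ Z χ → Dec (Critical Z χ)
      critical? Z χ = any? (_⊆? Z) Φ ×-dec all? (λ ψ → (ψ ⊆? Z) →-dec (χ ⊆? ψ)) Φ

    module _ {Φ : List (Subset n)} {t : ℕ} {W : Subset n} where
      open Fragments Φ t W

      -- A minimal set of the form ψ ─ W inside φ lies in every member of Φ
      -- that its union with W contains.
      bad⇒critical : ∀ {φ} → φ ∈ Φ → ¬ Good φ →
                     ∃[ χ ] (χ ⊆ ∁ W × (t ℕ.≤ ∣ χ ∣ × Critical Φ (W ∪ χ) χ) × χ ⊆ φ)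
      bad⇒critical {φ} φ∈Φ bad-φ = minimise (suc ∣ φ ─ W ∣) ℕ.≤-refl φ∈Φ (p─q⊆p φ W)
        where
        minimise : ∀ m {ψ} → ∣ ψ ─ W ∣ ℕ.< m → ψ ∈ Φ → ψ ─ W ⊆ φ →
                   ∃[ χ ] (χ ⊆ ∁ W × (t ℕ.≤ ∣ χ ∣ × Critical Φ (W ∪ χ) χ) × χ ⊆ φ)
        minimise (suc m) {ψ} (ℕ.s≤s bound) ψ∈Φ χ⊆φ
          with all? (λ ψ′ → (ψ′ ⊆? W ∪ (ψ ─ W)) →-dec (ψ ─ W ⊆? ψ′)) Φ
        ... | yes all = ψ ─ W , (λ x∈ → x∉p⇒x∈∁p (x∈p─q⇒x∉q ψ W x∈)) ,
                (ℕ.≮⇒≥ (λ small → bad-φ (lose ψ∈Φ (χ⊆φ , small))) , lose ψ∈Φ (p⊆q∪p─q ψ W) , all) , χ⊆φ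
        -- Some ψ′ inside the union misses a point of ψ ─ W, so ψ′ ─ W is a strictly smaller
        -- candidate.
        ... | no ¬all with find (¬All⇒Any¬ (λ ψ′ → (ψ′ ⊆? W ∪ (ψ ─ W)) →-dec (ψ ─ W ⊆? ψ′)) Φ ¬all)
        ... | ψ′ , ψ′∈Φ , ¬imp = minimise m (ℕ.<-≤-trans smaller bound) ψ′∈Φ (⊆-trans ψ′─W⊆χ χ⊆φ)
          where
          ψ′⊆ : ψ′ ⊆ W ∪ (ψ ─ W)
          ψ′⊆ = decidable-stable (ψ′ ⊆? W ∪ (ψ ─ W)) (λ ⊈ → ¬imp (λ ⊆ → contradiction (λ {x} → ⊆ {x}) ⊈))
          ψ′─W⊆χ : ψ′ ─ W ⊆ ψ ─ W
          ψ′─W⊆χ = p⊆q∪r⇒p─q⊆r ψ′ W (ψ ─ W) ψ′⊆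
          smaller : ∣ ψ′ ─ W ∣ ℕ.< ∣ ψ ─ W ∣
          smaller = ⊆∧⊉⇒∣∣< ψ′─W⊆χ (λ χ⊆ → ¬imp (λ _ → ⊆-trans (λ {x} → χ⊆ {x}) (p─q⊆p ψ′ W)))

    module OneRound {Φ : List (Subset n)} {t ℓ : ℕ} {p R M : ℚ} (0≤p : 0ℚ ≤ p) (p≤1 : p ≤ 1ℚ) (0≤R : 0ℚ ≤ R)
                    (1≤pR : 1ℚ ≤ p * R) (small : ∀ {φ} → φ ∈ Φ → ∣ φ ∣ ℕ.≤ ℓ) (spread : Spread R M Φ) where

      open Fragments Φ t using (good?; bad)

      heavy : Subset n → Subset n → ℚ
      heavy χ Z = ⟦ (t ℕ.≤? ∣ χ ∣) ×-dec critical? Φ Z χ ⟧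

      0≤heavy : ∀ χ Z → 0ℚ ≤ heavy χ Z
      0≤heavy χ Z = 0≤⟦ (t ℕ.≤? ∣ χ ∣) ×-dec critical? Φ Z χ ⟧

      -- The second factor depends on W only through W ∪ χ, which is the form that `𝔼-shift`
      -- requires.
      witness : Subset n → Subset n → ℚ
      witness χ W = ⟦ χ ⊆? ∁ W ⟧ * heavy χ (W ∪ χ)

      0≤witness : ∀ χ W → 0ℚ ≤ witness χ W
      0≤witness χ W = 0≤* 0≤⟦ χ ⊆? ∁ W ⟧ (0≤heavy χ (W ∪ χ))

      opaque
        -- Each bad member contains a critical χ by `bad⇒critical`, and a given χ is charged by at
        -- most `#⊇ Φ χ` members.
        bad≤ : ∀ W → bad W Φ ≤ ∑ (subsets n) (λ χ → #⊇ Φ χ * witness χ W)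
        bad≤ W = ≤-trans (∑-mono Φ pointwise)
          (≤-reflexive (trans (∑-swap Φ (subsets n) (λ φ χ → witness χ W * ⟦ χ ⊆? φ ⟧))
            (∑-cong (subsets n) (λ χ → trans (∑-*ˡ (witness χ W) Φ (λ φ → ⟦ χ ⊆? φ ⟧)) (*-comm (witness χ W) (#⊇ Φ χ))))))
          where
          nonneg : ∀ φ χ → 0ℚ ≤ witness χ W * ⟦ χ ⊆? φ ⟧
          nonneg φ χ = 0≤* (0≤witness χ W) 0≤⟦ χ ⊆? φ ⟧

          pointwise : ∀ {φ} → φ ∈ Φ → ⟦ ¬? (good? W φ) ⟧ ≤ ∑ (subsets n) (λ χ → witness χ W * ⟦ χ ⊆? φ ⟧)
          pointwise {φ} φ∈Φ = ⟦⟧-≤ (¬? (good? W φ)) (0≤∑ (subsets n) (nonneg φ)) λ bad-φ →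
            let χ , χ⊆∁W , crit , χ⊆φ = bad⇒critical φ∈Φ bad-φ in
            ≤-trans (≤-reflexive (sym (cong₂ _*_ (cong₂ _*_ (⟦⟧-yes (χ ⊆? ∁ W) χ⊆∁W)
                (⟦⟧-yes ((t ℕ.≤? ∣ χ ∣) ×-dec critical? Φ (W ∪ χ) χ) crit)) (⟦⟧-yes (χ ⊆? φ) χ⊆φ))))
              (term≤∑ (nonneg φ) (∈-subsets χ))

      opaque
        -- The factor p ^ ∣ χ ∣ pays for the passage from W to W ∪ χ and R ^ ∣ χ ∣ for the members
        -- containing χ. If χ has fewer than t points, both sides vanish.
        weigh : ∀ χ → Dec (t ℕ.≤ ∣ χ ∣) → (p * R) ^ t * (#⊇ Φ χ * 𝔼 p (witness χ)) ≤ M * 𝔼 p (heavy χ)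
        weigh χ (yes t≤∣χ∣) = ≤-trans
          (*-monoʳ-≤-nonNeg (#⊇ Φ χ * 𝔼 p (witness χ)) {{nonNegative (0≤* (0≤#⊇ Φ χ) (0≤𝔼 0≤p p≤1 (0≤witness χ)))}}
            (^-monoʳ 1≤pR t≤∣χ∣))
          (≤-trans (≤-reflexive (trans (cong (_* (#⊇ Φ χ * 𝔼 p (witness χ))) (^-distrib-* p R ∣ χ ∣))
              (solve 4 (λ a b c d → a :* b :* (c :* d) := b :* c :* (a :* d)) refl (p ^ ∣ χ ∣) (R ^ ∣ χ ∣) (#⊇ Φ χ) (𝔼 p (witness χ)))))
            (*-mono-≤-0≤ (0≤* (0≤^ ∣ χ ∣ 0≤p) (0≤𝔼 0≤p p≤1 (0≤witness χ)))
              (≤-trans (0≤* (0≤^ ∣ χ ∣ 0≤R) (0≤#⊇ Φ χ)) (spread χ)) (spread χ)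
              (𝔼-shift 0≤p p≤1 χ (0≤heavy χ))))
        weigh χ (no t≰∣χ∣) = ≤-reflexive (trans
          (cong (λ z → (p * R) ^ t * (#⊇ Φ χ * z)) (trans (𝔼-cong p (λ W → trans
            (cong (⟦ χ ⊆? ∁ W ⟧ *_) (none (W ∪ χ))) (*-zeroʳ ⟦ χ ⊆? ∁ W ⟧))) (𝔼-const {n} p 0ℚ)))
          (trans (trans (cong ((p * R) ^ t *_) (*-zeroʳ (#⊇ Φ χ))) (*-zeroʳ ((p * R) ^ t)))
            (sym (trans (cong (M *_) (trans (𝔼-cong p none) (𝔼-const {n} p 0ℚ))) (*-zeroʳ M)))))
          where
          none : ∀ Z → heavy χ Z ≡ 0ℚ
          none Z = ⟦⟧-no ((t ℕ.≤? ∣ χ ∣) ×-dec critical? Φ Z χ) (t≰∣χ∣ ∘ proj₁)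

      opaque
        #heavy : ∀ Z → Dec (Any (_⊆ Z) Φ) → ∑ (subsets n) (λ χ → heavy χ Z) ≤ 2ℚ ^ ℓ
        #heavy Z (no none)  = ≤-trans (≤-reflexive (trans
          (∑-cong (subsets n) (λ χ → ⟦⟧-no ((t ℕ.≤? ∣ χ ∣) ×-dec critical? Φ Z χ) (none ∘ proj₁ ∘ proj₂)))
          (∑-zero (subsets n)))) (0≤^ ℓ (0≤+ 0≤1ℚ 0≤1ℚ))
        #heavy Z (yes some) = let ψ , ψ∈Φ , ψ⊆Z = find some in ≤-trans
          (∑-mono (subsets n) (λ {χ} _ → ⟦⟧-mono ((t ℕ.≤? ∣ χ ∣) ×-dec critical? Φ Z χ) (χ ⊆? ψ)
            (λ (_ , _ , all) → All.lookup all ψ∈Φ ψ⊆Z)))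
          (≤-trans (#⊆ ψ) (^-monoʳ (by-≤ 1ℚ refl 0≤1ℚ) (small ψ∈Φ)))

      -- A critical pair (W , χ) is recovered from Z = W ∪ χ and one of the at most
      -- 2 ^ ℓ subsets χ of a fixed member of Φ inside Z.
      𝔼-bad : (p * R) ^ t * 𝔼 p (λ W → bad W Φ) ≤ M * 2ℚ ^ ℓ
      𝔼-bad = begin
        c * 𝔼 p (λ W → bad W Φ)
          ≤⟨ *-monoˡ-≤-nonNeg c {{nonNegative 0≤c}} (𝔼-mono 0≤p p≤1 bad≤) ⟩
        c * 𝔼 p (λ W → ∑ (subsets n) (λ χ → #⊇ Φ χ * witness χ W))
          ≡⟨ cong (c *_) (𝔼-∑ p (subsets n) (λ W χ → #⊇ Φ χ * witness χ W)) ⟩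
        c * ∑ (subsets n) (λ χ → 𝔼 p (λ W → #⊇ Φ χ * witness χ W))
          ≡⟨ sym (∑-*ˡ c (subsets n) _) ⟩
        ∑ (subsets n) (λ χ → c * 𝔼 p (λ W → #⊇ Φ χ * witness χ W))
          ≡⟨ ∑-cong (subsets n) (λ χ → cong (c *_) (𝔼-*ˡ p (#⊇ Φ χ) (witness χ))) ⟩
        ∑ (subsets n) (λ χ → c * (#⊇ Φ χ * 𝔼 p (witness χ)))
          ≤⟨ ∑-mono (subsets n) (λ {χ} _ → weigh χ (t ℕ.≤? ∣ χ ∣)) ⟩
        ∑ (subsets n) (λ χ → M * 𝔼 p (heavy χ))
          ≡⟨ ∑-*ˡ M (subsets n) _ ⟩
        M * ∑ (subsets n) (λ χ → 𝔼 p (heavy χ))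
          ≡⟨ cong (M *_) (sym (𝔼-∑ p (subsets n) (λ Z χ → heavy χ Z))) ⟩
        M * 𝔼 p (λ Z → ∑ (subsets n) (λ χ → heavy χ Z))
          ≤⟨ *-monoˡ-≤-nonNeg M {{nonNegative 0≤M}} (𝔼-mono 0≤p p≤1 (λ Z → #heavy Z (any? (_⊆? Z) Φ))) ⟩
        M * 𝔼 {n} p (λ _ → 2ℚ ^ ℓ)
          ≡⟨ cong (M *_) (𝔼-const {n} p (2ℚ ^ ℓ)) ⟩
        M * 2ℚ ^ ℓ ∎
        where
        open ≤-Reasoning
        c = (p * R) ^ t
        0≤c : 0ℚ ≤ c
        0≤c = 0≤^ t (≤-trans 0≤1ℚ 1≤pR)
        0≤M : 0ℚ ≤ M
        0≤M = ≤-trans (0≤∑ Φ (λ _ → 0≤1ℚ)) (size≤M {R} {M} {Φ} spread)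

  ^-antitoneʳ : ∀ {p} → 0ℚ ≤ p → p ≤ 1ℚ → ∀ {m n} → m ℕ.≤ n → p ^ n ≤ p ^ m
  ^-antitoneʳ {p} 0≤p p≤1 {n = n} ℕ.z≤n = subst (p ^ n ≤_) (1^ n) (^-mono n 0≤p p≤1)
  ^-antitoneʳ {p} 0≤p p≤1 (ℕ.s≤s m≤n) = *-monoˡ-≤-nonNeg p {{nonNegative 0≤p}} (^-antitoneʳ 0≤p p≤1 m≤n)

  n<2^n : ∀ n → n ℕ.< 2 ℕ.^ n
  n<2^n zero    = ℕ.s≤s ℕ.z≤n
  n<2^n (suc n) = ℕ.<-≤-trans (ℕ.s≤s (n<2^n n)) (ℕ.+-mono-≤ (ℕ.>-nonZero⁻¹ (2 ℕ.^ n) {{ℕ.m^n≢0 2 n}}) (ℕ.m≤m+n (2 ℕ.^ n) 0))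

  1/64 1/8 ¼ : ℚ
  1/64 = ℤ.1ℤ / 64
  1/8  = ℤ.1ℤ / 8
  ¼    = ℤ.1ℤ / 4

  -- Iterated rounds

  module _ {n : ℕ} where

    missing : List (Subset n) → Subset n → ℚ
    missing Φ U = ⟦ ¬? (any? (_⊆? U) Φ) ⟧

    missing-antitone : ∀ Φ {U V} → U ⊆ V → missing Φ V ≤ missing Φ U
    missing-antitone Φ {U} {V} U⊆V = ⟦⟧-mono (¬? (any? (_⊆? V) Φ)) (¬? (any? (_⊆? U) Φ))
      (λ none some → none (Any.map {P = _⊆ U} {Q = _⊆ V} (λ φ⊆U x∈φ → U⊆V (φ⊆U x∈φ)) some))

    -- The expectation for the union of j independent random sets of density p.
    𝔼^ : ℕ → ℚ → (Subset n → ℚ) → ℚ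
    𝔼^ zero    p f = f ⊥
    𝔼^ (suc j) p f = 𝔼 p (λ W → 𝔼^ j p (λ V → f (W ∪ V)))

  -- Closed form of the sum of 1/8 * ½ ^ i over i < j.
  slack : ℕ → ℚ
  slack j = ¼ - ¼ * ½ ^ j

  𝔼-0 : ∀ {n} (f : Subset n → ℚ) → 𝔼 0ℚ f ≡ f ⊥
  𝔼-0 {zero}  f = refl
  𝔼-0 {suc n} f = trans (solve 2 (λ X Y → con 0ℚ :* X :+ (con 1ℚ :- con 0ℚ) :* Y := Y) refl
      (𝔼 0ℚ (f ∘ (inside ∷_))) (𝔼 0ℚ (f ∘ (outside ∷_))))
    (𝔼-0 (f ∘ (outside ∷_)))

  module Rounds {n : ℕ} {p : ℚ} (0≤p : 0ℚ ≤ p) (p≤1 : p ≤ 1ℚ) where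

    𝔼^-mono : ∀ j {f g : Subset n → ℚ} → (∀ W → f W ≤ g W) → 𝔼^ j p f ≤ 𝔼^ j p g
    𝔼^-mono zero    f≤g = f≤g ⊥
    𝔼^-mono (suc j) f≤g = 𝔼-mono 0≤p p≤1 (λ W → 𝔼^-mono j (λ V → f≤g (W ∪ V)))

    -- By `𝔼-∪` the union of j sets is no denser than one random set of density j p, and an antitone
    -- f can only grow.
    𝔼≤𝔼^ : ∀ j {f : Subset n → ℚ} → fromℕᵣ j * p ≤ 1ℚ → (∀ {V W} → V ⊆ W → f W ≤ f V) →
           𝔼 (fromℕᵣ j * p) f ≤ 𝔼^ j p f
    𝔼≤𝔼^ zero    {f} _ anti = ≤-reflexive (trans (cong (λ q → 𝔼 q f) (*-zeroˡ p)) (𝔼-0 f))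
    𝔼≤𝔼^ (suc j) {f} jp≤1 anti = ≤-trans (≤-reflexive (cong (λ q → 𝔼 q f) split))
      (≤-trans (𝔼-∪ 0≤p 0≤jp p+jp≤1 anti)
        (𝔼-mono 0≤p p≤1 (λ W → 𝔼≤𝔼^ j (≤-trans jp≤p+jp p+jp≤1) (λ V⊆V′ → anti (∪-monoʳ W V⊆V′)))))
      where
      split : fromℕᵣ (suc j) * p ≡ p + fromℕᵣ j * p
      split = trans (cong (_* p) (fromℕᵣ-suc j)) (solve 2 (λ p m → (con 1ℚ :+ m) :* p := p :+ m :* p) refl p (fromℕᵣ j))
      0≤jp : 0ℚ ≤ fromℕᵣ j * p
      0≤jp = 0≤* (0≤fromℕᵣ j) 0≤p
      p+jp≤1 : p + fromℕᵣ j * p ≤ 1ℚ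
      p+jp≤1 = subst (_≤ 1ℚ) split jp≤1
      jp≤p+jp : fromℕᵣ j * p ≤ p + fromℕᵣ j * p
      jp≤p+jp = subst (_≤ p + fromℕᵣ j * p) (+-identityˡ _) (+-monoˡ-≤ (fromℕᵣ j * p) 0≤p)

    module _ {R : ℚ} (0≤R : 0ℚ ≤ R) (64≤pR : fromℕᵣ 64 ≤ p * R) where

      opaque
        -- With t = 2 ^ j the ratio is (4 / 64) ^ t = 1/8 ^ t * ½ ^ t. The first factor is at most
        -- 1/8 as t ≥ 1, the second at most ½ ^ j as j < t.
        bad-small : ∀ j {X M} → 0ℚ ≤ X → 0ℚ ≤ M →
                    (p * R) ^ (2 ℕ.^ j) * X ≤ M * 2ℚ ^ (2 ℕ.^ j ℕ.+ 2 ℕ.^ j) → X ≤ M * (1/8 * ½ ^ j)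
        bad-small j {X} {M} 0≤X 0≤M bound = begin
          X                                   ≡⟨ sym (*-identityˡ X) ⟩
          1ℚ * X                              ≡⟨ cong (_* X) (sym (trans (sym (^-distrib-* 1/64 (fromℕᵣ 64) t)) (1^ t))) ⟩
          1/64 ^ t * fromℕᵣ 64 ^ t * X        ≡⟨ *-assoc (1/64 ^ t) (fromℕᵣ 64 ^ t) X ⟩
          1/64 ^ t * (fromℕᵣ 64 ^ t * X)      ≤⟨ *-monoˡ-≤-nonNeg (1/64 ^ t) {{nonNegative 0≤1/64^t}}
                                                   (≤-trans (*-monoʳ-≤-nonNeg X {{nonNegative 0≤X}} (^-mono t (0≤fromℕᵣ 64) 64≤pR)) bound) ⟩
          1/64 ^ t * (M * 2ℚ ^ (t ℕ.+ t))     ≡⟨ cong (λ z → 1/64 ^ t * (M * z)) (trans (^-homo-* 2ℚ t t) (sym (^-distrib-* 2ℚ 2ℚ t))) ⟩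
          1/64 ^ t * (M * (2ℚ * 2ℚ) ^ t)      ≡⟨ solve 3 (λ a M b → a :* (M :* b) := M :* (a :* b)) refl (1/64 ^ t) M ((2ℚ * 2ℚ) ^ t) ⟩
          M * (1/64 ^ t * (2ℚ * 2ℚ) ^ t)      ≡⟨ cong (M *_) (trans (sym (^-distrib-* 1/64 (2ℚ * 2ℚ) t)) (^-distrib-* 1/8 ½ t)) ⟩
          M * (1/8 ^ t * ½ ^ t)               ≤⟨ *-monoˡ-≤-nonNeg M {{nonNegative 0≤M}} (*-mono-≤-0≤ (0≤^ t (<⇒≤ 0<½)) 0≤1/8
                                                   (subst (1/8 ^ t ≤_) (*-identityʳ 1/8) (^-antitoneʳ 0≤1/8 (≤-decide 1/8 1ℚ) (ℕ.>-nonZero⁻¹ t {{ℕ.m^n≢0 2 j}})))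
                                                   (^-antitoneʳ (<⇒≤ 0<½) (≤-decide ½ 1ℚ) (ℕ.<⇒≤ (n<2^n j)))) ⟩
          M * (1/8 * ½ ^ j)                   ∎
          where
          open ≤-Reasoning
          ≤-decide : ∀ p q {_ : True (p ≤? q)} → p ≤ q
          ≤-decide p q {p≤q} = toWitness p≤q
          t : ℕ
          t = 2 ℕ.^ j
          0≤1/8 : 0ℚ ≤ 1/8
          0≤1/8 = ≤-decide 0ℚ 1/8
          0≤1/64^t : 0ℚ ≤ 1/64 ^ t
          0≤1/64^t = 0≤^ t (≤-decide 0ℚ 1/64)

      1≤pR : 1ℚ ≤ p * R
      1≤pR = ≤-trans (1≤fromℕᵣ-suc 63) 64≤pR

      -- A round replaces most members φ by fragments ψ ─ W ⊆ φ of at most half the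
      -- size, which are as spread as Φ is; slack j bounds the losses of j rounds.
      rounds : ∀ j {M Φ} → (∀ {φ} → φ ∈ Φ → ∣ φ ∣ ℕ.< 2 ℕ.^ j) → Spread R M Φ →
               M * 𝔼^ j p (missing Φ) ≤ M - size Φ + M * slack j
      rounds zero {M} {[]} small spread =
        ≤-reflexive (solve 1 (λ M → M :* con 1ℚ := M :- con 0ℚ :+ M :* (con ¼ :- con ¼ :* con 1ℚ)) refl M)
      -- A member with fewer than 2 ^ 0 points is empty, so even ⊥ contains it and nothing is
      -- missing.
      rounds zero {M} {φ ∷ Φ} small spread = ≤-trans
        (≤-reflexive (trans (cong (M *_) (⟦⟧-no (¬? (any? (_⊆? ⊥) (φ ∷ Φ))) (λ none → none (here φ⊆⊥)))) (*-zeroʳ M)))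
        (≤-trans (p≤q⇒0≤q-p (size≤M {n} {R} {M} {φ ∷ Φ} spread))
          (≤-reflexive (solve 2 (λ M s → M :- s := M :- s :+ M :* (con ¼ :- con ¼ :* con 1ℚ)) refl M (size (φ ∷ Φ)))))
        where
        φ⊆⊥ : φ ⊆ ⊥
        φ⊆⊥ {x} x∈φ = contradiction (ℕ.<-≤-trans (small (here refl))
          (subst (ℕ._≤ ∣ φ ∣) (∣⁅x⁆∣≡1 x) (p⊆q⇒∣p∣≤∣q∣ (λ y∈ → subst (S._∈ φ) (sym (x∈⁅y⁆⇒x≡y x y∈)) x∈φ)))) (ℕ.<-irrefl refl)
      rounds (suc j) {M} {Φ} small spread = begin
        M * 𝔼 p (λ W → 𝔼^ j p (λ V → missing Φ (W ∪ V)))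
          ≡⟨ sym (𝔼-*ˡ p M (λ W → 𝔼^ j p (λ V → missing Φ (W ∪ V)))) ⟩
        𝔼 p (λ W → M * 𝔼^ j p (λ V → missing Φ (W ∪ V)))
          ≤⟨ 𝔼-mono 0≤p p≤1 round ⟩
        𝔼 p (λ W → bad W Φ + K)
          ≡⟨ trans (𝔼-+ p (λ W → bad W Φ) (λ _ → K)) (cong (𝔼 p (λ W → bad W Φ) +_) (𝔼-const {n} p K)) ⟩
        𝔼 p (λ W → bad W Φ) + K
          ≤⟨ +-monoˡ-≤ K (bad-small j (0≤𝔼 0≤p p≤1 (λ W → 0≤∑ Φ (λ φ → 0≤⟦ ¬? (good? W φ) ⟧))) 0≤M
               (OneRound.𝔼-bad {Φ = Φ} {t} 0≤p p≤1 0≤R 1≤pR small′ spread)) ⟩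
        M * (1/8 * ½ ^ j) + K
          ≡⟨ solve 3 (λ M s h → M :* (con 1/8 :* h) :+ (M :- s :+ M :* (con ¼ :- con ¼ :* h)) :=
               M :- s :+ M :* (con ¼ :- con ¼ :* (con ½ :* h))) refl M (size Φ) (½ ^ j) ⟩
        M - size Φ + M * slack (suc j) ∎
        where
        open ≤-Reasoning
        t = 2 ℕ.^ j
        open Fragments Φ t
        K = M - size Φ + M * slack j
        0≤M : 0ℚ ≤ M
        0≤M = ≤-trans (0≤∑ Φ (λ _ → 0≤1ℚ)) (size≤M {n} {R} {M} {Φ} spread)

        small′ : ∀ {φ} → φ ∈ Φ → ∣ φ ∣ ℕ.≤ t ℕ.+ t
        small′ {φ} φ∈Φ = subst (∣ φ ∣ ℕ.≤_) (cong (t ℕ.+_) (ℕ.+-identityʳ t)) (ℕ.<⇒≤ (small φ∈Φ))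

        covers : ∀ W V → missing Φ (W ∪ V) ≤ missing (fragments W Φ) V
        covers W V = ⟦⟧-mono (¬? (any? (_⊆? W ∪ V) Φ)) (¬? (any? (_⊆? V) (fragments W Φ))) λ none some →
          let χ , χ∈ , χ⊆V = find some
              _ , ψ , ψ∈Φ , χ≡ = fragment-of W Φ χ∈
          in none (lose ψ∈Φ (⊆-trans (p⊆q∪p─q ψ W) (∪-monoʳ W (subst (_⊆ V) χ≡ χ⊆V))))

        round : ∀ W → M * 𝔼^ j p (λ V → missing Φ (W ∪ V)) ≤ bad W Φ + K
        round W = ≤-trans
          (*-monoˡ-≤-nonNeg M {{nonNegative 0≤M}} (𝔼^-mono j (covers W)))
          (≤-trans
            (rounds j {M} {fragments W Φ} (λ χ∈ → proj₁ (fragment-of W Φ χ∈)) (λ S → ≤-trans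
              (*-monoˡ-≤-nonNeg (R ^ ∣ S ∣) {{nonNegative (0≤^ ∣ S ∣ 0≤R)}} (#⊇-fragments W Φ S)) (spread S)))
            (≤-reflexive (trans
              (solve 4 (λ M s b c → M :- s :+ c := b :+ (M :- (s :+ b) :+ c)) refl M (size (fragments W Φ)) (bad W Φ) (M * slack j))
              (cong (λ z → bad W Φ + (M - z + M * slack j)) (sym (size-fragments W Φ))))))

  -- The spread lemma of Alweiss, Lovász, Wu and Zhang.
  spread⇒contained : ∀ {n T p R M} {Φ : List (Subset n)} → 0ℚ ≤ p → fromℕᵣ T * p ≡ ½ → p ≤ 1ℚ → 0ℚ ≤ R → fromℕᵣ 64 ≤ p * R →
    0ℚ < M → (∀ {φ} → φ ∈ Φ → ∣ φ ∣ ℕ.< 2 ℕ.^ T) → Spread R M Φ → M - size Φ ≤ M * ¼ → 𝔼 ½ (missing Φ) < ½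
  spread⇒contained {n} {T} {p} {R} {M} {Φ} 0≤p Tp≡½ p≤1 0≤R 64≤pR 0<M small spread large =
    *-cancelˡ-<-nonNeg M {{nonNegative (<⇒≤ 0<M)}} (≤-<-trans
      (≤-trans (*-monoˡ-≤-nonNeg M {{nonNegative (<⇒≤ 0<M)}}
          (subst (λ q → 𝔼 q (missing Φ) ≤ 𝔼^ T p (missing Φ)) Tp≡½
            (𝔼≤𝔼^ T (subst (_≤ 1ℚ) (sym Tp≡½) ½≤1) (missing-antitone Φ))))
        (≤-trans (rounds 0≤R 64≤pR T small spread) (+-monoˡ-≤ (M * slack T) large)))
      -- A quarter of M for the initial deficit and less than a quarter for all rounds leave a
      -- positive gap to ½.
      (by-< (M * (¼ * ½ ^ T))
        (solve 2 (λ M h → M :* con ½ :- (M :* con ¼ :+ M :* (con ¼ :- con ¼ :* h)) := M :* (con ¼ :* h)) refl M (½ ^ T))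
        (0<* 0<M (0<* (positive⁻¹ ¼) (0<^ T 0<½)))))
    where
    open Rounds {n} {p} 0≤p p≤1
    ½≤1 = toWitness {a? = ½ ≤? 1ℚ} _

  -- If all members met, no U could contain a member of Φ while ∁ U contains one of Ψ. The two
  -- probabilities of missing would then sum to at least 1.
  disjoint-members : ∀ {n} {Φ Ψ : List (Subset n)} → 𝔼 ½ (missing Φ) < ½ → 𝔼 ½ (missing Ψ) < ½ →
    ¬ (∀ {φ ψ} → φ ∈ Φ → ψ ∈ Ψ → S.Nonempty (φ ∩ ψ))
  disjoint-members {n} {Φ} {Ψ} Φ<½ Ψ<½ meet = <-irrefl refl (≤-<-trans
    (≤-trans (≤-reflexive (sym (𝔼-const {n} ½ 1ℚ)))
      (𝔼-mono (<⇒≤ 0<½) (toWitness {a? = ½ ≤? 1ℚ} _) one-missing))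
    (≤-<-trans (≤-reflexive (trans (𝔼-+ ½ (missing Φ) (missing Ψ ∘ ∁)) (cong (𝔼 ½ (missing Φ) +_) (𝔼-∁ refl (missing Ψ)))))
      (+-mono-< Φ<½ Ψ<½)))
    where
    one-missing : ∀ U → 1ℚ ≤ missing Φ U + missing Ψ (∁ U)
    one-missing U with any? (_⊆? U) Φ | any? (_⊆? ∁ U) Ψ
    ... | no _     | Ψ∈?     = by-≤ ⟦ ¬? Ψ∈? ⟧ (solve 1 (λ x → con 1ℚ :+ x :- con 1ℚ := x) refl ⟦ ¬? Ψ∈? ⟧) 0≤⟦ ¬? Ψ∈? ⟧
    ... | yes _    | no _    = ≤-refl
    ... | yes some | yes some′ =
      let φ , φ∈Φ , φ⊆U = find some
          ψ , ψ∈Ψ , ψ⊆∁U = find some′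
          x , x∈ = meet φ∈Φ ψ∈Ψ
          x∈φ , x∈ψ = x∈p∩q⁻ φ ψ x∈
      in contradiction (φ⊆U x∈φ) (x∈∁p⇒x∉p (ψ⊆∁U x∈ψ))

  -- Duplicate-free lists and cardinalities

  module _ {X : Set} where

    ∑-⊆ : ∀ {xs ys : List X} {f : X → ℚ} → (∀ x → 0ℚ ≤ f x) → Unique xs → (∀ {x} → x ∈ xs → x ∈ ys) → ∑ xs f ≤ ∑ ys f
    ∑-⊆ {ys = ys} 0≤f [] xs⊆ys = 0≤∑ ys 0≤f
    ∑-⊆ {x ∷ xs} {f = f} 0≤f (x∉xs ∷ unique) xs⊆ys with ∈-∃++ (xs⊆ys (here refl))
    ... | as , bs , refl = begin
      f x + ∑ xs f               ≤⟨ +-monoʳ-≤ (f x) (∑-⊆ 0≤f unique avoid) ⟩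
      f x + ∑ (as ++ bs) f       ≡⟨ cong (f x +_) (∑-++ as bs f) ⟩
      f x + (∑ as f + ∑ bs f)    ≡⟨ solve 3 (λ a b c → a :+ (b :+ c) := b :+ (a :+ c)) refl (f x) (∑ as f) (∑ bs f) ⟩
      ∑ as f + (f x + ∑ bs f)    ≡⟨ sym (∑-++ as (x ∷ bs) f) ⟩
      ∑ (as ++ x ∷ bs) f         ∎
      where
      open ≤-Reasoning
      avoid : ∀ {y} → y ∈ xs → y ∈ as ++ bs
      avoid y∈xs with ∈-++⁻ as (xs⊆ys (there y∈xs))
      ... | inj₁ y∈as         = ∈-++⁺ˡ y∈as
      ... | inj₂ (here refl)  = contradiction refl (All.lookup x∉xs y∈xs)
      ... | inj₂ (there y∈bs) = ∈-++⁺ʳ as y∈bs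

    -- The counting form of an injection. Symmetry arguments run on such inequalities, without a
    -- bijection of lists.
    ∑-reindex : ∀ {Y : Set} {ys : List Y} {xs : List X} {f : X → ℚ} {g : Y → ℚ} (h : Y → X) → (∀ x → 0ℚ ≤ f x) →
                (∀ {y z} → h y ≡ h z → y ≡ z) → Unique ys → (∀ {y} → y ∈ ys → h y ∈ xs) →
                (∀ y → g y ≤ f (h y)) → ∑ ys g ≤ ∑ xs f
    ∑-reindex {ys = ys} {f = f} h 0≤f inj unique h∈ g≤f = ≤-trans (∑-mono ys (λ {y} _ → g≤f y))
      (subst (_≤ _) (∑-map h ys f) (∑-⊆ 0≤f (Unique.map⁺ inj unique)
        (λ x∈ → let _ , y∈ , x≡ = ∈-map⁻ h x∈ in subst (_∈ _) (sym x≡) (h∈ y∈))))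

    ∑-filter : ∀ {P : X → Set} (P? : ∀ x → Dec (P x)) xs (f : X → ℚ) → ∑ (filter P? xs) f ≡ ∑ xs (λ x → ⟦ P? x ⟧ * f x)
    ∑-filter P? []       f = refl
    ∑-filter P? (x ∷ xs) f with P? x
    ... | yes _ = cong₂ _+_ (sym (*-identityˡ (f x))) (∑-filter P? xs f)
    ... | no _  = trans (∑-filter P? xs f) (sym (trans (cong (_+ ∑ xs (λ x → ⟦ P? x ⟧ * f x)) (*-zeroˡ (f x))) (+-identityˡ _)))

  ∑-cartesianProductWith : ∀ {X Y Z : Set} (h : X → Y → Z) xs ys (f : Z → ℚ) →
                           ∑ (cartesianProductWith h xs ys) f ≡ ∑ xs (λ x → ∑ ys (λ y → f (h x y)))
  ∑-cartesianProductWith h []       ys f = refl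
  ∑-cartesianProductWith h (x ∷ xs) ys f = trans (∑-++ (map (h x) ys) _ f)
    (cong₂ _+_ (∑-map (h x) ys f) (∑-cartesianProductWith h xs ys f))

  opaque
    ∑-const-allFin : ∀ n c → ∑ (allFin n) (λ _ → c) ≡ fromℕᵣ n * c
    ∑-const-allFin n c = trans (∑-const (allFin n) c) (cong (λ m → fromℕᵣ m * c) (length-tabulate {n = n} (λ i → i)))

  size-allFin : ∀ n → size (allFin n) ≡ fromℕᵣ n
  size-allFin n = trans (∑-const-allFin n 1ℚ) (*-identityʳ (fromℕᵣ n))

  allFin-suc : ∀ n → allFin (suc n) ≡ zero ∷ map suc (allFin n)
  allFin-suc n = cong (zero ∷_) (sym (map-tabulate (λ i → i) suc))

  -- The size as a sum of indicators, ready for interchange with other sums in double counting.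
  card : ∀ {n} → Subset n → ℚ
  card {n} p = ∑ (allFin n) (λ i → ⟦ i ∈? p ⟧)

  ∣∣≡card : ∀ {n} (p : Subset n) → fromℕᵣ ∣ p ∣ ≡ card p
  ∣∣≡card [] = refl
  ∣∣≡card {suc n} (s ∷ p) = trans (head s) (sym (trans (cong (λ xs → ∑ xs (λ i → ⟦ i ∈? s ∷ p ⟧)) (allFin-suc n))
    (cong (⟦ zero ∈? s ∷ p ⟧ +_) (trans (∑-map suc (allFin n) (λ i → ⟦ i ∈? s ∷ p ⟧))
      (∑-cong (allFin n) (λ i → ≤-antisym (⟦⟧-mono (suc i ∈? s ∷ p) (i ∈? p) drop-there) (⟦⟧-mono (i ∈? p) (suc i ∈? s ∷ p) there)))))))
    where
    head : ∀ s → fromℕᵣ ∣ s ∷ p ∣ ≡ ⟦ zero ∈? s ∷ p ⟧ + ∑ (allFin n) (λ i → ⟦ i ∈? p ⟧)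
    head inside  = trans (fromℕᵣ-suc ∣ p ∣) (cong (1ℚ +_) (∣∣≡card p))
    head outside = trans (∣∣≡card p) (sym (+-identityˡ _))

  ∣p∣+∣q∣≤∣p∪q∣ : ∀ {n} (p q : Subset n) → ¬ S.Nonempty (p ∩ q) → ∣ p ∣ ℕ.+ ∣ q ∣ ℕ.≤ ∣ p ∪ q ∣
  ∣p∣+∣q∣≤∣p∪q∣ []            []            _    = ℕ.z≤n
  ∣p∣+∣q∣≤∣p∪q∣ (inside ∷ p)  (inside ∷ q)  disj = contradiction (zero , here) disj
  ∣p∣+∣q∣≤∣p∪q∣ (inside ∷ p)  (outside ∷ q) disj = ℕ.s≤s (∣p∣+∣q∣≤∣p∪q∣ p q (λ (i , i∈) → disj (suc i , there i∈)))
  ∣p∣+∣q∣≤∣p∪q∣ (outside ∷ p) (inside ∷ q)  disj = subst (ℕ._≤ suc ∣ p ∪ q ∣) (sym (ℕ.+-suc ∣ p ∣ ∣ q ∣))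
    (ℕ.s≤s (∣p∣+∣q∣≤∣p∪q∣ p q (λ (i , i∈) → disj (suc i , there i∈))))
  ∣p∣+∣q∣≤∣p∪q∣ (outside ∷ p) (outside ∷ q) disj = ∣p∣+∣q∣≤∣p∪q∣ p q (λ (i , i∈) → disj (suc i , there i∈))

  ∣++∣ : ∀ {m n} (p : Subset m) (q : Subset n) → ∣ p Vec.++ q ∣ ≡ ∣ p ∣ ℕ.+ ∣ q ∣
  ∣++∣ []            q = refl
  ∣++∣ (inside ∷ p)  q = cong suc (∣++∣ p q)
  ∣++∣ (outside ∷ p) q = ∣++∣ p q

  ++⊆++⁻ : ∀ {m n} (p p′ : Subset m) {q q′ : Subset n} → p Vec.++ q ⊆ p′ Vec.++ q′ → p ⊆ p′ × q ⊆ q′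
  ++⊆++⁻ p p′ {q} {q′} sub =
    (λ {i} i∈p → lookup⇒[]= i p′ (trans (sym (lookup-++ˡ p′ q′ i)) ([]=⇒lookup (sub (lookup⇒[]= (i Fin.↑ˡ _) (p Vec.++ q) (trans (lookup-++ˡ p q i) ([]=⇒lookup i∈p))))))) ,
    (λ {i} i∈q → lookup⇒[]= i q′ (trans (sym (lookup-++ʳ p′ q′ i)) ([]=⇒lookup (sub (lookup⇒[]= (_ Fin.↑ʳ i) (p Vec.++ q) (trans (lookup-++ʳ p q i) ([]=⇒lookup i∈q)))))))

  unique-subsets : ∀ n → Unique (subsets n)
  unique-subsets zero    = All.[] ∷ []
  unique-subsets (suc n) = Unique.++⁺ (Unique.map⁺ ∷-injectiveʳ (unique-subsets n)) (Unique.map⁺ ∷-injectiveʳ (unique-subsets n))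
    (λ (in₁ , in₂) → let _ , _ , eq₁ = ∈-map⁻ (inside ∷_) in₁
                         _ , _ , eq₂ = ∈-map⁻ (outside ∷_) in₂ in absurd (trans (sym eq₁) eq₂))
    where
    absurd : ∀ {p q : Subset n} → ¬ (inside ∷ p ≡ outside ∷ q)
    absurd ()
    ∷-injectiveʳ : ∀ {s} {p q : Subset n} → s ∷ p ≡ s ∷ q → p ≡ q
    ∷-injectiveʳ refl = refl

  -- The graph of a vector, a set of positions i and symbols a coded as combine i a

  graph : ∀ {k n} → Vec (Fin k) n → Subset (n ℕ.* k)
  graph []      = []
  graph (a ∷ v) = ⁅ a ⁆ Vec.++ graph v

  ∣graph∣ : ∀ {k n} (v : Vec (Fin k) n) → ∣ graph v ∣ ≡ n
  ∣graph∣ []      = refl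
  ∣graph∣ (a ∷ v) = trans (∣++∣ ⁅ a ⁆ (graph v)) (cong₂ ℕ._+_ (∣⁅x⁆∣≡1 a) (∣graph∣ v))

  ∈-graph⁺ : ∀ {k n} (v : Vec (Fin k) n) i {a} → lookup v i ≡ a → Fin.combine i a S.∈ graph v
  ∈-graph⁺ (a ∷ v) zero refl = lookup⇒[]= _ (⁅ a ⁆ Vec.++ graph v) (trans (lookup-++ˡ ⁅ a ⁆ (graph v) a) ([]=⇒lookup (x∈⁅x⁆ a)))
  ∈-graph⁺ (b ∷ v) (suc i) {a} eq = lookup⇒[]= _ (⁅ b ⁆ Vec.++ graph v)
    (trans (lookup-++ʳ ⁅ b ⁆ (graph v) (Fin.combine i a)) ([]=⇒lookup (∈-graph⁺ v i eq)))

  ∈-graph⁻ : ∀ {k n} (v : Vec (Fin k) n) i {a} → Fin.combine i a S.∈ graph v → lookup v i ≡ a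
  ∈-graph⁻ {k} {suc n} (b ∷ v) zero {a} a∈ = sym (x∈⁅y⁆⇒x≡y b (lookup⇒[]= a ⁅ b ⁆
    (trans (sym (lookup-++ˡ ⁅ b ⁆ (graph v) a)) ([]=⇒lookup a∈))))
  ∈-graph⁻ {k} {suc n} (b ∷ v) (suc i) {a} a∈ = ∈-graph⁻ v i (lookup⇒[]= (Fin.combine i a) (graph v)
    (trans (sym (lookup-++ʳ ⁅ b ⁆ (graph v) (Fin.combine i a))) ([]=⇒lookup a∈)))

  vectors : ∀ k n → List (Vec (Fin k) n)
  vectors k zero    = [ [] ]
  vectors k (suc n) = cartesianProductWith _∷_ (allFin k) (vectors k n)

  ∈-vectors : ∀ {k n} (v : Vec (Fin k) n) → v ∈ vectors k n
  ∈-vectors []      = here refl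
  ∈-vectors (a ∷ v) = ∈-cartesianProductWith⁺ _∷_ (∈-allFin a) (∈-vectors v)

  opaque
    ∑⟦≡⟧≤1 : ∀ {k} {xs : List (Fin k)} b → Unique xs → ∑ xs (λ a → ⟦ a Fin.≟ b ⟧) ≤ 1ℚ
    ∑⟦≡⟧≤1 b [] = 0≤1ℚ
    ∑⟦≡⟧≤1 {xs = a ∷ xs} b (a∉xs ∷ unique) with a Fin.≟ b
    ... | no _     = ≤-trans (≤-reflexive (+-identityˡ _)) (∑⟦≡⟧≤1 b unique)
    ... | yes refl = ≤-reflexive (trans (cong (1ℚ +_) (≤-antisym
        (≤-trans (∑-mono xs (λ {c} c∈xs → ≤-reflexive (⟦⟧-no (c Fin.≟ a) (λ c≡a → All.lookup a∉xs c∈xs (sym c≡a)))))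
          (≤-reflexive (∑-zero xs)))
        (0≤∑ xs (λ c → 0≤⟦ c Fin.≟ a ⟧)))) (+-identityʳ 1ℚ))

    -- According to whether p has no point, one or more, at most k, at most one or none of the
    -- singletons contain it.
    row-count : ∀ {k} (p : Subset k) → fromℕᵣ k ^ ∣ p ∣ * ∑ (allFin k) (λ a → ⟦ p ⊆? ⁅ a ⁆ ⟧) ≤ fromℕᵣ k
    row-count {k} p with nonempty? p | 1 ℕ.<? ∣ p ∣
    ... | no empty     | _        = ≤-trans
      (≤-reflexive (trans (cong (λ m → fromℕᵣ k ^ m * ∑ (allFin k) (λ a → ⟦ p ⊆? ⁅ a ⁆ ⟧))
          (trans (cong ∣_∣ (Empty-unique empty)) (∣⊥∣≡0 k))) (*-identityˡ _)))
      (≤-trans (∑-mono (allFin k) (λ {a} _ → ⟦ p ⊆? ⁅ a ⁆ ⟧≤1)) (≤-reflexive (size-allFin k)))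
    ... | yes (b , b∈p) | yes big = ≤-trans
      (≤-reflexive (trans (cong (fromℕᵣ k ^ ∣ p ∣ *_) (trans (∑-cong (allFin k) (λ a → ⟦⟧-no (p ⊆? ⁅ a ⁆)
        (λ p⊆a → ℕ.<⇒≱ big (subst (∣ p ∣ ℕ.≤_) (∣⁅x⁆∣≡1 a) (p⊆q⇒∣p∣≤∣q∣ p⊆a)))))
          (∑-zero (allFin k)))) (*-zeroʳ (fromℕᵣ k ^ ∣ p ∣)))) (0≤fromℕᵣ k)
    ... | yes (b , b∈p) | no small = ≤-trans
      (*-mono-≤-0≤ (0≤∑ (allFin k) (λ a → 0≤⟦ p ⊆? ⁅ a ⁆ ⟧)) (0≤fromℕᵣ k) (power k b)
        (≤-trans (∑-mono (allFin k) (λ {a} _ → ⟦⟧-mono (p ⊆? ⁅ a ⁆) (a Fin.≟ b) (λ p⊆a → sym (x∈⁅y⁆⇒x≡y a (p⊆a b∈p)))))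
          (∑⟦≡⟧≤1 b (Unique.allFin⁺ k))))
      (≤-reflexive (*-identityʳ (fromℕᵣ k)))
      where
      power : ∀ k → Fin k → fromℕᵣ k ^ ∣ p ∣ ≤ fromℕᵣ k
      power (suc k) _ = subst (fromℕᵣ (suc k) ^ ∣ p ∣ ≤_) (*-identityʳ _) (^-monoʳ (1≤fromℕᵣ-suc k) (ℕ.≮⇒≥ small))

  -- At most k^(n - ∣J∣) vectors pass through J, stated without subtraction. The rows of a vector
  -- are independent, so the bounds of `row-count` multiply.
  graph-count : ∀ k n (J : Subset (n ℕ.* k)) → fromℕᵣ k ^ ∣ J ∣ * ∑ (vectors k n) (λ v → ⟦ J ⊆? graph v ⟧) ≤ fromℕᵣ k ^ n
  graph-count k zero    [] = ≤-trans (≤-reflexive (*-identityˡ _))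
    (≤-trans (≤-reflexive (+-identityʳ ⟦ [] ⊆? [] ⟧)) ⟦ [] ⊆? [] ⟧≤1)
  graph-count k (suc n) J with Vec.splitAt k J
  ... | P , Q , refl = begin
    K ^ ∣ P Vec.++ Q ∣ * ∑ (vectors k (suc n)) (λ v → ⟦ P Vec.++ Q ⊆? graph v ⟧)
      ≡⟨ cong₂ _*_ (trans (cong (K ^_) (∣++∣ P Q)) (^-homo-* K ∣ P ∣ ∣ Q ∣))
           (∑-cartesianProductWith _∷_ (allFin k) (vectors k n) (λ v → ⟦ P Vec.++ Q ⊆? graph v ⟧)) ⟩
    K ^ ∣ P ∣ * K ^ ∣ Q ∣ * ∑ (allFin k) (λ a → ∑ (vectors k n) (λ v → ⟦ P Vec.++ Q ⊆? ⁅ a ⁆ Vec.++ graph v ⟧))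
      ≤⟨ *-monoˡ-≤-nonNeg (K ^ ∣ P ∣ * K ^ ∣ Q ∣) {{nonNegative (0≤* (0≤^ ∣ P ∣ 0≤K) (0≤^ ∣ Q ∣ 0≤K))}}
           (∑-mono (allFin k) (λ {a} _ → ≤-trans (∑-mono (vectors k n) (λ {v} _ → separate a v))
             (≤-reflexive (trans (∑-*ˡ ⟦ P ⊆? ⁅ a ⁆ ⟧ (vectors k n) (λ v → ⟦ Q ⊆? graph v ⟧)) (*-comm _ tails))))) ⟩
    K ^ ∣ P ∣ * K ^ ∣ Q ∣ * ∑ (allFin k) (λ a → tails * ⟦ P ⊆? ⁅ a ⁆ ⟧)
      ≡⟨ cong (K ^ ∣ P ∣ * K ^ ∣ Q ∣ *_) (∑-*ˡ tails (allFin k) (λ a → ⟦ P ⊆? ⁅ a ⁆ ⟧)) ⟩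
    K ^ ∣ P ∣ * K ^ ∣ Q ∣ * (tails * heads)
      ≡⟨ solve 4 (λ a b c d → a :* b :* (c :* d) := a :* d :* (b :* c)) refl (K ^ ∣ P ∣) (K ^ ∣ Q ∣) tails heads ⟩
    K ^ ∣ P ∣ * heads * (K ^ ∣ Q ∣ * tails)
      ≤⟨ *-mono-≤-0≤ (0≤* (0≤^ ∣ Q ∣ 0≤K) (0≤∑ (vectors k n) (λ v → 0≤⟦ Q ⊆? graph v ⟧))) 0≤K (row-count P) (graph-count k n Q) ⟩
    K ^ suc n ∎
    where
    open ≤-Reasoning
    K heads tails : ℚ
    K = fromℕᵣ k
    0≤K : 0ℚ ≤ K
    0≤K = 0≤fromℕᵣ k
    heads = ∑ (allFin k) (λ a → ⟦ P ⊆? ⁅ a ⁆ ⟧)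
    tails = ∑ (vectors k n) (λ v → ⟦ Q ⊆? graph v ⟧)
    separate : ∀ a v → ⟦ P Vec.++ Q ⊆? ⁅ a ⁆ Vec.++ graph v ⟧ ≤ ⟦ P ⊆? ⁅ a ⁆ ⟧ * ⟦ Q ⊆? graph v ⟧
    separate a v = ⟦⟧-≤ (P Vec.++ Q ⊆? ⁅ a ⁆ Vec.++ graph v) (0≤* 0≤⟦ P ⊆? ⁅ a ⁆ ⟧ 0≤⟦ Q ⊆? graph v ⟧) λ sub →
      let P⊆ , Q⊆ = ++⊆++⁻ P ⁅ a ⁆ sub in
      ≤-reflexive (sym (cong₂ _*_ (⟦⟧-yes (P ⊆? ⁅ a ⁆) P⊆) (⟦⟧-yes (Q ⊆? graph v) Q⊆)))

  fromℕᵣ-cancel-< : ∀ {m n} → fromℕᵣ m < fromℕᵣ n → m ℕ.< n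
  fromℕᵣ-cancel-< {m} {n} m<n with m ℕ.<? n
  ... | yes m<n′ = m<n′
  ... | no m≮n   = contradiction (<-≤-trans m<n (fromℕᵣ-mono (ℕ.≮⇒≥ m≮n))) (<-irrefl refl)

  fromℕᵣ-cancel-≤ : ∀ {m n} → fromℕᵣ m ≤ fromℕᵣ n → m ℕ.≤ n
  fromℕᵣ-cancel-≤ {m} {n} m≤n = ℕ.<⇒≤pred (fromℕᵣ-cancel-< {m} {suc n} (≤-<-trans m≤n
    (by-< 1ℚ (trans (cong (_- fromℕᵣ n) (fromℕᵣ-suc n)) (solve 1 (λ x → con 1ℚ :+ x :- x := con 1ℚ) refl (fromℕᵣ n))) 0<1ℚ)))

  -- Sets of positions of maximal weight

  module Action (k n : ℕ) where

    move : (Fin n → Fin n) → Fin (n ℕ.* k) → Fin (n ℕ.* k)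
    move σ e = let i , a = Fin.remQuot {n} k e in Fin.combine (σ i) a

    move-combine : ∀ σ i a → move σ (Fin.combine i a) ≡ Fin.combine (σ i) a
    move-combine σ i a = cong (λ (j , b) → Fin.combine (σ j) b) (Fin.remQuot-combine i a)

    position : ∀ (e : Fin (n ℕ.* k)) → ∃[ i ] ∃[ a ] e ≡ Fin.combine i a
    position e = proj₁ (Fin.remQuot {n} k e) , proj₂ (Fin.remQuot {n} k e) , sym (Fin.combine-remQuot {n} k e)

    move-inverse : ∀ σ τ → (∀ i → σ (τ i) ≡ i) → ∀ e → move σ (move τ e) ≡ e
    move-inverse σ τ inv e with position e
    ... | i , a , refl = trans (cong (move σ) (move-combine τ i a))
      (trans (move-combine σ (τ i) a) (cong (λ j → Fin.combine j a) (inv i)))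

    -- A preimage, because `permute` also reads its argument at σ i. The two then match without
    -- inverting σ.
    pull : (Fin n → Fin n) → Subset (n ℕ.* k) → Subset (n ℕ.* k)
    pull σ J = tabulate (λ e → lookup J (move σ e))

    ∈-pull⁺ : ∀ σ J {e} → move σ e S.∈ J → e S.∈ pull σ J
    ∈-pull⁺ σ J {e} ∈J = lookup⇒[]= e (pull σ J) (trans (lookup∘tabulate _ e) ([]=⇒lookup ∈J))

    ∈-pull⁻ : ∀ σ J {e} → e S.∈ pull σ J → move σ e S.∈ J
    ∈-pull⁻ σ J {e} e∈ = lookup⇒[]= (move σ e) J (trans (sym (lookup∘tabulate _ e)) ([]=⇒lookup e∈))

    row≤card : ∀ a (J : Subset (n ℕ.* k)) → ∑ (allFin n) (λ i → ⟦ Fin.combine i a ∈? J ⟧) ≤ card J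
    row≤card a J = ∑-reindex {ys = allFin n} {xs = allFin (n ℕ.* k)} {f = λ e → ⟦ e ∈? J ⟧} (λ i → Fin.combine i a) (λ e → 0≤⟦ e ∈? J ⟧)
      (λ {i} {j} → Fin.combine-injectiveˡ i a j a) (Unique.allFin⁺ n) (λ {i} _ → ∈-allFin (Fin.combine i a)) (λ i → ≤-refl)

    module _ (σ : Permutation′ n) where

      σʳ σˡ : Fin n → Fin n
      σʳ = σ ⟨$⟩ʳ_
      σˡ = σ ⟨$⟩ˡ_

      pull-injective : ∀ {I J} → pull σʳ I ≡ pull σʳ J → I ≡ J
      pull-injective {I} {J} eq = ⊆-antisym (half-of I J (λ {x} → subst (x S.∈_) eq)) (half-of J I (λ {x} → subst (x S.∈_) (sym eq)))
        where
        half-of : ∀ I J → pull σʳ I ⊆ pull σʳ J → I ⊆ J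
        half-of I J sub {e} e∈I = subst (S._∈ J) (move-inverse σʳ σˡ (λ _ → inverseʳ σ) e)
          (∈-pull⁻ σʳ J (sub (∈-pull⁺ σʳ I (subst (S._∈ I) (sym (move-inverse σʳ σˡ (λ _ → inverseʳ σ) e)) e∈I))))

      ∣pull∣ : ∀ J → fromℕᵣ ∣ J ∣ ≤ fromℕᵣ ∣ pull σʳ J ∣
      ∣pull∣ J = subst₂ _≤_ (sym (∣∣≡card J)) (sym (∣∣≡card (pull σʳ J)))
        (∑-reindex (move σˡ) (λ e → 0≤⟦ e ∈? pull σʳ J ⟧)
          (λ {d} {e} eq → trans (sym (move-inverse σʳ σˡ (λ _ → inverseʳ σ) d)) (trans (cong (move σʳ) eq) (move-inverse σʳ σˡ (λ _ → inverseʳ σ) e)))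
          (Unique.allFin⁺ (n ℕ.* k)) (λ _ → ∈-allFin _)
          (λ e → ⟦⟧-mono (e ∈? J) (move σˡ e ∈? pull σʳ J)
            (λ e∈J → ∈-pull⁺ σʳ J (subst (S._∈ J) (sym (move-inverse σʳ σˡ (λ _ → inverseʳ σ) e)) e∈J))))

      permute-injective : ∀ {x y : Vec (Fin k) n} → permute σ x ≡ permute σ y → x ≡ y
      permute-injective {x} {y} eq = trans (sym (restore x)) (trans (cong (λ z → tabulate (λ i → lookup z (σˡ i))) eq) (restore y))
        where
        restore : ∀ x → tabulate (λ i → lookup (permute σ x) (σˡ i)) ≡ x
        restore x = trans (tabulate-cong (λ i → trans (lookup∘tabulate _ (σˡ i)) (cong (lookup x) (inverseʳ σ)))) (tabulate∘lookup x)

      pull⊆graph : ∀ J x → J ⊆ graph x → pull σʳ J ⊆ graph (permute σ x)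
      pull⊆graph J x J⊆ {e} e∈ with position e
      ... | i , a , refl = ∈-graph⁺ (permute σ x) i (trans (lookup∘tabulate _ i) (∈-graph⁻ x (σʳ i)
        (J⊆ (subst (S._∈ J) (move-combine σʳ i a) (∈-pull⁻ σʳ J e∈)))))

  graph-∩ : ∀ {k n} (x y : Vec (Fin k) n) i → lookup x i ≡ lookup y i → Fin.combine i (lookup x i) S.∈ graph x × Fin.combine i (lookup x i) S.∈ graph y
  graph-∩ x y i eq = ∈-graph⁺ x i refl , ∈-graph⁺ y i (sym eq)

  4ℚ : ℚ
  4ℚ = fromℕᵣ 4

  count : ∀ {k n} → Family k n → Subset (n ℕ.* k) → ℚ
  count A J = ∑ A (λ x → ⟦ J ⊆? graph x ⟧)

  module _ {k n : ℕ} {A : Family k n} (unique : Unique A) where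

    open Action k n

    0≤count : ∀ J → 0ℚ ≤ count A J
    0≤count J = 0≤∑ A (λ x → 0≤⟦ J ⊆? graph x ⟧)

    count-bound : ∀ J → fromℕᵣ k ^ ∣ J ∣ * count A J ≤ fromℕᵣ k ^ n
    count-bound J = ≤-trans (*-monoˡ-≤-nonNeg (fromℕᵣ k ^ ∣ J ∣) {{nonNegative (0≤^ ∣ J ∣ (0≤fromℕᵣ k))}}
      (∑-⊆ (λ x → 0≤⟦ J ⊆? graph x ⟧) unique (λ {x} _ → ∈-vectors x))) (graph-count k n J)

    count-⊥ : count A ⊥ ≡ size A
    count-⊥ = ∑-cong A (λ x → ⟦⟧-yes (⊥ ⊆? graph x) (⊆-min (graph x)))

    module Weight {R : ℚ} (1≤R : 1ℚ ≤ R) where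

      0≤R : 0ℚ ≤ R
      0≤R = ≤-trans 0≤1ℚ 1≤R

      weight : Subset (n ℕ.* k) → ℚ
      weight J = R ^ ∣ J ∣ * count A J

      J₀ : Subset (n ℕ.* k)
      J₀ = argmax weight ⊥ (subsets (n ℕ.* k))

      -- Comparison with the single set `J₀` keeps maximality decidable, so the maximisers can be
      -- listed.
      Maximal : Subset (n ℕ.* k) → Set
      Maximal J = weight J₀ ≤ weight J

      opaque
        weight≤ : ∀ {J} → Maximal J → ∀ I → weight I ≤ weight J
        weight≤ max I = ≤-trans (All.lookup (f[xs]≤f[argmax] {f = weight} ⊥ (subsets (n ℕ.* k))) (∈-subsets I)) max

        -- The weight of J ∪ S carries ∣ S ∣ more factors R than that of J but cannot exceed it.
        -- This is the source of spreadness.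
        maximal-extension : ∀ {J} → Maximal J → ∀ S → ¬ S.Nonempty (J ∩ S) → R ^ ∣ S ∣ * count A (J ∪ S) ≤ count A J
        maximal-extension {J} max S disj = *-cancelˡ-≤-pos (R ^ ∣ J ∣) {{positive (0<^ ∣ J ∣ (<-≤-trans 0<1ℚ 1≤R))}} (begin
          R ^ ∣ J ∣ * (R ^ ∣ S ∣ * count A (J ∪ S)) ≡⟨ sym (*-assoc (R ^ ∣ J ∣) (R ^ ∣ S ∣) (count A (J ∪ S))) ⟩
          R ^ ∣ J ∣ * R ^ ∣ S ∣ * count A (J ∪ S)   ≡⟨ cong (_* count A (J ∪ S)) (sym (^-homo-* R ∣ J ∣ ∣ S ∣)) ⟩
          R ^ (∣ J ∣ ℕ.+ ∣ S ∣) * count A (J ∪ S)   ≤⟨ *-monoʳ-≤-nonNeg (count A (J ∪ S)) {{nonNegative (0≤count (J ∪ S))}}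
                                                        (^-monoʳ 1≤R (∣p∣+∣q∣≤∣p∪q∣ J S disj)) ⟩
          weight (J ∪ S)                            ≤⟨ weight≤ {J} max (J ∪ S) ⟩
          weight J                                  ∎)
          where open ≤-Reasoning

        size≤weight : ∀ {J} → Maximal J → size A ≤ weight J
        size≤weight {J} max = subst (_≤ weight J)
          (trans (cong (λ m → R ^ m * count A ⊥) (∣⊥∣≡0 (n ℕ.* k))) (trans (*-identityˡ (count A ⊥)) count-⊥)) (weight≤ {J} max ⊥)

      module Symmetric (symmetric : TransitiveSymmetric A) where

        maximals : List (Subset (n ℕ.* k))
        maximals = filter (λ J → weight J₀ ≤? weight J) (subsets (n ℕ.* k))

        degree : Fin (n ℕ.* k) → ℚ
        degree e = ∑ maximals (λ J → ⟦ e ∈? J ⟧)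

        unique-maximals : Unique maximals
        unique-maximals = Unique.filter⁺ (λ J → weight J₀ ≤? weight J) (unique-subsets (n ℕ.* k))

        ∈-maximals : ∀ {J} → Maximal J → J ∈ maximals
        ∈-maximals {J} max = ∈-filter⁺ (λ J → weight J₀ ≤? weight J) (∈-subsets J) max

        maximals-∈ : ∀ {J} → J ∈ maximals → Maximal J
        maximals-∈ J∈ = proj₂ (∈-filter⁻ (λ J → weight J₀ ≤? weight J) {xs = subsets (n ℕ.* k)} J∈)

        module _ {σ : Permutation′ n} (preserves : ∀ {x} → x ∈ A → permute σ x ∈ A) where

          count-pull : ∀ J → count A J ≤ count A (pull (σ ⟨$⟩ʳ_) J)
          count-pull J = ∑-reindex (permute σ) (λ x → 0≤⟦ pull (σ ⟨$⟩ʳ_) J ⊆? graph x ⟧) (permute-injective σ) unique preserves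
            (λ x → ⟦⟧-mono (J ⊆? graph x) (pull (σ ⟨$⟩ʳ_) J ⊆? graph (permute σ x)) (pull⊆graph σ J x))

          -- Neither the size of J nor the count of members through it drops under `pull`, and with
          -- 1 ≤ R the weight cannot drop either.
          pull-maximal : ∀ J → Maximal J → Maximal (pull (σ ⟨$⟩ʳ_) J)
          pull-maximal J max = ≤-trans max (*-mono-≤-0≤ (0≤count J) (0≤^ ∣ pull (σ ⟨$⟩ʳ_) J ∣ 0≤R)
            (^-monoʳ 1≤R (fromℕᵣ-cancel-≤ {∣ J ∣} {∣ pull (σ ⟨$⟩ʳ_) J ∣} (∣pull∣ σ J))) (count-pull J))

          degree-move : ∀ e → degree (move (σ ⟨$⟩ʳ_) e) ≤ degree e
          degree-move e = ∑-reindex (pull (σ ⟨$⟩ʳ_)) (λ J → 0≤⟦ e ∈? J ⟧) (pull-injective σ) unique-maximals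
            (λ {J} J∈ → ∈-maximals {pull (σ ⟨$⟩ʳ_) J} (pull-maximal J (maximals-∈ {J} J∈)))
            (λ J → ⟦⟧-mono (move (σ ⟨$⟩ʳ_) e ∈? J) (e ∈? pull (σ ⟨$⟩ʳ_) J) (∈-pull⁺ (σ ⟨$⟩ʳ_) J))

        -- The permutations move positions and fix symbols, so by transitivity the degree depends on
        -- the symbol alone.
        degree-const : ∀ i j a → degree (Fin.combine j a) ≤ degree (Fin.combine i a)
        degree-const i j a = let σ , σi≡j , preserves = symmetric i j in
          subst (λ e → degree e ≤ degree (Fin.combine i a))
            (trans (move-combine (σ ⟨$⟩ʳ_) i a) (cong (λ j → Fin.combine j a) σi≡j))
            (degree-move {σ} (λ {x} → Equivalence.to (preserves x)) (Fin.combine i a))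

        module _ {G : ℚ} (small : ∀ {J} → Maximal J → card J ≤ G) where

          -- The n points with symbol a have equal degrees, which sum to at most the total size of
          -- all maximisers.
          n*degree≤-combine : ∀ i a → size (allFin n) * degree (Fin.combine i a) ≤ G * size maximals
          n*degree≤-combine i a = begin
            size (allFin n) * d
              ≡⟨ trans (*-comm (size (allFin n)) d) (sym (∑-*ˡ d (allFin n) (λ _ → 1ℚ))) ⟩
            ∑ (allFin n) (λ _ → d * 1ℚ)
              ≤⟨ ∑-mono (allFin n) (λ {j} _ → ≤-trans (≤-reflexive (*-identityʳ d)) (degree-const j i a)) ⟩
            ∑ (allFin n) (λ j → degree (Fin.combine j a))
              ≡⟨ ∑-swap (allFin n) maximals (λ j J → ⟦ Fin.combine j a ∈? J ⟧) ⟩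
            ∑ maximals (λ J → ∑ (allFin n) (λ j → ⟦ Fin.combine j a ∈? J ⟧))
              ≤⟨ ∑-mono maximals (λ {J} J∈ → ≤-trans (≤-trans (row≤card a J) (small {J} (maximals-∈ {J} J∈)))
                   (≤-reflexive (sym (*-identityʳ G)))) ⟩
            ∑ maximals (λ _ → G * 1ℚ)
              ≡⟨ ∑-*ˡ G maximals (λ _ → 1ℚ) ⟩
            G * size maximals ∎
            where
            open ≤-Reasoning
            d : ℚ
            d = degree (Fin.combine i a)

          n*degree≤ : ∀ e → size (allFin n) * degree e ≤ G * size maximals
          n*degree≤ e = let i , a , e≡ = position e in
            subst (λ e → size (allFin n) * degree e ≤ G * size maximals) (sym e≡) (n*degree≤-combine i a)
          -- If every maximiser hits `J₀`, the degrees on `J₀` sum to at least the number of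
          -- maximisers. Each is at most G / n of that number, and `J₀` has at most G points.
          maximals-meet : (∀ {J} → Maximal J → S.Nonempty (J₀ ∩ J)) → size (allFin n) ≤ G * G
          maximals-meet meet = *-cancelʳ-≤-pos (size maximals) {{positive 0<size}} (begin
            N * size maximals
              ≤⟨ *-monoˡ-≤-nonNeg N {{nonNegative (0≤∑ (allFin n) (λ _ → 0≤1ℚ))}} (∑-mono maximals (λ {J} J∈ → common J (meet {J} (maximals-∈ {J} J∈)))) ⟩
            N * ∑ maximals (λ J → ∑ es (λ e → ⟦ e ∈? J₀ ⟧ * ⟦ e ∈? J ⟧))
              ≡⟨ cong (N *_) (trans (∑-swap maximals es (λ J e → ⟦ e ∈? J₀ ⟧ * ⟦ e ∈? J ⟧))
                   (∑-cong es (λ e → ∑-*ˡ ⟦ e ∈? J₀ ⟧ maximals (λ J → ⟦ e ∈? J ⟧)))) ⟩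
            N * ∑ es (λ e → ⟦ e ∈? J₀ ⟧ * degree e)
              ≡⟨ sym (∑-*ˡ N es (λ e → ⟦ e ∈? J₀ ⟧ * degree e)) ⟩
            ∑ es (λ e → N * (⟦ e ∈? J₀ ⟧ * degree e))
              ≤⟨ ∑-mono es (λ {e} _ → term e) ⟩
            ∑ es (λ e → G * size maximals * ⟦ e ∈? J₀ ⟧)
              ≡⟨ ∑-*ˡ (G * size maximals) es (λ e → ⟦ e ∈? J₀ ⟧) ⟩
            G * size maximals * card J₀
              ≤⟨ *-monoˡ-≤-nonNeg (G * size maximals) {{nonNegative (0≤* 0≤G (<⇒≤ 0<size))}} (small {J₀} ≤-refl) ⟩
            G * size maximals * G
              ≡⟨ solve 2 (λ G s → G :* s :* G := G :* G :* s) refl G (size maximals) ⟩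
            G * G * size maximals ∎)
            where
            open ≤-Reasoning
            N : ℚ
            N = size (allFin n)
            es : List (Fin (n ℕ.* k))
            es = allFin (n ℕ.* k)
            0≤G : 0ℚ ≤ G
            0≤G = ≤-trans (0≤∑ es (λ e → 0≤⟦ e ∈? J₀ ⟧)) (small {J₀} ≤-refl)
            0<size : 0ℚ < size maximals
            0<size = <-≤-trans 0<1ℚ (term≤∑ {xs = maximals} {f = λ _ → 1ℚ} (λ _ → 0≤1ℚ) {J₀} (∈-maximals {J₀} ≤-refl))
            common : ∀ J → S.Nonempty (J₀ ∩ J) → 1ℚ ≤ ∑ es (λ e → ⟦ e ∈? J₀ ⟧ * ⟦ e ∈? J ⟧)
            common J (e , e∈) = let e∈J₀ , e∈J = x∈p∩q⁻ J₀ J e∈ in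
              ≤-trans (≤-reflexive (sym (cong₂ _*_ (⟦⟧-yes (e ∈? J₀) e∈J₀) (⟦⟧-yes (e ∈? J) e∈J))))
                (term≤∑ (λ e → 0≤* 0≤⟦ e ∈? J₀ ⟧ 0≤⟦ e ∈? J ⟧) (∈-allFin e))
            term : ∀ e → N * (⟦ e ∈? J₀ ⟧ * degree e) ≤ G * size maximals * ⟦ e ∈? J₀ ⟧
            term e = ≤-trans (≤-reflexive (solve 3 (λ N d x → N :* (x :* d) := N :* d :* x) refl N (degree e) ⟦ e ∈? J₀ ⟧))
              (*-monoʳ-≤-nonNeg ⟦ e ∈? J₀ ⟧ {{nonNegative 0≤⟦ e ∈? J₀ ⟧}} (n*degree≤ e))

      -- Members through one maximiser and off another

      module Link {J J′ : Subset (n ℕ.* k)} (max : Maximal J) (disj : ¬ S.Nonempty (J ∩ J′)) where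

        Linked : Vec (Fin k) n → Set
        Linked x = J ⊆ graph x × ¬ S.Nonempty (graph x ∩ J′)

        linked? : ∀ x → Dec (Linked x)
        linked? x = (J ⊆? graph x) ×-dec ¬? (nonempty? (graph x ∩ J′))

        link : List (Subset (n ℕ.* k))
        link = map (λ x → graph x ─ J) (filter linked? A)

        link-∈ : ∀ {φ} → φ ∈ link → ∃[ x ] x ∈ A × Linked x × φ ≡ graph x ─ J
        link-∈ φ∈ = let x , x∈ , φ≡ = ∈-map⁻ (λ x → graph x ─ J) φ∈
                        x∈A , linked = ∈-filter⁻ linked? {xs = A} x∈
                    in x , x∈A , linked , φ≡

        ∑-link : ∀ f → ∑ link f ≡ ∑ A (λ x → ⟦ linked? x ⟧ * f (graph x ─ J))
        ∑-link f = trans (∑-map (λ x → graph x ─ J) (filter linked? A) f) (∑-filter linked? A (λ x → f (graph x ─ J)))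

        opaque
          -- M counts all members through J, also those that meet J′ and are left out of `link`.
          -- Their loss is accounted for in `link-large`.
          link-spread : Spread R (count A J) link
          link-spread S with nonempty? (J ∩ S)
          ... | yes (e , e∈) = ≤-trans (≤-reflexive (trans (cong (R ^ ∣ S ∣ *_) (trans (∑-link (λ φ → ⟦ S ⊆? φ ⟧))
              (trans (∑-cong A (λ x → trans (cong (⟦ linked? x ⟧ *_) (⟦⟧-no (S ⊆? graph x ─ J) (outside-J x))) (*-zeroʳ ⟦ linked? x ⟧)))
                (∑-zero A)))) (*-zeroʳ (R ^ ∣ S ∣)))) (0≤count J)
            where
            outside-J : ∀ (x : Vec (Fin k) n) → ¬ (S ⊆ graph x ─ J)
            outside-J x S⊆ = let e∈J , e∈S = x∈p∩q⁻ J S e∈ in x∈p─q⇒x∉q (graph x) J (S⊆ e∈S) e∈J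
          ... | no empty = ≤-trans (*-monoˡ-≤-nonNeg (R ^ ∣ S ∣) {{nonNegative (0≤^ ∣ S ∣ 0≤R)}}
              (≤-trans (≤-reflexive (∑-link (λ φ → ⟦ S ⊆? φ ⟧))) (∑-mono A (λ {x} _ → extend x (linked? x)))))
              (maximal-extension max S empty)
            where
            extend : ∀ x (L? : Dec (Linked x)) → ⟦ L? ⟧ * ⟦ S ⊆? graph x ─ J ⟧ ≤ ⟦ J ∪ S ⊆? graph x ⟧
            extend x (no _)       = ≤-trans (≤-reflexive (*-zeroˡ ⟦ S ⊆? graph x ─ J ⟧)) 0≤⟦ J ∪ S ⊆? graph x ⟧
            extend x (yes linked) = ≤-trans (≤-reflexive (*-identityˡ ⟦ S ⊆? graph x ─ J ⟧))
              (⟦⟧-mono (S ⊆? graph x ─ J) (J ∪ S ⊆? graph x) (λ S⊆ → ∪-least (proj₁ linked) (⊆-trans S⊆ (p─q⊆p (graph x) J))))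
              where
              ∪-least : ∀ {p} → J ⊆ p → S ⊆ p → J ∪ S ⊆ p
              ∪-least J⊆ S⊆ e∈ with x∈p∪q⁻ J S e∈
              ... | inj₁ e∈J = J⊆ e∈J
              ... | inj₂ e∈S = S⊆ e∈S

          -- A lost member contains some e in J′, which is not in J. By maximality at most a
          -- fraction 1 / R of the members through J contain e; the union bound over J′ does the
          -- rest.
          link-large : R * (count A J - size link) ≤ card J′ * count A J
          link-large = begin
            R * (count A J - size link)
              ≤⟨ *-monoˡ-≤-nonNeg R {{nonNegative 0≤R}} lost ⟩
            R * ∑ es (λ e → ⟦ e ∈? J′ ⟧ * count A (J ∪ ⁅ e ⁆))
              ≡⟨ sym (∑-*ˡ R es (λ e → ⟦ e ∈? J′ ⟧ * count A (J ∪ ⁅ e ⁆))) ⟩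
            ∑ es (λ e → R * (⟦ e ∈? J′ ⟧ * count A (J ∪ ⁅ e ⁆)))
              ≤⟨ ∑-mono es (λ {e} _ → term e (e ∈? J′)) ⟩
            ∑ es (λ e → count A J * ⟦ e ∈? J′ ⟧)
              ≡⟨ trans (∑-*ˡ (count A J) es (λ e → ⟦ e ∈? J′ ⟧)) (*-comm (count A J) (card J′)) ⟩
            card J′ * count A J ∎
            where
            open ≤-Reasoning
            es : List (Fin (n ℕ.* k))
            es = allFin (n ℕ.* k)

            term : ∀ e (e∈? : Dec (e S.∈ J′)) → R * (⟦ e∈? ⟧ * count A (J ∪ ⁅ e ⁆)) ≤ count A J * ⟦ e∈? ⟧
            term e (no _)     = ≤-reflexive (solve 3 (λ R c m → R :* (con 0ℚ :* c) := m :* con 0ℚ) refl R (count A (J ∪ ⁅ e ⁆)) (count A J))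
            term e (yes e∈J′) = ≤-trans
              (≤-reflexive (trans (cong (R *_) (*-identityˡ (count A (J ∪ ⁅ e ⁆))))
                (cong (_* count A (J ∪ ⁅ e ⁆)) (trans (sym (*-identityʳ R)) (cong (R ^_) (sym (∣⁅x⁆∣≡1 e)))))))
              (≤-trans (maximal-extension max ⁅ e ⁆ (λ (d , d∈) → let d∈J , d∈e = x∈p∩q⁻ J ⁅ e ⁆ d∈ in
                  disj (d , x∈p∩q⁺ (d∈J , subst (S._∈ J′) (sym (x∈⁅y⁆⇒x≡y e d∈e)) e∈J′))))
                (≤-reflexive (sym (*-identityʳ (count A J)))))

            pointwise : ∀ x → ⟦ J ⊆? graph x ⟧ ≤ ⟦ linked? x ⟧ * 1ℚ + ∑ es (λ e → ⟦ e ∈? J′ ⟧ * ⟦ J ∪ ⁅ e ⁆ ⊆? graph x ⟧)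
            pointwise x = ⟦⟧-≤ (J ⊆? graph x) (0≤+ (0≤* 0≤⟦ linked? x ⟧ 0≤1ℚ) (0≤∑ es nonneg)) (λ J⊆ → covered J⊆ (nonempty? (graph x ∩ J′)))
              where
              nonneg : ∀ e → 0ℚ ≤ ⟦ e ∈? J′ ⟧ * ⟦ J ∪ ⁅ e ⁆ ⊆? graph x ⟧
              nonneg e = 0≤* 0≤⟦ e ∈? J′ ⟧ 0≤⟦ J ∪ ⁅ e ⁆ ⊆? graph x ⟧
              covered : J ⊆ graph x → Dec (S.Nonempty (graph x ∩ J′)) → 1ℚ ≤ ⟦ linked? x ⟧ * 1ℚ + ∑ es (λ e → ⟦ e ∈? J′ ⟧ * ⟦ J ∪ ⁅ e ⁆ ⊆? graph x ⟧)
              covered J⊆ (no empty) = subst (_≤ ⟦ linked? x ⟧ * 1ℚ + ∑ es (λ e → ⟦ e ∈? J′ ⟧ * ⟦ J ∪ ⁅ e ⁆ ⊆? graph x ⟧)) (+-identityʳ 1ℚ)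
                      (+-mono-≤ (≤-reflexive (sym (trans (*-identityʳ ⟦ linked? x ⟧) (⟦⟧-yes (linked? x) (J⊆ , empty))))) (0≤∑ es nonneg))
              covered J⊆ (yes (e , e∈)) = let e∈x , e∈J′ = x∈p∩q⁻ (graph x) J′ e∈ in
                      subst (_≤ ⟦ linked? x ⟧ * 1ℚ + ∑ es (λ e → ⟦ e ∈? J′ ⟧ * ⟦ J ∪ ⁅ e ⁆ ⊆? graph x ⟧)) (+-identityˡ 1ℚ)
                        (+-mono-≤ (0≤* 0≤⟦ linked? x ⟧ 0≤1ℚ) (≤-trans
                          (≤-reflexive (sym (cong₂ _*_ (⟦⟧-yes (e ∈? J′) e∈J′) (⟦⟧-yes (J ∪ ⁅ e ⁆ ⊆? graph x) (with-e e e∈x)))))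
                          (term≤∑ nonneg (∈-allFin e))))
                where
                with-e : ∀ e → e S.∈ graph x → J ∪ ⁅ e ⁆ ⊆ graph x
                with-e e e∈x d∈ with x∈p∪q⁻ J ⁅ e ⁆ d∈
                ... | inj₁ d∈J = J⊆ d∈J
                ... | inj₂ d∈e = subst (S._∈ graph x) (sym (x∈⁅y⁆⇒x≡y e d∈e)) e∈x

            lost : count A J - size link ≤ ∑ es (λ e → ⟦ e ∈? J′ ⟧ * count A (J ∪ ⁅ e ⁆))
            lost = by-≤ (size link + T - count A J) (solve 3 (λ T m s → T :- (m :- s) := s :+ T :- m) refl T (count A J) (size link))
              (p≤q⇒0≤q-p (begin
                count A J
                  ≤⟨ ∑-mono A (λ {x} _ → pointwise x) ⟩
                ∑ A (λ x → ⟦ linked? x ⟧ * 1ℚ + ∑ es (λ e → ⟦ e ∈? J′ ⟧ * ⟦ J ∪ ⁅ e ⁆ ⊆? graph x ⟧))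
                  ≡⟨ ∑-+ A (λ x → ⟦ linked? x ⟧ * 1ℚ) _ ⟩
                ∑ A (λ x → ⟦ linked? x ⟧ * 1ℚ) + ∑ A (λ x → ∑ es (λ e → ⟦ e ∈? J′ ⟧ * ⟦ J ∪ ⁅ e ⁆ ⊆? graph x ⟧))
                  ≡⟨ cong₂ _+_ (sym (∑-link (λ _ → 1ℚ)))
                       (trans (∑-swap A es (λ x e → ⟦ e ∈? J′ ⟧ * ⟦ J ∪ ⁅ e ⁆ ⊆? graph x ⟧))
                         (∑-cong es (λ e → ∑-*ˡ ⟦ e ∈? J′ ⟧ A (λ x → ⟦ J ∪ ⁅ e ⁆ ⊆? graph x ⟧)))) ⟩
                size link + T ∎))
              where
              T : ℚ
              T = ∑ es (λ e → ⟦ e ∈? J′ ⟧ * count A (J ∪ ⁅ e ⁆))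

  -- Disjoint maximisers have disjoint extensions in A

  ^-cancel-≤ : ∀ {p} → 1ℚ < p → ∀ {m n} → p ^ m ≤ p ^ n → m ℕ.≤ n
  ^-cancel-≤ {p} 1<p {m} {n} p^m≤p^n = ℕ.≮⇒≥ λ n<m → <-irrefl refl (<-≤-trans
    (subst (_< p ^ suc n) (*-identityˡ (p ^ n)) (*-monoˡ-<-pos (p ^ n) {{positive (0<^ n (<-trans 0<1ℚ 1<p))}} 1<p))
    (≤-trans (^-monoʳ (<⇒≤ 1<p) n<m) p^m≤p^n))

  -- Since k = 4 R, the upper bound k^(n - ∣J∣) for the count falls short of ∣A∣ R^(-∣J∣) as soon as
  -- 4^∣J∣ exceeds 4^g.
  maximal-small : ∀ {k n g} {A : Family k n} (unique : Unique A) {R} (1≤R : 1ℚ ≤ R) → fromℕᵣ k ≡ 4ℚ * R →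
    0ℚ < size A → fromℕᵣ k ^ n ≤ size A * 4ℚ ^ g → ∀ {J} → Weight.Maximal unique 1≤R J → ∣ J ∣ ℕ.≤ g
  maximal-small {k} {n} {g} {A} unique {R} 1≤R k≡4R 0<A dense {J} max =
    ^-cancel-≤ {4ℚ} (toWitness {a? = 1ℚ <? 4ℚ} _) (*-cancelˡ-≤-pos (size A) {{positive 0<A}} (begin
      size A * 4ℚ ^ ∣ J ∣
        ≤⟨ *-monoʳ-≤-nonNeg (4ℚ ^ ∣ J ∣) {{nonNegative (0≤^ ∣ J ∣ (0≤fromℕᵣ 4))}} (size≤weight {J} max) ⟩
      R ^ ∣ J ∣ * count A J * 4ℚ ^ ∣ J ∣
        ≡⟨ trans (solve 3 (λ a b c → a :* b :* c := c :* a :* b) refl (R ^ ∣ J ∣) (count A J) (4ℚ ^ ∣ J ∣))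
             (cong (_* count A J) (trans (sym (^-distrib-* 4ℚ R ∣ J ∣)) (cong (_^ ∣ J ∣) (sym k≡4R)))) ⟩
      fromℕᵣ k ^ ∣ J ∣ * count A J
        ≤⟨ count-bound unique J ⟩
      fromℕᵣ k ^ n
        ≤⟨ dense ⟩
      size A * 4ℚ ^ g ∎))
    where
    open ≤-Reasoning
    open Weight unique 1≤R

  module _ {k n : ℕ} {A : Family k n} (unique : Unique A) {R : ℚ} (1≤R : 1ℚ ≤ R) where
    open Weight unique 1≤R

    module _ {G : ℚ} (4G≤R : 4ℚ * G ≤ R) (0<A : 0ℚ < size A) {T : ℕ} (n<2^T : n ℕ.< 2 ℕ.^ suc T)
             (128T≤R : fromℕᵣ 128 * fromℕᵣ (suc T) ≤ R) where

      link-contained : ∀ {J J′} (max : Maximal J) (disj : ¬ S.Nonempty (J ∩ J′)) → card J′ ≤ G →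
                       𝔼 ½ (missing (Link.link {J} {J′} max disj)) < ½
      link-contained {J} {J′} max disj small = spread⇒contained {n ℕ.* k} {suc T} {p} {R} {count A J} {link}
        (0≤* (<⇒≤ 0<½) (0≤unit-fraction T)) Tp≡½ p≤1 (≤-trans 0≤1ℚ 1≤R) 64≤pR 0<count
        (λ {φ} φ∈ → let x , _ , _ , φ≡ = link-∈ φ∈ in
          ℕ.≤-<-trans (subst (ℕ._≤ n) (cong ∣_∣ (sym φ≡)) (subst (∣ graph x ─ J ∣ ℕ.≤_) (∣graph∣ x) (∣p─q∣≤∣p∣ (graph x) J))) n<2^T)
        link-spread few-lost
        where
        open Link {J} {J′} max disj
        0<R : 0ℚ < R
        0<R = <-≤-trans 0<1ℚ 1≤R
        -- T + 1 rounds of this density add up to ½, and 128 (T + 1) ≤ R then gives p R ≥ 64.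
        p : ℚ
        p = ½ * (ℤ.1ℤ / suc T)
        scaled : ∀ t u → t * u ≡ 1ℚ → t * (½ * u) ≡ ½
        scaled t u tu≡1 = trans (solve 2 (λ t u → t :* (con ½ :* u) := con ½ :* (t :* u)) refl t u) (cong (½ *_) tu≡1)
        Tp≡½ : fromℕᵣ (suc T) * p ≡ ½
        Tp≡½ = scaled (fromℕᵣ (suc T)) (ℤ.1ℤ / suc T) (unit-fraction T)
        p≤1 : p ≤ 1ℚ
        p≤1 = *-mono-≤-0≤ {½} {1ℚ} {ℤ.1ℤ / suc T} {1ℚ} (0≤unit-fraction T) 0≤1ℚ (toWitness {a? = ½ ≤? 1ℚ} _) (unit-fraction≤1 T)
        halves : ∀ t u → t * u ≡ 1ℚ → 0ℚ ≤ u → fromℕᵣ 128 * t ≤ R → fromℕᵣ 64 ≤ ½ * u * R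
        halves t u tu≡1 0≤u le = subst (_≤ ½ * u * R)
          (trans (solve 2 (λ t u → con ½ :* u :* (con (fromℕᵣ 128) :* t) := con (fromℕᵣ 64) :* (t :* u)) refl t u)
            (trans (cong (fromℕᵣ 64 *_) tu≡1) (*-identityʳ (fromℕᵣ 64))))
          (*-monoˡ-≤-nonNeg (½ * u) {{nonNegative (0≤* (<⇒≤ 0<½) 0≤u)}} le)
        64≤pR : fromℕᵣ 64 ≤ p * R
        64≤pR = halves (fromℕᵣ (suc T)) (ℤ.1ℤ / suc T) (unit-fraction T) (0≤unit-fraction T) 128T≤R
        0<count : 0ℚ < count A J
        0<count = 0<pq⇒0<p {count A J} {R ^ ∣ J ∣} (subst (0ℚ <_) (*-comm (R ^ ∣ J ∣) (count A J)) (<-≤-trans 0<A (size≤weight {J} max)))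
          (0≤^ ∣ J ∣ (<⇒≤ 0<R))
        few-lost : count A J - size link ≤ count A J * ¼
        few-lost = *-cancelˡ-≤-pos R {{positive 0<R}} (≤-trans link-large (≤-trans
          (*-monoʳ-≤-nonNeg (count A J) {{nonNegative (<⇒≤ 0<count)}} small)
          (by-≤ (¼ * count A J * (R - 4ℚ * G))
            (solve 3 (λ R M G → R :* (M :* con ¼) :- G :* M := con ¼ :* M :* (R :- con 4ℚ :* G)) refl R (count A J) G)
            (0≤* (0≤* (toWitness {a? = 0ℚ ≤? ¼} _) (<⇒≤ 0<count)) (p≤q⇒0≤q-p 4G≤R)))))

      maximals-intersect : VectorIntersecting A → (∀ {J} → Maximal J → card J ≤ G) →
                           ∀ {J J′} → Maximal J → Maximal J′ → S.Nonempty (J ∩ J′)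
      maximals-intersect intersecting small {J} {J′} max max′ = decidable-stable (nonempty? (J ∩ J′)) λ disj →
        let disj′ = λ nonempty → disj (subst S.Nonempty (∩-comm J′ J) nonempty)
        in disjoint-members {n ℕ.* k} {Link.link {J} {J′} max disj} {Link.link {J′} {J} max′ disj′}
             (link-contained {J} {J′} max disj (small {J′} max′)) (link-contained {J′} {J} max′ disj′ (small {J} max))
             (λ φ∈ ψ∈ → meet (Link.link-∈ {J} {J′} max disj φ∈) (Link.link-∈ {J′} {J} max′ disj′ ψ∈))
        where
        meet : ∀ {φ ψ} → ∃[ x ] (x ∈ A × (J ⊆ graph x × ¬ S.Nonempty (graph x ∩ J′)) × φ ≡ graph x ─ J) →
               ∃[ y ] (y ∈ A × (J′ ⊆ graph y × ¬ S.Nonempty (graph y ∩ J)) × ψ ≡ graph y ─ J′) → S.Nonempty (φ ∩ ψ)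
        -- The common point of x and y survives the removal of J and J′: y avoids J and x avoids J′.
        meet (x , x∈A , (_ , x∩J′) , refl) (y , y∈A , (_ , y∩J) , refl) =
          let i , xi≡yi = intersecting x y x∈A y∈A
              e∈x , e∈y = graph-∩ x y i xi≡yi
          in _ , x∈p∩q⁺ (x∈p∧x∉q⇒x∈p─q e∈x (λ e∈J → y∩J (_ , x∈p∩q⁺ (e∈y , e∈J))) ,
                         x∈p∧x∉q⇒x∈p─q e∈y (λ e∈J′ → x∩J′ (_ , x∈p∩q⁺ (e∈x , e∈J′))))

  -- The spread lemma makes any two maximisers intersect, and double counting then gives n ≤ g².
  dense-impossible : ∀ {k n g T} {A : Family k n} → Unique A → TransitiveSymmetric A → VectorIntersecting A →
    ∀ {R} → fromℕᵣ k ≡ 4ℚ * R → 0ℚ < size A → fromℕᵣ k ^ n ≤ size A * 4ℚ ^ g →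
    fromℕᵣ g * fromℕᵣ g < fromℕᵣ n → 4ℚ * fromℕᵣ g ≤ R → 1ℚ ≤ R → fromℕᵣ 128 * fromℕᵣ (suc T) ≤ R → n ℕ.< 2 ℕ.^ suc T → Empty.⊥
  dense-impossible {k} {n} {g} {T} {A} unique symmetric intersecting {R} k≡4R 0<A dense g²<n 4g≤R 1≤R 128T≤R n<2^T =
    <-irrefl refl (<-≤-trans g²<n (subst (_≤ fromℕᵣ g * fromℕᵣ g) (size-allFin n)
      (Symmetric.maximals-meet symmetric {fromℕᵣ g} (λ {J} → small {J}) (λ {J} max →
        maximals-intersect unique 1≤R {fromℕᵣ g} 4g≤R 0<A {T} n<2^T 128T≤R intersecting (λ {J} → small {J}) {J₀} {J} ≤-refl max))))
    where
    open Weight unique 1≤R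
    small : ∀ {J} → Maximal J → card J ≤ fromℕᵣ g
    small {J} max = subst (_≤ fromℕᵣ g) (∣∣≡card J)
      (fromℕᵣ-mono (maximal-small {g = g} unique 1≤R k≡4R 0<A dense {J} max))

  -- Approximations of exp, log and √

  open ℝ

  fromℕᵣ-+ : ∀ m n → fromℕᵣ (m ℕ.+ n) ≡ fromℕᵣ m + fromℕᵣ n
  fromℕᵣ-+ zero    n = sym (+-identityˡ (fromℕᵣ n))
  fromℕᵣ-+ (suc m) n = trans (fromℕᵣ-suc (m ℕ.+ n)) (trans (cong (1ℚ +_) (fromℕᵣ-+ m n))
    (trans (sym (+-assoc 1ℚ (fromℕᵣ m) (fromℕᵣ n))) (cong (_+ fromℕᵣ n) (sym (fromℕᵣ-suc m)))))

  fromℕᵣ-* : ∀ m n → fromℕᵣ (m ℕ.* n) ≡ fromℕᵣ m * fromℕᵣ n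
  fromℕᵣ-* zero    n = sym (*-zeroˡ (fromℕᵣ n))
  fromℕᵣ-* (suc m) n = trans (fromℕᵣ-+ n (m ℕ.* n)) (trans (cong (fromℕᵣ n +_) (fromℕᵣ-* m n))
    (trans (distrib (fromℕᵣ m) (fromℕᵣ n)) (cong (_* fromℕᵣ n) (sym (fromℕᵣ-suc m)))))
    where
    distrib : ∀ x y → y + x * y ≡ (1ℚ + x) * y
    distrib = solve 2 (λ x y → y :+ x :* y := (con 1ℚ :+ x) :* y) refl

  fromℕᵣ-^ : ∀ m n → fromℕᵣ (m ℕ.^ n) ≡ fromℕᵣ m ^ n
  fromℕᵣ-^ m zero    = refl
  fromℕᵣ-^ m (suc n) = trans (fromℕᵣ-* m (m ℕ.^ n)) (cong (fromℕᵣ m *_) (fromℕᵣ-^ m n))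

  /-*-cancel : ∀ m d .{{_ : ℕ.NonZero d}} → (ℤ.+ m / d) * fromℕᵣ d ≡ fromℕᵣ m
  /-*-cancel m (suc d) = toℚᵘ-injective (begin
    toℚᵘ ((ℤ.+ m / suc d) * fromℕᵣ (suc d))            ≈⟨ toℚᵘ-homo-* (ℤ.+ m / suc d) (fromℕᵣ (suc d)) ⟩
    toℚᵘ (ℤ.+ m / suc d) ℚᵘ.* toℚᵘ (fromℕᵣ (suc d))   ≈⟨ ℚᵘ.*-cong (toℚᵘ-fromℚᵘ (ℚᵘ.mkℚᵘ (ℤ.+ m) d)) (toℚᵘ-fromℚᵘ (ℚᵘ.mkℚᵘ (ℤ.+ suc d) 0)) ⟩
    ℚᵘ.mkℚᵘ (ℤ.+ m) d ℚᵘ.* ℚᵘ.mkℚᵘ (ℤ.+ suc d) 0      ≈⟨ ℚᵘ.*≡* (trans (ℤ.*-identityʳ (ℤ.+ m ℤ.* ℤ.+ suc d)) (cong (λ e → ℤ.+ m ℤ.* ℤ.+ e) (sym (ℕ.*-identityʳ (suc d))))) ⟩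
    ℚᵘ.mkℚᵘ (ℤ.+ m) 0                                  ≈⟨ ℚᵘ.≃-sym (toℚᵘ-fromℚᵘ (ℚᵘ.mkℚᵘ (ℤ.+ m) 0)) ⟩
    toℚᵘ (fromℕᵣ m)                                    ∎)
    where open import Relation.Binary.Reasoning.Setoid ℚᵘ.≃-setoid

  natural-ceiling : ∀ {p} → 0ℚ < p → ∃[ g ] fromℕᵣ g < p × p ≤ fromℕᵣ (suc g)
  natural-ceiling {p} 0<p = let n , p≤n = archimedean p in descend n p≤n
    where
    descend : ∀ n → p ≤ fromℕᵣ (suc n) → ∃[ g ] fromℕᵣ g < p × p ≤ fromℕᵣ (suc g)
    descend zero    p≤1 = zero , 0<p , p≤1
    descend (suc n) p≤n with p ≤? fromℕᵣ (suc n)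
    ... | yes p≤n′ = descend n p≤n′
    ... | no p≰n′  = suc n , ≰⇒> p≰n′ , p≤n

  -- Compares with (1 - g / 2 g) ^ (2 g) = ¼ ^ g, a lower bound of exp (- g).
  exp-approx≤4^ : ∀ N g {r} → r ≤ fromℕᵣ (suc g) → 0ℚ ≤ 1+ r ÷suc N → (1+ r ÷suc N) ^ suc N ≤ 4ℚ ^ suc g
  exp-approx≤4^ N g {r} r≤g 0≤A = begin
    X                                                         ≡⟨ sym (*-identityʳ X) ⟩
    X * 1ℚ                                                    ≡⟨ cong (X *_) (sym (trans (sym (^-distrib-* ¼ 4ℚ (suc g))) (1^ (suc g)))) ⟩
    X * (¼ ^ suc g * 4ℚ ^ suc g)                              ≡⟨ sym (*-assoc X (¼ ^ suc g) (4ℚ ^ suc g)) ⟩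
    X * ¼ ^ suc g * 4ℚ ^ suc g                                ≡⟨ cong (λ z → X * z * 4ℚ ^ suc g) (sym quarter) ⟩
    X * (1+ (- fromℕᵣ (suc g)) ÷suc m) ^ suc m * 4ℚ ^ suc g  ≤⟨ *-monoʳ-≤-nonNeg (4ℚ ^ suc g) {{nonNegative (0≤^ (suc g) (0≤fromℕᵣ 4))}}
                                                                  (exp-bounds-product N m r≤g 0≤A (subst (0ℚ ≤_) (sym half-left) (<⇒≤ 0<½))) ⟩
    1ℚ * 4ℚ ^ suc g                                           ≡⟨ *-identityˡ (4ℚ ^ suc g) ⟩
    4ℚ ^ suc g                                                ∎
    where
    open ≤-Reasoning
    m : ℕ
    m = g ℕ.+ suc g
    X : ℚ
    X = (1+ r ÷suc N) ^ suc N
    halve : ∀ G u → (G + G) * u ≡ 1ℚ → 1ℚ + - G * u ≡ ½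
    halve G u eq = trans (solve 2 (λ G u → con 1ℚ :+ :- G :* u := con 1ℚ :- con ½ :* ((G :+ G) :* u)) refl G u) (cong (λ z → 1ℚ - ½ * z) eq)
    half-left : 1+ (- fromℕᵣ (suc g)) ÷suc m ≡ ½
    half-left = halve (fromℕᵣ (suc g)) (ℤ.1ℤ / suc m) (trans (cong (_* (ℤ.1ℤ / suc m)) (sym (fromℕᵣ-+ (suc g) (suc g)))) (unit-fraction m))
    quarter : (1+ (- fromℕᵣ (suc g)) ÷suc m) ^ suc m ≡ ¼ ^ suc g
    quarter = trans (cong (_^ suc m) half-left) (trans (^-homo-* ½ (suc g) (suc g)) (sym (^-distrib-* ½ ½ (suc g))))

  -- The one-factor approximation 1 - ½ of exp (- ½) bounds every lower approximation of exp ½ by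
  -- its inverse.
  exp-approx≤2 : ∀ N {r} → r ≤ ½ → 0ℚ ≤ 1+ r ÷suc N → (1+ r ÷suc N) ^ suc N ≤ 2ℚ
  exp-approx≤2 N {r} r≤½ 0≤A = begin
    X               ≡⟨ solve 1 (λ x → x := x :* con ½ :* (con 1ℚ :+ con 1ℚ)) refl X ⟩
    X * ½ * 2ℚ      ≤⟨ *-monoʳ-≤-nonNeg 2ℚ (exp-bounds-product N 0 {r} {½} r≤½ 0≤A (toWitness {a? = 0ℚ ≤? 1+ (- ½) ÷suc 0} _)) ⟩
    1ℚ * 2ℚ         ≡⟨⟩
    2ℚ              ∎
    where
    open ≤-Reasoning
    X : ℚ
    X = (1+ r ÷suc N) ^ suc N

  -- An upper bound of log n is certified by a lower approximation of exp that exceeds n. Both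
  -- estimates of β below start from this certificate.
  U-log : ∀ {n} (2≤n : 2 ℕ.≤ n) {β} → U (logℕ n 2≤n) β → ∃[ r ] ∃[ N ] r < β × 0ℚ ≤ 1+ r ÷suc N × fromℕᵣ n < (1+ r ÷suc N) ^ suc N
  U-log 2≤n (β′ , β′<β , u , (v , v<u , n≤v) , s , u<s , r , N , (r′ , r<r′ , r′≤β′) , 0≤A , s≤A) =
    r , N , <-trans (<-≤-trans r<r′ r′≤β′) β′<β , 0≤A , <-≤-trans (≤-<-trans n≤v (<-trans v<u u<s)) s≤A

  ½<log : ∀ {n} (2≤n : 2 ℕ.≤ n) {β} → U (logℕ n 2≤n) β → ½ < β
  ½<log {n} 2≤n β∈U = let r , N , r<β , 0≤A , n<A = U-log 2≤n β∈U in <-trans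
    (≰⇒> (λ r≤½ → <-irrefl refl (<-≤-trans n<A (≤-trans (exp-approx≤2 N r≤½ 0≤A) (fromℕᵣ-mono 2≤n))))) r<β

  log<⇒<4^ : ∀ {n} (2≤n : 2 ℕ.≤ n) {β} → U (logℕ n 2≤n) β → ∀ h → β ≤ fromℕᵣ (suc h) → fromℕᵣ n < 4ℚ ^ suc h
  log<⇒<4^ 2≤n β∈U h β≤h = let r , N , r<β , 0≤A , n<A = U-log 2≤n β∈U in
    <-≤-trans n<A (exp-approx≤4^ N h (≤-trans (<⇒≤ r<β) β≤h) 0≤A)

  -- An upper bound of exp (- t) is the inverse of a lower approximation of exp at some τ < t.
  -- Moving it across turns the violation into an inequality of rationals.
  exp-tail : ∀ {t α q} → U (fromℕ 128 *ᴿ exp (-ᴿ t)) q → q < α →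
             ∃[ τ ] ∃[ N ] L t τ × 0ℚ ≤ 1+ τ ÷suc N × fromℕᵣ 128 < α * (1+ τ ÷suc N) ^ suc N
  exp-tail {t} {α} {q} (r , r<q , B , _ , _ , _ , bd≤r) q<α = extract (Box.b∈U B) (Box.d∈U B)
    where
    b d : ℚ
    b = Box.b B
    d = Box.d B
    extract : U (fromℕ 128) b → U (exp (-ᴿ t)) d → ∃[ τ ] ∃[ N ] L t τ × 0ℚ ≤ 1+ τ ÷suc N × fromℕᵣ 128 < α * (1+ τ ÷suc N) ^ suc N
    extract (s , s<b , 128≤s) (e , e<d , ρ , N , (σ , σ<ρ , -σ∈L) , 0<B , 1≤eY) =
      - ρ , N , L-down t (neg-antimono-< σ<ρ) -σ∈L , <⇒≤ 0<B , bound ((1+ (- ρ) ÷suc N) ^ suc N) (0<^ (suc N) 0<B) 1≤eY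
      where
      bound : ∀ Y → 0ℚ < Y → 1ℚ ≤ e * Y → fromℕᵣ 128 < α * Y
      bound Y 0<Y 1≤eY = ≤-<-trans
        (≤-trans (*-monoˡ-≤-nonNeg (fromℕᵣ 128) 1≤eY)
          (≤-reflexive (sym (*-assoc (fromℕᵣ 128) e Y))))
        (*-monoˡ-<-pos Y {{positive 0<Y}} (≤-<-trans
          (≤-trans (*-mono-≤-0≤ {fromℕᵣ 128} {b} {e} {d} (<⇒≤ 0<e) (≤-trans (0≤fromℕᵣ 128) (<⇒≤ 128<b)) (<⇒≤ 128<b) (<⇒≤ e<d)) bd≤r)
          (<-trans r<q q<α)))
        where
        0<e : 0ℚ < e
        0<e = 0<pq⇒0<p {e} {Y} (<-≤-trans 0<1ℚ 1≤eY) (<⇒≤ 0<Y)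
        128<b : fromℕᵣ 128 < b
        128<b = ≤-<-trans 128≤s s<b

  L-√ : ∀ n {a} → 0ℚ < a → L (√ (fromℕ n)) a → a * a < fromℕᵣ n
  L-√ n 0<a (a′ , a<a′ , inj₁ a′≤0) = contradiction (<-trans 0<a (<-≤-trans a<a′ a′≤0)) (<-irrefl refl)
  L-√ n 0<a (a′ , a<a′ , inj₂ (v , a′²<v , v≤n)) = <-trans (p²<q² 0<a a<a′) (<-≤-trans a′²<v v≤n)

  -- The strict bound holds on the whole box, so any convenient point may be inserted, such as a
  -- corner or an exact rational value.
  record LowerBox (x y : ℝ) (q : ℚ) : Set where
    field
      box′ : Box x y
    open Box box′ public
    field
      q<st : ∀ {s t} → a ≤ s → s ≤ b → c ≤ t → t ≤ d → q < s * t
    a≤b : a ≤ b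
    a≤b = <⇒≤ (L<U x a∈L b∈U)
    c≤d : c ≤ d
    c≤d = <⇒≤ (L<U y c∈L d∈U)

  record UpperBox (x y : ℝ) (q : ℚ) : Set where
    field
      box′ : Box x y
    open Box box′ public
    field
      st<q : ∀ {s t} → a ≤ s → s ≤ b → c ≤ t → t ≤ d → s * t < q
    a≤b : a ≤ b
    a≤b = <⇒≤ (L<U x a∈L b∈U)
    c≤d : c ≤ d
    c≤d = <⇒≤ (L<U y c∈L d∈U)

  lowerBox : ∀ x y {q} → L (x *ᴿ y) q → LowerBox x y q
  lowerBox x y (r , q<r , B , ac , ad , bc , bd) = record
    { box′ = B ; q<st = λ a≤s s≤b c≤t t≤d → <-≤-trans q<r (box-≤ a≤s s≤b c≤t t≤d ac ad bc bd) }

  upperBox : ∀ x y {q} → U (x *ᴿ y) q → UpperBox x y q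
  upperBox x y (r , r<q , B , ac , ad , bc , bd) = record
    { box′ = B ; st<q = λ a≤s s≤b c≤t t≤d → ≤-<-trans (box-≥ a≤s s≤b c≤t t≤d ac ad bc bd) r<q }

  L-fromℚ : ∀ p {q} → L (fromℚ p) q → q < p
  L-fromℚ p (r , q<r , r≤p) = <-≤-trans q<r r≤p

  U-fromℚ : ∀ p {q} → U (fromℚ p) q → p < q
  U-fromℚ p (r , r<q , p≤r) = ≤-<-trans p≤r r<q

  -- H stands for 10⁴, and τ for a rational number below t in the bound 128 exp (- t).
  record Bounds (√n logn : ℝ) (H K τ : ℚ) : Set where
    field
      {β a} : ℚ
      β∈U   : U logn β
      a∈L   : L √n a
      τβ≤k  : H * τ * β ≤ K
      τ≤a   : H * τ ≤ 2ℚ * a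

  module _ {√n logn κ : ℝ} {h H K : ℚ} (0<h : 0ℚ < h) (0≤H : 0ℚ ≤ H) (Hh≡1 : H * h ≡ 1ℚ)
           (L-κ : ∀ {q} → L κ q → q < K) (U-κ : ∀ {q} → U κ q → K < q) (κ-L : ∀ {q} → q < K → L κ q)
           (0<log-upper : ∀ {β} → U logn β → 0ℚ < β) where

    module _ (0<K : 0ℚ < K) {0<log : 0ᴿ <ᴿ logn} where

      L-hk : ∀ {a} → L (fromℚ h *ᴿ κ) a → a < h * K
      L-hk a∈L = q<st {h} {K} (<⇒≤ (L-fromℚ h a∈L′)) (<⇒≤ (U-fromℚ h b∈U)) (<⇒≤ (L-κ c∈L)) (<⇒≤ (U-κ d∈U))
        where open LowerBox (lowerBox (fromℚ h) κ a∈L) renaming (a∈L to a∈L′)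

      U-hk : ∀ {b} → U (fromℚ h *ᴿ κ) b → h * K < b
      U-hk b∈U = st<q {h} {K} (<⇒≤ (L-fromℚ h a∈L)) (<⇒≤ (U-fromℚ h b∈U′)) (<⇒≤ (L-κ c∈L)) (<⇒≤ (U-κ d∈U))
        where open UpperBox (upperBox (fromℚ h) κ b∈U) renaming (b∈U to b∈U′)

      -- A positive lower bound c of 1 / log n comes with an upper bound β of log n such that c β ≤
      -- 1. Multiplying τ ≤ h K c by H β gives the claim.
      L-k/log : ∀ {τ} → 0ℚ < τ → L (fromℚ h *ᴿ κ ÷ᴿ logn [ 0<log ]) τ →
                ∃[ β ] U logn β × H * τ * β ≤ K
      L-k/log {τ} 0<τ τ∈L = finish c∈L
        where
        open LowerBox (lowerBox (fromℚ h *ᴿ κ) (recip logn 0<log) τ∈L)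
        0<b : 0ℚ < b
        0<b = <-trans (0<* 0<h 0<K) (U-hk b∈U)
        0<c : 0ℚ < c
        0<c = 0<pq⇒0<p {c} {b} (subst (0ℚ <_) (*-comm b c) (<-trans 0<τ (q<st {b} {c} a≤b ≤-refl ≤-refl c≤d))) (<⇒≤ 0<b)
        scaled : ∀ {β} → 0ℚ ≤ β → τ ≤ h * K * c → c * β ≤ 1ℚ → H * τ * β ≤ K
        scaled {β} 0≤β τ≤ cβ≤1 = begin
          H * τ * β              ≤⟨ *-monoʳ-≤-nonNeg β {{nonNegative 0≤β}} (*-monoˡ-≤-nonNeg H {{nonNegative 0≤H}} τ≤) ⟩
          H * (h * K * c) * β    ≡⟨ solve 5 (λ H h K c β → H :* (h :* K :* c) :* β := H :* h :* (K :* (c :* β))) refl H h K c β ⟩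
          H * h * (K * (c * β))  ≡⟨ trans (cong (_* (K * (c * β))) Hh≡1) (*-identityˡ (K * (c * β))) ⟩
          K * (c * β)            ≤⟨ *-monoˡ-≤-nonNeg K {{nonNegative (<⇒≤ 0<K)}} cβ≤1 ⟩
          K * 1ℚ                 ≡⟨ *-identityʳ K ⟩
          K                      ∎
          where open ≤-Reasoning
        finish : L (recip logn 0<log) c → ∃[ β ] U logn β × H * τ * β ≤ K
        finish (c′ , c<c′ , inj₁ c′≤0) = contradiction (<-trans 0<c (<-≤-trans c<c′ c′≤0)) (<-irrefl refl)
        finish (c′ , c<c′ , inj₂ (β , β∈U , c′β≤1)) = β , β∈U , scaled (<⇒≤ (0<log-upper β∈U))
          (≤-trans (<⇒≤ (q<st {a} {c} ≤-refl a≤b ≤-refl c≤d)) (*-monoʳ-≤-nonNeg c {{nonNegative (<⇒≤ 0<c)}} (<⇒≤ (L-hk a∈L))))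
          (≤-trans (*-monoʳ-≤-nonNeg β {{nonNegative (<⇒≤ (0<log-upper β∈U))}} (<⇒≤ c<c′)) c′β≤1)

      moderate : ∀ {τ} → 0ℚ < τ → κ ≤ᴿ √n *ᴿ logn → L (fromℚ h *ᴿ κ ÷ᴿ logn [ 0<log ]) τ → Bounds √n logn H K τ
      moderate {τ} 0<τ k≤ τ∈L = let β , β∈U , τβ≤k = L-k/log 0<τ τ∈L in record
        { β∈U = β∈U ; a∈L = a∈L ; τβ≤k = τβ≤k
        ; τ≤a = *-cancelʳ-≤-pos β {{positive (0<log-upper β∈U)}} (halves H K τ β a τβ≤k
            (≤-trans (<⇒≤ (q<st {a} {c} ≤-refl a≤b ≤-refl c≤d)) (*-monoˡ-≤-nonNeg a {{nonNegative (<⇒≤ 0<a)}} (<⇒≤ (L<U logn c∈L β∈U))))) }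
        where
        ½K<K : ½ * K < K
        ½K<K = by-< (½ * K) (solve 1 (λ K → K :- con ½ :* K := con ½ :* K) refl K) (0<* 0<½ 0<K)
        -- A lower cut contains only rationals strictly below K. The choice ½ K is paid for by the
        -- factor 2 in `Bounds`.
        open LowerBox (lowerBox √n logn (k≤ (½ * K) (κ-L ½K<K)))
        0<a : 0ℚ < a
        0<a = 0<pq⇒0<p {a} {d} (<-trans (0<* 0<½ 0<K) (q<st {a} {d} ≤-refl a≤b c≤d ≤-refl)) (<⇒≤ (0<log-upper d∈U))
        halves : ∀ H K τ β a → H * τ * β ≤ K → ½ * K ≤ a * β → H * τ * β ≤ 2ℚ * a * β
        halves H K τ β a τβ≤ K≤ = by-≤ (2ℚ * (a * β - ½ * K) + (K - H * τ * β))
          (solve 5 (λ H K τ β a → (con 1ℚ :+ con 1ℚ) :* a :* β :- H :* τ :* β :=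
            (con 1ℚ :+ con 1ℚ) :* (a :* β :- con ½ :* K) :+ (K :- H :* τ :* β)) refl H K τ β a)
          (0≤+ (0≤* (0≤+ 0≤1ℚ 0≤1ℚ) (p≤q⇒0≤q-p K≤)) (p≤q⇒0≤q-p τβ≤))

    -- Take β = d from a box around √n log n whose corner b d is below K, and a from τ < h a. As H τ
    -- ≤ a < b, it follows that H τ β ≤ b d < K.
    large-k : ∀ {τ} → 0ℚ < τ → √n *ᴿ logn <ᴿ κ → L (fromℚ h *ᴿ √n) τ → Bounds √n logn H K τ
    large-k {τ} 0<τ (q , q∈U , q∈L) τ∈L = record
      { β∈U = d∈U ; a∈L = T.c∈L
      ; τβ≤k = ≤-trans (*-mono-≤-0≤ 0≤d 0≤b (≤-trans Hτ≤c (<⇒≤ (L<U √n T.c∈L b∈U))) ≤-refl)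
          (<⇒≤ (<-trans (st<q {b} {d} a≤b ≤-refl c≤d ≤-refl) (L-κ q∈L)))
      ; τ≤a = ≤-trans Hτ≤c (by-≤ T.c (solve 1 (λ c → (con 1ℚ :+ con 1ℚ) :* c :- c := c) refl T.c) (≤-trans 0≤Hτ Hτ≤c)) }
      where
      open UpperBox (upperBox √n logn q∈U)
      module T = LowerBox (lowerBox (fromℚ h) √n τ∈L)
      0≤d : 0ℚ ≤ d
      0≤d = <⇒≤ (0<log-upper d∈U)
      Hτ≤c : H * τ ≤ T.c
      Hτ≤c = ≤-trans (*-monoˡ-≤-nonNeg H {{nonNegative 0≤H}} (<⇒≤ (T.q<st {h} {T.c} (<⇒≤ (L-fromℚ h T.a∈L)) (<⇒≤ (U-fromℚ h T.b∈U)) ≤-refl T.c≤d)))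
        (≤-reflexive (trans (sym (*-assoc H h T.c)) (trans (cong (_* T.c) Hh≡1) (*-identityˡ T.c))))
      0≤Hτ : 0ℚ ≤ H * τ
      0≤Hτ = 0≤* 0≤H (<⇒≤ 0<τ)
      0≤b : 0ℚ ≤ b
      0≤b = ≤-trans 0≤Hτ (≤-trans Hτ≤c (<⇒≤ (L<U √n T.c∈L b∈U)))

  -- Consequences of a violated bound

  module _ {k n : ℕ} .{{_ : ℕ.NonZero k}} {A : Family k n} (unique : Unique A) where

    private
      α K : ℚ
      α = density A
      K = fromℕᵣ k

    0<K : 0ℚ < K
    0<K = <-≤-trans 0<1ℚ (fromℕᵣ-mono (ℕ.>-nonZero⁻¹ k))

    density*kⁿ : α * K ^ n ≡ size A
    density*kⁿ = trans (cong (α *_) (sym (fromℕᵣ-^ k n)))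
      (trans (/-*-cancel (length A) (k ℕ.^ n) {{ℕ.m^n≢0 k n}})
        (sym (trans (∑-const A 1ℚ) (*-identityʳ (fromℕᵣ (length A))))))

    density≤1 : α ≤ 1ℚ
    density≤1 = *-cancelʳ-≤-pos (K ^ n) {{positive (0<^ n 0<K)}} (subst₂ _≤_ (sym density*kⁿ) (sym (*-identityˡ (K ^ n)))
      (subst (_≤ K ^ n) (trans (cong (λ m → K ^ m * count A ⊥) (∣⊥∣≡0 (n ℕ.* k))) (trans (*-identityˡ (count A ⊥)) (count-⊥ unique)))
        (count-bound unique ⊥)))

    module _ {τ : ℚ} {N : ℕ} (0≤1+τ/N : 0ℚ ≤ 1+ τ ÷suc N) (tail : fromℕᵣ 128 < α * (1+ τ ÷suc N) ^ suc N) where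

      private
        X : ℚ
        X = (1+ τ ÷suc N) ^ suc N
        0≤X : 0ℚ ≤ X
        0≤X = 0≤^ (suc N) 0≤1+τ/N

      0<α : 0ℚ < α
      0<α = 0<pq⇒0<p {α} {X} (≤-<-trans (0≤fromℕᵣ 128) tail) 0≤X

      -- A density is at most 1 and approximations of exp at τ ≤ 1 are at most 4, which is below
      -- 128. So rounding τ up at most doubles it.
      1<τ : 1ℚ < τ
      1<τ = ≰⇒> λ τ≤1 → <-irrefl refl (<-≤-trans tail (begin
        α * X              ≤⟨ *-monoʳ-≤-nonNeg X {{nonNegative 0≤X}} density≤1 ⟩
        1ℚ * X             ≡⟨ *-identityˡ X ⟩
        X                  ≤⟨ exp-approx≤4^ N 0 τ≤1 0≤1+τ/N ⟩
        4ℚ ^ 1             ≤⟨ toWitness {a? = 4ℚ ^ 1 ≤? fromℕᵣ 128} _ ⟩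
        fromℕᵣ 128         ∎))
        where open ≤-Reasoning

      -- Powers of 4 suit the weights: each point of a maximiser costs a factor k / R = 4.
      dense : ∀ g → τ ≤ fromℕᵣ (suc g) → K ^ n ≤ size A * 4ℚ ^ suc g
      dense g τ≤g = begin
        K ^ n                        ≡⟨ sym (*-identityˡ (K ^ n)) ⟩
        1ℚ * K ^ n                   ≤⟨ *-monoʳ-≤-nonNeg (K ^ n) {{nonNegative (0≤^ n (<⇒≤ 0<K))}} (≤-trans (1≤fromℕᵣ-suc 127) (<⇒≤ tail)) ⟩
        α * X * K ^ n                ≤⟨ *-monoʳ-≤-nonNeg (K ^ n) {{nonNegative (0≤^ n (<⇒≤ 0<K))}}
                                          (*-monoˡ-≤-nonNeg α {{nonNegative (<⇒≤ 0<α)}} (exp-approx≤4^ N g τ≤g 0≤1+τ/N)) ⟩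
        α * 4ℚ ^ suc g * K ^ n       ≡⟨ solve 3 (λ a b c → a :* b :* c := a :* c :* b) refl α (4ℚ ^ suc g) (K ^ n) ⟩
        α * K ^ n * 4ℚ ^ suc g       ≡⟨ cong (_* 4ℚ ^ suc g) density*kⁿ ⟩
        size A * 4ℚ ^ suc g          ∎
        where open ≤-Reasoning

      0<size : 0ℚ < size A
      0<size = subst (0ℚ <_) density*kⁿ (0<* 0<α (0<^ n 0<K))

  -- The constants

  below-twice : ∀ {g x G} → G ≡ 1ℚ + g → g < x → 1ℚ < x → G ≤ 2ℚ * x
  below-twice {g} {x} refl g<x 1<x = by-≤ ((x - g) + (x - 1ℚ))
    (solve 2 (λ g x → (con 1ℚ :+ con 1ℚ) :* x :- (con 1ℚ :+ g) := (x :- g) :+ (x :- con 1ℚ)) refl g x)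
    (0≤+ (p≤q⇒0≤q-p (<⇒≤ g<x)) (p≤q⇒0≤q-p (<⇒≤ 1<x)))

  -- Rounding up costs at most 1, which is less than 2 x when x > ½.
  below-thrice : ∀ {g x G} → G ≡ 1ℚ + g → g < x → ½ < x → G ≤ fromℕᵣ 3 * x
  below-thrice {g} {x} refl g<x ½<x = by-≤ ((x - g) + 2ℚ * (x - ½))
    (solve 2 (λ g x → con (fromℕᵣ 3) :* x :- (con 1ℚ :+ g) := (x :- g) :+ (con 1ℚ :+ con 1ℚ) :* (x :- con ½)) refl g x)
    (0≤+ (p≤q⇒0≤q-p (<⇒≤ g<x)) (0≤* (0≤+ 0≤1ℚ 0≤1ℚ) (p≤q⇒0≤q-p (<⇒≤ ½<x))))

  module _ {H K τ β : ℚ} (3072≤H : fromℕᵣ 3072 ≤ H) (1<τ : 1ℚ < τ) (½<β : ½ < β) (Hτβ≤K : H * τ * β ≤ K) where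

    private
      0≤τ : 0ℚ ≤ τ
      0≤τ = <⇒≤ (<-trans 0<1ℚ 1<τ)
      0≤β : 0ℚ ≤ β
      0≤β = <⇒≤ (<-trans 0<½ ½<β)
      0≤excess : 0ℚ ≤ ¼ * (K - H * τ * β) + ¼ * (H - fromℕᵣ 3072) * τ * β
      0≤excess = 0≤+ (0≤* (toWitness {a? = 0ℚ ≤? ¼} _) (p≤q⇒0≤q-p Hτβ≤K))
        (0≤* (0≤* (0≤* (toWitness {a? = 0ℚ ≤? ¼} _) (p≤q⇒0≤q-p 3072≤H)) 0≤τ) 0≤β)

    -- 4 G ≤ 8 τ ≤ 384 τ ≤ 768 τ β ≤ ¼ K; the 376 below is 384 - 8.
    4G≤¼K : ∀ {G} → G ≤ 2ℚ * τ → 4ℚ * G ≤ ¼ * K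
    4G≤¼K {G} G≤2τ = by-≤ (¼ * (K - H * τ * β) + ¼ * (H - fromℕᵣ 3072) * τ * β
        + (fromℕᵣ 768 * τ * (β - ½) + fromℕᵣ 376 * τ + 4ℚ * (2ℚ * τ - G)))
      (solve 5 (λ H K τ β G → con ¼ :* K :- con 4ℚ :* G :=
        con ¼ :* (K :- H :* τ :* β) :+ con ¼ :* (H :- con (fromℕᵣ 3072)) :* τ :* β
        :+ (con (fromℕᵣ 768) :* τ :* (β :- con ½) :+ con (fromℕᵣ 376) :* τ :+ con 4ℚ :* (con 2ℚ :* τ :- G))) refl H K τ β G)
      (0≤+ 0≤excess (0≤+ (0≤+ (0≤* (0≤* (0≤fromℕᵣ 768) 0≤τ) (p≤q⇒0≤q-p (<⇒≤ ½<β))) (0≤* (0≤fromℕᵣ 376) 0≤τ))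
        (0≤* (0≤fromℕᵣ 4) (p≤q⇒0≤q-p G≤2τ))))

    -- The origin of 3072 = 4 * 256 * 3: 256 G ≤ 768 β ≤ 768 τ β ≤ ¼ H τ β ≤ ¼ K.
    256G≤¼K : ∀ {G} → G ≤ fromℕᵣ 3 * β → fromℕᵣ 128 * (G + G) ≤ ¼ * K
    256G≤¼K {G} G≤3β = by-≤ (¼ * (K - H * τ * β) + ¼ * (H - fromℕᵣ 3072) * τ * β
        + (fromℕᵣ 768 * (τ - 1ℚ) * β + fromℕᵣ 256 * (fromℕᵣ 3 * β - G)))
      (solve 5 (λ H K τ β G → con ¼ :* K :- con (fromℕᵣ 128) :* (G :+ G) :=
        con ¼ :* (K :- H :* τ :* β) :+ con ¼ :* (H :- con (fromℕᵣ 3072)) :* τ :* β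
        :+ (con (fromℕᵣ 768) :* (τ :- con 1ℚ) :* β :+ con (fromℕᵣ 256) :* (con (fromℕᵣ 3) :* β :- G))) refl H K τ β G)
      (0≤+ 0≤excess (0≤+ (0≤* (0≤* (0≤fromℕᵣ 768) (p≤q⇒0≤q-p (<⇒≤ 1<τ))) 0≤β)
        (0≤* (0≤fromℕᵣ 256) (p≤q⇒0≤q-p G≤3β))))

  G≤a : ∀ {H τ G a} → 4ℚ ≤ H → 0ℚ ≤ τ → G ≤ 2ℚ * τ → H * τ ≤ 2ℚ * a → G ≤ a
  G≤a {H} {τ} {G} {a} 4≤H 0≤τ G≤2τ Hτ≤2a = by-≤ (½ * (2ℚ * a - H * τ) + ½ * (H - 4ℚ) * τ + (2ℚ * τ - G))
    (solve 4 (λ H τ G a → a :- G := con ½ :* (con 2ℚ :* a :- H :* τ) :+ con ½ :* (H :- con 4ℚ) :* τ :+ (con 2ℚ :* τ :- G)) refl H τ G a)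
    (0≤+ (0≤+ (0≤* (<⇒≤ 0<½) (p≤q⇒0≤q-p Hτ≤2a)) (0≤* (0≤* (<⇒≤ 0<½) (p≤q⇒0≤q-p 4≤H)) 0≤τ)) (p≤q⇒0≤q-p G≤2τ))

  n<2^2h : ∀ {n} h → fromℕᵣ n < 4ℚ ^ h → n ℕ.< 2 ℕ.^ (h ℕ.+ h)
  n<2^2h {n} h n<4^h = fromℕᵣ-cancel-< {n} {2 ℕ.^ (h ℕ.+ h)} (subst (fromℕᵣ n <_)
    (sym (trans (fromℕᵣ-^ 2 (h ℕ.+ h)) (trans (^-homo-* (fromℕᵣ 2) h h) (sym (^-distrib-* (fromℕᵣ 2) (fromℕᵣ 2) h))))) n<4^h)

  bounds-impossible : ∀ {n k} .{{_ : ℕ.NonZero k}} (2≤n : 2 ℕ.≤ n) {A : Family k n} → Unique A → TransitiveSymmetric A → VectorIntersecting A →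
    ∀ {H τ N} → fromℕᵣ 3072 ≤ H → 0ℚ ≤ 1+ τ ÷suc N → fromℕᵣ 128 < density A * (1+ τ ÷suc N) ^ suc N →
    ¬ Bounds (√ (fromℕ n)) (logℕ n 2≤n) H (fromℕᵣ k) τ
  bounds-impossible {n} {k} 2≤n {A} unique symmetric intersecting {H} {τ} {N} 3072≤H 0≤A tail bounds =
    impossible (natural-ceiling 0<τ) (natural-ceiling 0<β)
    where
    open Bounds bounds
    1<τ′ : 1ℚ < τ
    1<τ′ = 1<τ unique {τ} {N} 0≤A tail
    0<τ : 0ℚ < τ
    0<τ = <-trans 0<1ℚ 1<τ′
    ½<β : ½ < β
    ½<β = ½<log {n} 2≤n {β} β∈U
    0<β : 0ℚ < β
    0<β = <-trans 0<½ ½<β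

    impossible : ∃[ g ] fromℕᵣ g < τ × τ ≤ fromℕᵣ (suc g) → ∃[ h ] fromℕᵣ h < β × β ≤ fromℕᵣ (suc h) → Empty.⊥
    -- The rounded-up τ, g + 1, bounds the maximisers. There are 2 (h + 1) rounds because n < 4 ^ (h
    -- + 1), where h + 1 is β rounded up.
    impossible (g , g<τ , τ≤g) (h , h<β , β≤h) = dense-impossible {k} {n} {suc g} {h ℕ.+ suc h} {A} unique symmetric intersecting
      {¼ * fromℕᵣ k} (solve 1 (λ K → K := con 4ℚ :* (con ¼ :* K)) refl (fromℕᵣ k))
      (0<size unique {τ} {N} 0≤A tail) (dense unique {τ} {N} 0≤A tail g τ≤g)
      (≤-<-trans (*-mono-≤-0≤ (0≤fromℕᵣ (suc g)) (<⇒≤ 0<a) G≤a′ G≤a′) (L-√ n 0<a a∈L))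
      4G≤R (≤-trans (≤-trans (1≤fromℕᵣ-suc g) G≤4G) 4G≤R)
      (subst (λ T → fromℕᵣ 128 * T ≤ ¼ * fromℕᵣ k) (sym (fromℕᵣ-+ (suc h) (suc h)))
        (256G≤¼K 3072≤H 1<τ′ ½<β τβ≤k (below-thrice (fromℕᵣ-suc h) h<β ½<β)))
      (n<2^2h {n} (suc h) (log<⇒<4^ {n} 2≤n {β} β∈U h β≤h))
      where
      G : ℚ
      G = fromℕᵣ (suc g)
      G≤2τ : G ≤ 2ℚ * τ
      G≤2τ = below-twice (fromℕᵣ-suc g) g<τ 1<τ′
      4G≤R : 4ℚ * G ≤ ¼ * fromℕᵣ k
      4G≤R = 4G≤¼K 3072≤H 1<τ′ ½<β τβ≤k G≤2τ
      G≤4G : G ≤ 4ℚ * G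
      G≤4G = by-≤ (fromℕᵣ 3 * G) (solve 1 (λ G → con 4ℚ :* G :- G := con (fromℕᵣ 3) :* G) refl G) (0≤* (0≤fromℕᵣ 3) (0≤fromℕᵣ (suc g)))
      G≤a′ : G ≤ a
      G≤a′ = G≤a {H} {τ} {G} {a} (≤-trans (toWitness {a? = 4ℚ ≤? fromℕᵣ 3072} _) 3072≤H) (<⇒≤ 0<τ) G≤2τ τ≤a
      0<a : 0ℚ < a
      0<a = <-≤-trans 0<1ℚ (≤-trans (1≤fromℕᵣ-suc g) G≤a′)

  -- As the right-hand side is located, it suffices to refute that it is less than α.
  ≤ᴿ-tail : ∀ {α t} → (∀ {τ N} → L t τ → 0ℚ ≤ 1+ τ ÷suc N → ¬ fromℕᵣ 128 < α * (1+ τ ÷suc N) ^ suc N) →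
            fromℚ α ≤ᴿ fromℕ 128 *ᴿ exp (-ᴿ t)
  ≤ᴿ-tail {α} {t} no-tail q (r , q<r , r≤α) =
    let s , q<s , s<r = <-dense q<r
    in [ id , (λ s∈U → let τ , N , τ∈L , 0≤A , tail = exp-tail {t} {α} {s} s∈U (<-≤-trans s<r r≤α)
                       in contradiction tail (no-tail {τ} {N} τ∈L 0≤A)) ]′ (located (fromℕ 128 *ᴿ exp (-ᴿ t)) q<s)

  3072≤10⁴ : fromℕᵣ 3072 ≤ fromℕᵣ 10000
  3072≤10⁴ = fromℕᵣ-mono (ℕ.≤ᵇ⇒≤ 3072 10000 _)

  module _ {n k : ℕ} .{{_ : ℕ.NonZero k}} (2≤n : 2 ℕ.≤ n) {A : Family k n} (unique : Unique A)
           (symmetric : TransitiveSymmetric A) (intersecting : VectorIntersecting A)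
           {h H : ℚ} (0<h : 0ℚ < h) (3072≤H : fromℕᵣ 3072 ≤ H) (Hh≡1 : H * h ≡ 1ℚ) where

    private
      0≤H : 0ℚ ≤ H
      0≤H = ≤-trans (0≤fromℕᵣ 3072) 3072≤H
      0<log-upper : ∀ {β} → ℝ.U (logℕ n 2≤n) β → 0ℚ < β
      0<log-upper {β} β∈U = <-trans 0<½ (½<log {n} 2≤n {β} β∈U)

    moderate-k-bound : fromℕ k ≤ᴿ √ (fromℕ n) *ᴿ logℕ n 2≤n →
      fromℚ (density A) ≤ᴿ fromℕ 128 *ᴿ exp (-ᴿ (fromℚ h *ᴿ fromℕ k ÷ᴿ logℕ n 2≤n [ 0<logℕ 2≤n ]))
    moderate-k-bound k≤ = ≤ᴿ-tail {density A} {fromℚ h *ᴿ fromℕ k ÷ᴿ logℕ n 2≤n [ 0<logℕ 2≤n ]} λ {τ} {N} τ∈L 0≤A tail →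
      bounds-impossible {n} {k} 2≤n {A} unique symmetric intersecting {H} {τ} {N} 3072≤H 0≤A tail
        (moderate {√ (fromℕ n)} {logℕ n 2≤n} {fromℕ k} {h} {H} {fromℕᵣ k} 0<h 0≤H Hh≡1 (λ {q} → L-fromℚ (fromℕᵣ k) {q}) (λ {q} → U-fromℚ (fromℕᵣ k) {q}) (λ {q} q<K → fromℕᵣ k , q<K , ≤-refl) (λ {β} → 0<log-upper {β}) (0<K unique) {0<logℕ 2≤n} {τ}
          (<-trans 0<1ℚ (1<τ unique {τ} {N} 0≤A tail)) k≤ τ∈L)

    large-k-bound : √ (fromℕ n) *ᴿ logℕ n 2≤n <ᴿ fromℕ k → fromℚ (density A) ≤ᴿ fromℕ 128 *ᴿ exp (-ᴿ (fromℚ h *ᴿ √ (fromℕ n)))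
    large-k-bound <k = ≤ᴿ-tail {density A} {fromℚ h *ᴿ √ (fromℕ n)} λ {τ} {N} τ∈L 0≤A tail →
      bounds-impossible {n} {k} 2≤n {A} unique symmetric intersecting {H} {τ} {N} 3072≤H 0≤A tail
        (large-k {√ (fromℕ n)} {logℕ n 2≤n} {fromℕ k} {h} {H} {fromℕᵣ k} 0<h 0≤H Hh≡1 (λ {q} → L-fromℚ (fromℕᵣ k) {q}) (λ {q} → U-fromℚ (fromℕᵣ k) {q}) (λ {q} q<K → fromℕᵣ k , q<K , ≤-refl) (λ {β} → 0<log-upper {β}) {τ}
          (<-trans 0<1ℚ (1<τ unique {τ} {N} 0≤A tail)) <k τ∈L)

open import Data.Integer using (1ℤ)
open import Data.List.Relation.Unary.Unique.Propositional using (Unique)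
open import Data.Nat using (ℕ; NonZero; _≤_)
open import Data.Product using (_×_; _,_)
open import Data.Rational using (_/_)

mainTheorem15 : ∀ (n k : ℕ) .{{_ : NonZero k}} (2≤n : 2 ≤ n) (A : Family k n) →
    Unique A → TransitiveSymmetric A → VectorIntersecting A →
    (fromℕ 2 *ᴿ logℕ n 2≤n ≤ᴿ fromℕ k → fromℕ k ≤ᴿ √ (fromℕ n) *ᴿ logℕ n 2≤n →
    fromℚ (density A) ≤ᴿ fromℕ 128 *ᴿ exp (-ᴿ (fromℚ (1ℤ / 10000) *ᴿ fromℕ k ÷ᴿ logℕ n 2≤n [ 0<logℕ 2≤n ])))
    ×
    (√ (fromℕ n) *ᴿ logℕ n 2≤n <ᴿ fromℕ k →
    fromℚ (density A) ≤ᴿ fromℕ 128 *ᴿ exp (-ᴿ (fromℚ (1ℤ / 10000) *ᴿ √ (fromℕ n))))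
mainTheorem15 n k 2≤n A unique symmetric intersecting =
  (λ _ → moderate-k-bound {n} {k} 2≤n {A} unique symmetric intersecting {1ℤ / 10000} {fromℕᵣ 10000}
    (0<unit-fraction 9999) 3072≤10⁴ (unit-fraction 9999)) ,
  large-k-bound {n} {k} 2≤n {A} unique symmetric intersecting {1ℤ / 10000} {fromℕᵣ 10000}
    (0<unit-fraction 9999) 3072≤10⁴ (unit-fraction 9999)
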